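{- Let $\Gamma$ be a vertex- and arc-transitive two-ended digraph and $G=\mathrm{Aut}(\Gamma)$. Let $N$ be a normal subgroup of $G$ with finite orbits on $V\Gamma$ such that either (i) $\Gamma/N\cong\mathbb Z$ and $G/N\cong D_\infty$, or (ii) $\Gamma/N\cong\vec{\mathbb Z}$ and $G/N\cong\mathbb Z$ (such an $N$ always exists). Let $\varphi$ be the surjective digraph homomorphism from $\Gamma$ onto the digraph $\mathbb Z$ in case (i), respectively onto $\vec{\mathbb Z}$ in case (ii), obtained by composing the quotient map $\Gamma\to\Gamma/N$ with such an isomorphism, and set $\Gamma_i=\varphi^{ -1}(i)$ for $i\in\mathbb Z$. Then: (a) Case (i) occurs precisely when every vertex $v$ in $\Gamma_i$ (for every $i$) has both in-neighbours and out-neighbours in each of $\Gamma_{i-1}$ and $\Gamma_{i+1}$. In this case the number of out-neighbours of $v$ in $\Gamma_{i-1}$ is the same as the number of out-neighbours in $\Gamma_{i+1}$, and the same holds for the numbers of in-neighbours; and the subdigraph spanned by $\Gamma_i\cup\Gamma_{i+1}$ is bipartite (i.e. its underlying undirected graph is bipartite) and is both vertex- and arc-transitive. (b) Case (ii) occurs precisely when every vertex $v$ in $\Gamma_i$ (for every $i$) has all of its in-neighbours in $\Gamma_{i-1}$ and all of its out-neighbours in $\Gamma_{i+1}$. In this case the subdigraph spanned by $\Gamma_i\cup\Gamma_{i+1}$ is bipartite and arc-transitive, and all its arcs have their initial vertex in $\Gamma_i$ and terminal vertex in $\Gamma_{i+1}$. (c) The in-valency of $\Gamma$ is equal to the out-valency.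 (d) If the out-valency of $\Gamma$ is odd, then $\Gamma$ has Property Z. (e) If $\Gamma$ is 2-arc-transitive, then $\Gamma/N\cong\vec{\mathbb Z}$ and $\Gamma$ has Property Z. (f) If $\Gamma$ is locally quasi-primitive and the stabilizer in $G$ of a vertex has more than 2 elements, then $\Gamma$ has Property Z. (g) Suppose that the out-valency is 2. If the stabilizer in $G$ of a vertex has more than 2 elements, then $\Gamma$ has Property Z.
   Context: A digraph $\Gamma=(V\Gamma,E\Gamma)$ has vertex set $V\Gamma$ and arc set $E\Gamma\subseteq V\Gamma\times V\Gamma$; both $(v,w)$ and $(w,v)$ may be arcs. It is connected if its underlying undirected graph is connected. For a vertex $v$, $\mathrm{in}(v)=\{u:(u,v)\in E\Gamma\}$ (in-neighbours) and $\mathrm{out}(v)=\{u:(v,u)\in E\Gamma\}$ (out-neighbours); their cardinalities are the in-valency and out-valency. $\Gamma$ is vertex-transitive (arc-transitive, 2-arc-transitive) if $\mathrm{Aut}(\Gamma)$ is transitive on vertices (arcs, 2-arcs), where a 2-arc is a sequence $v_0,v_1,v_2$ with $(v_0,v_1),(v_1,v_2)\in E\Gamma$. The subdigraph spanned by a set of vertices is the induced subdigraph. A ray is a one-way infinite path (in the underlying undirected graph) with distinct vertices. The ends of a digraph are the equivalence classes of rays, where two rays are equivalent if there is an infinite family of pairwise disjoint paths (ignoring directions) each having its initial vertex in one ray and terminal vertex in the other. A digraph is two-ended if it is connected and has exactly two ends; two-ended vertex-transitive digraphs are locally finite. The symbol $\mathbb Z$ denotes both the group of integers and the digraph with vertex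 set $\mathbb Z$ and arcs $(i,i+1)$ and $(i+1,i)$ for all $i\in\mathbb Z$; $\vec{\mathbb Z}$ is the digraph with vertex set $\mathbb Z$ and arcs $(i,i+1)$ for all $i\in\mathbb Z$. $D_\infty$ is the infinite dihedral group. For a subgroup $N\le\mathrm{Aut}(\Gamma)$, the quotient digraph $\Gamma/N$ has the $N$-orbits on $V\Gamma$ as vertices, and $(A,B)$ is an arc of $\Gamma/N$ iff there are $v\in A$, $w\in B$ with $(v,w)\in E\Gamma$. A digraph homomorphism is a map on vertices sending arcs to arcs (preserving direction). A connected digraph $\Gamma$ has Property Z if there is a surjective digraph homomorphism $\Gamma\to\vec{\mathbb Z}$. A transitive group action is quasi-primitive if every normal subgroup acts either trivially or transitively. A vertex-transitive digraph $\Gamma$ is locally quasi-primitive if the stabilizer of a vertex $v$ in $\mathrm{Aut}(\Gamma)$ acts quasi-primitively on both $\mathrm{in}(v)$ and $\mathrm{out}(v)$. -}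

module Defs where

open import Level using (Level; _⊔_; suc; 0ℓ)
open import Algebra.Bundles using (Group)
open import Algebra.Morphism.Structures using (IsGroupIsomorphism)
import Algebra.Properties.Group as GroupProperties
open import Data.Bool.Base using (Bool)
open import Data.Fin.Base using (Fin; zero; inject₁; fromℕ)
  renaming (suc to fsuc)
open import Data.Integer.Base as ℤ using (ℤ; 0ℤ; 1ℤ)
import Data.Integer.Properties as ℤ
open import Data.Nat.Base as ℕ using (ℕ)
open import Data.Product.Base using (Σ; Σ-syntax; ∃-syntax; ∃₂; _×_; _,_; proj₁; proj₂)
open import Data.Sign.Base as Sign using (Sign)
import Data.Sign.Properties as Sign
open import Data.Sum.Base using (_⊎_; inj₁; inj₂)
open import Function.Base using (_∘_; id)
open import Function.Bundles using (Inverse; Injection)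
import Function.Construct.Composition as Composition
import Function.Construct.Identity as Identity
import Function.Construct.Symmetry as Symmetry
open import Function.Definitions using (Congruent; Injective; Surjective)
open import Relation.Binary.Bundles using (Setoid)
open import Relation.Binary.Core using (Rel)
import Relation.Binary.Construct.On as On
open import Relation.Binary.PropositionalEquality as ≡ using (_≡_; _≢_; refl; cong; cong₂)
open import Relation.Nullary.Negation.Core using (¬_)
open import Relation.Unary using (Pred)

private
  variable
    c ℓ e c′ ℓ′ e′ p q : Level

subset : (S : Setoid c ℓ) → Pred (Setoid.Carrier S) p → Setoid (c ⊔ p) ℓ
subset S P = On.setoid {B = Σ (Setoid.Carrier S) P} S proj₁

HasSize : Setoid c ℓ → ℕ → Set (c ⊔ ℓ)
HasSize S n = Inverse (≡.setoid (Fin n)) S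

Finite : Setoid c ℓ → Set (c ⊔ ℓ)
Finite S = ∃[ n ] HasSize S n

SameSize : Setoid c ℓ → Setoid c′ ℓ′ → Set (c ⊔ ℓ ⊔ c′ ⊔ ℓ′)
SameSize S T = Inverse S T

MoreThanTwoElements : Setoid c ℓ → Set (c ⊔ ℓ)
MoreThanTwoElements S = Injection (≡.setoid (Fin 3)) S

record NormalSubgroup (G : Group c ℓ) (p : Level) : Set (c ⊔ ℓ ⊔ suc p) where
  open Group G
  field
    Member      : Pred Carrier p
    resp        : ∀ {g h} → g ≈ h → Member g → Member h
    ε-closed    : Member ε
    ∙-closed    : ∀ {g h} → Member g → Member h → Member (g ∙ h)
    ⁻¹-closed   : ∀ {g} → Member g → Member (g ⁻¹)
    conj-closed : ∀ g {n} → Member n → Member (g ∙ n ∙ g ⁻¹)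

-- The carrier of G / N is that of G; two elements are identified when
-- they lie in the same coset of N.
_/ᴳ_ : (G : Group c ℓ) → NormalSubgroup G p → Group c p
_/ᴳ_ {c = c} {p = p} G N = record
  { Carrier = Carrier
  ; _≈_     = _∼_
  ; _∙_     = _∙_
  ; ε       = ε
  ; _⁻¹     = _⁻¹
  ; isGroup = record
    { isMonoid = record
      { isSemigroup = record
        { isMagma = record
          { isEquivalence = record
            { refl  = ≈⇒∼ G.refl
            ; sym   = ∼-sym
            ; trans = ∼-trans
            }
          ; ∙-cong = ∼-∙-cong
          }
        ; assoc = λ x y z → ≈⇒∼ (assoc x y z)
        }
      ; identity = (λ x → ≈⇒∼ (identityˡ x)) , (λ x → ≈⇒∼ (identityʳ x))
      }
    ; inverse = (λ x → ≈⇒∼ (inverseˡ x)) , (λ x → ≈⇒∼ (inverseʳ x))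
    ; ⁻¹-cong = ∼-⁻¹-cong
    }
  }
  where
  module G = Group G
  open Group G
  open GroupProperties G
  open NormalSubgroup N
  open import Relation.Binary.Reasoning.Setoid setoid

  _∼_ : Rel Carrier p
  g ∼ h = Member (g ⁻¹ ∙ h)

  ≈⇒∼ : ∀ {g h} → g ≈ h → g ∼ h
  ≈⇒∼ {g} {h} g≈h = resp
    (G.trans (G.sym (inverseˡ g)) (∙-congˡ g≈h)) ε-closed

  cancel-middle : ∀ x y z → (x ∙ y) ∙ (y ⁻¹ ∙ z) ≈ x ∙ z
  cancel-middle x y z = begin
    (x ∙ y) ∙ (y ⁻¹ ∙ z)  ≈⟨ assoc x y (y ⁻¹ ∙ z) ⟩
    x ∙ (y ∙ (y ⁻¹ ∙ z))  ≈⟨ ∙-congˡ (assoc y (y ⁻¹) z) ⟨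
    x ∙ ((y ∙ y ⁻¹) ∙ z)  ≈⟨ ∙-congˡ (∙-congʳ (inverseʳ y)) ⟩
    x ∙ (ε ∙ z)           ≈⟨ ∙-congˡ (identityˡ z) ⟩
    x ∙ z                 ∎

  ∼-sym : ∀ {g h} → g ∼ h → h ∼ g
  ∼-sym {g} {h} n = resp
    (G.trans (⁻¹-anti-homo-∙ (g ⁻¹) h) (∙-congˡ (⁻¹-involutive g)))
    (⁻¹-closed n)

  ∼-trans : ∀ {g h k} → g ∼ h → h ∼ k → g ∼ k
  ∼-trans {g} {h} {k} m n = resp (cancel-middle (g ⁻¹) h k) (∙-closed m n)

  ∼-∙-cong : ∀ {g g′ h h′} → g ∼ g′ → h ∼ h′ → (g ∙ h) ∼ (g′ ∙ h′)
  ∼-∙-cong {g} {g′} {h} {h′} m n = resp eq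
    (∙-closed (conj-closed (h ⁻¹) m) n)
    where
    eq : (h ⁻¹ ∙ (g ⁻¹ ∙ g′) ∙ h ⁻¹ ⁻¹) ∙ (h ⁻¹ ∙ h′) ≈ (g ∙ h) ⁻¹ ∙ (g′ ∙ h′)
    eq = begin
      (h ⁻¹ ∙ (g ⁻¹ ∙ g′) ∙ h ⁻¹ ⁻¹) ∙ (h ⁻¹ ∙ h′)  ≈⟨ ∙-congʳ (∙-congˡ (⁻¹-involutive h)) ⟩
      (h ⁻¹ ∙ (g ⁻¹ ∙ g′) ∙ h) ∙ (h ⁻¹ ∙ h′)        ≈⟨ cancel-middle _ h h′ ⟩
      h ⁻¹ ∙ (g ⁻¹ ∙ g′) ∙ h′                       ≈⟨ ∙-congʳ (assoc (h ⁻¹) (g ⁻¹) g′) ⟨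
      h ⁻¹ ∙ g ⁻¹ ∙ g′ ∙ h′                         ≈⟨ assoc _ g′ h′ ⟩
      h ⁻¹ ∙ g ⁻¹ ∙ (g′ ∙ h′)                       ≈⟨ ∙-congʳ (⁻¹-anti-homo-∙ g h) ⟨
      (g ∙ h) ⁻¹ ∙ (g′ ∙ h′)                        ∎

  ∼-⁻¹-cong : ∀ {g h} → g ∼ h → (g ⁻¹) ∼ (h ⁻¹)
  ∼-⁻¹-cong {g} {h} n = resp eq (conj-closed g (∼-sym n))
    where
    eq : g ∙ (h ⁻¹ ∙ g) ∙ g ⁻¹ ≈ g ⁻¹ ⁻¹ ∙ h ⁻¹
    eq = begin
      g ∙ (h ⁻¹ ∙ g) ∙ g ⁻¹    ≈⟨ ∙-congʳ (assoc g (h ⁻¹) g) ⟨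
      g ∙ h ⁻¹ ∙ g ∙ g ⁻¹      ≈⟨ assoc _ g (g ⁻¹) ⟩
      g ∙ h ⁻¹ ∙ (g ∙ g ⁻¹)    ≈⟨ ∙-congˡ (inverseʳ g) ⟩
      g ∙ h ⁻¹ ∙ ε             ≈⟨ identityʳ _ ⟩
      g ∙ h ⁻¹                 ≈⟨ ∙-congʳ (⁻¹-involutive g) ⟨
      g ⁻¹ ⁻¹ ∙ h ⁻¹           ∎

_≅ᴳ_ : Group c ℓ → Group c′ ℓ′ → Set (c ⊔ ℓ ⊔ c′ ⊔ ℓ′)
G ≅ᴳ H = ∃[ f ] IsGroupIsomorphism (Group.rawGroup G) (Group.rawGroup H) f

record Action (G : Group c ℓ) (X : Setoid c′ ℓ′) : Set (c ⊔ ℓ ⊔ c′ ⊔ ℓ′) where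
  private
    module G = Group G
    module X = Setoid X
  infixr 6 _·_
  field
    _·_    : G.Carrier → X.Carrier → X.Carrier
    ·-cong : ∀ {g h x y} → g G.≈ h → x X.≈ y → (g · x) X.≈ (h · y)
    ε-act  : ∀ x → (G.ε · x) X.≈ x
    ∙-act  : ∀ g h x → ((g G.∙ h) · x) X.≈ (g · h · x)

QuasiPrimitive : {G : Group c ℓ} {X : Setoid c′ ℓ′} →
                 Action G X → Set (suc c ⊔ ℓ ⊔ c′ ⊔ ℓ′)
QuasiPrimitive {c = c} {G = G} {X = X} A =
    (∀ x y → ∃[ g ] (g · x) ≈ y)
  × ((N : NormalSubgroup G c) → let open NormalSubgroup N in
       (∀ n x → Member n → (n · x) ≈ x)
     ⊎ (∀ x y → ∃[ n ] Member n × (n · x) ≈ y))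
  where
  open Action A
  open Setoid X using (_≈_)

ℤ-group : Group 0ℓ 0ℓ
ℤ-group = record { isGroup = ℤ.+-0-isGroup }

infixr 7 _⋆_
_⋆_ : Sign → ℤ → ℤ
Sign.+ ⋆ k = k
Sign.- ⋆ k = ℤ.- k

-- D∞ as the semidirect product ℤ ⋊ {±1}, with -1 acting on ℤ by negation.
D∞ : Group 0ℓ 0ℓ
D∞ = record
  { Carrier = ℤ × Sign
  ; _≈_     = _≡_
  ; _∙_     = λ (k , s) (l , t) → k ℤ.+ s ⋆ l , s Sign.* t
  ; ε       = 0ℤ , Sign.+
  ; _⁻¹     = λ (k , s) → ℤ.- (s ⋆ k) , s
  ; isGroup = record
    { isMonoid = record
      { isSemigroup = record
        { isMagma = record
          { isEquivalence = ≡.isEquivalence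
          ; ∙-cong        = λ { refl refl → refl }
          }
        ; assoc = λ (k , s) (l , t) (m , u) → cong₂ _,_
            (≡.trans (ℤ.+-assoc k (s ⋆ l) ((s Sign.* t) ⋆ m))
                     (cong (ℤ._+_ k) (⋆-distrib s t l m)))
            (Sign.*-assoc s t u)
        }
      ; identity = (λ (k , s) → cong (_, s) (ℤ.+-identityˡ k))
                 , (λ (k , s) → cong₂ _,_
                     (≡.trans (cong (ℤ._+_ k) (⋆-zero s)) (ℤ.+-identityʳ k))
                     (Sign.*-identityʳ s))
      }
    ; inverse = (λ (k , s) → cong₂ _,_ (ℤ.+-inverseˡ (s ⋆ k)) (Sign.s*s≡+ s))
              , (λ (k , s) → cong₂ _,_
                  (≡.trans (cong (ℤ._+_ k) (⋆-neg s k)) (ℤ.+-inverseʳ k))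
                  (Sign.s*s≡+ s))
    ; ⁻¹-cong = λ { refl → refl }
    }
  }
  where
  ⋆-zero : ∀ s → s ⋆ 0ℤ ≡ 0ℤ
  ⋆-zero Sign.+ = refl
  ⋆-zero Sign.- = refl

  ⋆-neg : ∀ s k → s ⋆ (ℤ.- (s ⋆ k)) ≡ ℤ.- k
  ⋆-neg Sign.+ k = refl
  ⋆-neg Sign.- k = ℤ.neg-involutive (ℤ.- k)

  ⋆-distrib : ∀ s t l m → s ⋆ l ℤ.+ (s Sign.* t) ⋆ m ≡ s ⋆ (l ℤ.+ t ⋆ m)
  ⋆-distrib Sign.+ t      l m = refl
  ⋆-distrib Sign.- Sign.+ l m = ≡.sym (ℤ.neg-distrib-+ l m)
  ⋆-distrib Sign.- Sign.- l m = ≡.sym (≡.trans (ℤ.neg-distrib-+ l (ℤ.- m))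
    (cong (ℤ._+_ (ℤ.- l)) (ℤ.neg-involutive m)))

-- The vertices form a setoid, so that the quotient digraph can have the
-- orbits of a group of automorphisms as its vertices.
record Digraph (c ℓ e : Level) : Set (suc (c ⊔ ℓ ⊔ e)) where
  field
    vertices : Setoid c ℓ
  open Setoid vertices public renaming (Carrier to V)
  field
    E      : Rel V e
    E-resp : ∀ {u u′ v v′} → u ≈ u′ → v ≈ v′ → E u v → E u′ v′

  In : V → Pred V e
  In v u = E u v

  Out : V → Pred V e
  Out v u = E v u

  Adjacent : Rel V e
  Adjacent u v = E u v ⊎ E v u

ℤ-digraph : Digraph 0ℓ 0ℓ 0ℓ
ℤ-digraph = record
  { vertices = ≡.setoid ℤ
  ; E        = λ i j → j ≡ i ℤ.+ 1ℤ ⊎ i ≡ j ℤ.+ 1ℤ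
  ; E-resp   = λ { refl refl a → a }
  }

ℤ⃗-digraph : Digraph 0ℓ 0ℓ 0ℓ
ℤ⃗-digraph = record
  { vertices = ≡.setoid ℤ
  ; E        = λ i j → j ≡ i ℤ.+ 1ℤ
  ; E-resp   = λ { refl refl a → a }
  }

induced : (Γ : Digraph c ℓ e) → Pred (Digraph.V Γ) p → Digraph (c ⊔ p) ℓ e
induced Γ P = record
  { vertices = subset vertices P
  ; E        = λ (u , _) (v , _) → E u v
  ; E-resp   = E-resp
  }
  where open Digraph Γ

record Homomorphism (Γ : Digraph c ℓ e) (Δ : Digraph c′ ℓ′ e′)
                    : Set (c ⊔ ℓ ⊔ e ⊔ c′ ⊔ ℓ′ ⊔ e′) where
  private
    module Γ = Digraph Γ
    module Δ = Digraph Δ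
  field
    to      : Γ.V → Δ.V
    to-cong : Congruent Γ._≈_ Δ._≈_ to
    to-arc  : ∀ {u v} → Γ.E u v → Δ.E (to u) (to v)

record Isomorphism (Γ : Digraph c ℓ e) (Δ : Digraph c′ ℓ′ e′)
                   : Set (c ⊔ ℓ ⊔ e ⊔ c′ ⊔ ℓ′ ⊔ e′) where
  private
    module Γ = Digraph Γ
    module Δ = Digraph Δ
  field
    inverse-maps : Inverse Γ.vertices Δ.vertices
  open Inverse inverse-maps public
  field
    to-arc   : ∀ {u v} → Γ.E u v → Δ.E (to u) (to v)
    from-arc : ∀ {u v} → Δ.E u v → Γ.E (from u) (from v)

HasPropertyZ : Digraph c ℓ e → Set (c ⊔ ℓ ⊔ e)
HasPropertyZ Γ = Σ[ f ∈ Homomorphism Γ ℤ⃗-digraph ]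
  Surjective (Digraph._≈_ Γ) _≡_ (Homomorphism.to f)

InValency OutValency : Digraph c ℓ e → ℕ → Set (c ⊔ ℓ ⊔ e)
InValency  Γ n = ∀ v → HasSize (subset vertices (In v)) n
  where open Digraph Γ
OutValency Γ n = ∀ v → HasSize (subset vertices (Out v)) n
  where open Digraph Γ

Bipartite : Digraph c ℓ e → Set (c ⊔ ℓ ⊔ e)
Bipartite Γ = Σ[ side ∈ (V → Bool) ]
    Congruent _≈_ _≡_ side
  × (∀ {u v} → Adjacent u v → side u ≢ side v)
  where open Digraph Γ

module _ (Γ : Digraph c ℓ e) where
  open Digraph Γ

  -- A single vertex counts as a path, so rays sharing infinitely many
  -- vertices are equivalent.
  record Path : Set (c ⊔ ℓ ⊔ e) where
    field
      length   : ℕ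
      at       : Fin (ℕ.suc length) → V
      adjacent : ∀ i → Adjacent (at (inject₁ i)) (at (fsuc i))
      distinct : Injective _≡_ _≈_ at

    initial terminal : V
    initial  = at zero
    terminal = at (fromℕ length)

  Disjoint : Path → Path → Set ℓ
  Disjoint P Q = ∀ i j → ¬ Path.at P i ≈ Path.at Q j

  Connected : Set (c ⊔ ℓ ⊔ e)
  Connected = ∀ u v → Σ[ P ∈ Path ] Path.initial P ≈ u × Path.terminal P ≈ v

  record Ray : Set (c ⊔ ℓ ⊔ e) where
    field
      at       : ℕ → V
      adjacent : ∀ n → Adjacent (at n) (at (ℕ.suc n))
      distinct : Injective _≡_ _≈_ at

  _OnRay_ : V → Ray → Set ℓ
  v OnRay R = ∃[ n ] v ≈ Ray.at R n

  Equivalent : Rel Ray (c ⊔ ℓ ⊔ e)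
  Equivalent R S = Σ[ P ∈ (ℕ → Path) ]
      (∀ n → Path.initial (P n) OnRay R × Path.terminal (P n) OnRay S)
    × (∀ m n → m ≢ n → Disjoint (P m) (P n))

  TwoEnded : Set (c ⊔ ℓ ⊔ e)
  TwoEnded = Connected
    × (∃₂ λ R S → ¬ Equivalent R S × (∀ T → Equivalent T R ⊎ Equivalent T S))

module _ (Γ : Digraph c ℓ e) where
  open Digraph Γ

  Automorphism : Set (c ⊔ ℓ ⊔ e)
  Automorphism = Isomorphism Γ Γ

  open Isomorphism using (to; from; to-cong; from-cong; to-arc; from-arc;
    inverse-maps; strictlyInverseˡ; strictlyInverseʳ; inverseʳ)

  -- The product g ∙ h applies h first.
  Aut : Group (c ⊔ ℓ ⊔ e) (c ⊔ ℓ)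
  Aut = record
    { Carrier = Automorphism
    ; _≈_     = λ g h → ∀ v → to g v ≈ to h v
    ; _∙_     = λ g h → record
      { inverse-maps = Composition.inverse (inverse-maps h) (inverse-maps g)
      ; to-arc       = λ a → to-arc g (to-arc h a)
      ; from-arc     = λ a → from-arc h (from-arc g a)
      }
    ; ε       = record
      { inverse-maps = Identity.inverse vertices
      ; to-arc       = id
      ; from-arc     = id
      }
    ; _⁻¹     = λ g → record
      { inverse-maps = Symmetry.inverse (inverse-maps g)
      ; to-arc       = from-arc g
      ; from-arc     = to-arc g
      }
    ; isGroup = record
      { isMonoid = record
        { isSemigroup = record
          { isMagma = record
            { isEquivalence = record
              { refl  = λ v → Digraph.refl Γ
              ; sym   = λ g≈h v → sym (g≈h v)
              ; trans = λ g≈h h≈k v → trans (g≈h v) (h≈k v)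
              }
            ; ∙-cong = λ {g} {g′} {h} {h′} g≈g′ h≈h′ v →
                trans (to-cong g (h≈h′ v)) (g≈g′ (to h′ v))
            }
          ; assoc = λ g h k v → Digraph.refl Γ
          }
        ; identity = (λ g v → Digraph.refl Γ) , (λ g v → Digraph.refl Γ)
        }
      ; inverse = (λ g v → strictlyInverseʳ g v) , (λ g v → strictlyInverseˡ g v)
      ; ⁻¹-cong = λ {g} {h} g≈h v → inverseʳ g
          (trans (sym (strictlyInverseˡ h v)) (sym (g≈h (from h v))))
      }
    }

  VertexTransitive : Set (c ⊔ ℓ ⊔ e)
  VertexTransitive = ∀ u v → Σ[ g ∈ Automorphism ] to g u ≈ v

  ArcTransitive : Set (c ⊔ ℓ ⊔ e)
  ArcTransitive = ∀ {u v u′ v′} → E u v → E u′ v′ →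
    Σ[ g ∈ Automorphism ] to g u ≈ u′ × to g v ≈ v′

  -- w = u is allowed.
  TwoArcTransitive : Set (c ⊔ ℓ ⊔ e)
  TwoArcTransitive = ∀ {u v w u′ v′ w′} →
    E u v → E v w → E u′ v′ → E v′ w′ →
    Σ[ g ∈ Automorphism ] to g u ≈ u′ × to g v ≈ v′ × to g w ≈ w′

  Stabilizer : V → Group (c ⊔ ℓ ⊔ e) (c ⊔ ℓ)
  Stabilizer v = record
    { Carrier = Σ[ g ∈ Automorphism ] to g v ≈ v
    ; _≈_     = λ (g , _) (h , _) → g A.≈ h
    ; _∙_     = λ (g , gv) (h , hv) → g A.∙ h , trans (to-cong g hv) gv
    ; ε       = A.ε , Digraph.refl Γ
    ; _⁻¹     = λ (g , gv) → g A.⁻¹ , inverseʳ g (sym gv)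
    ; isGroup = record
      { isMonoid = record
        { isSemigroup = record
          { isMagma = record
            { isEquivalence = On.isEquivalence proj₁ A.isEquivalence
            ; ∙-cong        = λ {(g , _)} {(g′ , _)} {(h , _)} {(h′ , _)} →
                A.∙-cong {g} {g′} {h} {h′}
            }
          ; assoc = λ (g , _) (h , _) (k , _) → A.assoc g h k
          }
        ; identity = (λ (g , _) → A.identityˡ g) , (λ (g , _) → A.identityʳ g)
        }
      ; inverse = (λ (g , _) → A.inverseˡ g) , (λ (g , _) → A.inverseʳ g)
      ; ⁻¹-cong = λ {(g , _)} {(h , _)} → A.⁻¹-cong {g} {h}
      }
    }
    where module A = Group Aut

  InAction : ∀ v → Action (Stabilizer v) (subset vertices (In v))
  InAction v = record
    { _·_    = λ (g , gv) (u , a) → to g u , E-resp (Digraph.refl Γ) gv (to-arc g a)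
    ; ·-cong = λ {(g , _)} {_} {_} {(u , _)} g≈h x≈y →
        trans (to-cong g x≈y) (g≈h _)
    ; ε-act  = λ _ → Digraph.refl Γ
    ; ∙-act  = λ _ _ _ → Digraph.refl Γ
    }

  OutAction : ∀ v → Action (Stabilizer v) (subset vertices (Out v))
  OutAction v = record
    { _·_    = λ (g , gv) (u , a) → to g u , E-resp gv (Digraph.refl Γ) (to-arc g a)
    ; ·-cong = λ {(g , _)} {_} {_} {(u , _)} g≈h x≈y →
        trans (to-cong g x≈y) (g≈h _)
    ; ε-act  = λ _ → Digraph.refl Γ
    ; ∙-act  = λ _ _ _ → Digraph.refl Γ
    }

  LocallyQuasiPrimitive : Set (suc (c ⊔ ℓ ⊔ e))
  LocallyQuasiPrimitive =
    ∀ v → QuasiPrimitive (InAction v) × QuasiPrimitive (OutAction v)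

module _ (Γ : Digraph c ℓ e) (N : NormalSubgroup (Aut Γ) p) where
  open Digraph Γ
  open NormalSubgroup N
  open Isomorphism using (to; to-cong; inverseʳ)

  SameOrbit : Rel V (c ⊔ ℓ ⊔ e ⊔ p)
  SameOrbit u v = ∃[ n ] Member n × to n u ≈ v

  orbits : Setoid c (c ⊔ ℓ ⊔ e ⊔ p)
  orbits = record
    { Carrier       = V
    ; _≈_           = SameOrbit
    ; isEquivalence = record
      { refl  = A.ε , ε-closed , Digraph.refl Γ
      ; sym   = λ (n , n∈N , eq) → n A.⁻¹ , ⁻¹-closed n∈N , inverseʳ n (sym eq)
      ; trans = λ (m , m∈N , eq) (n , n∈N , eq′) →
          n A.∙ m , ∙-closed n∈N m∈N , trans (to-cong n eq) eq′
      }
    }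
    where module A = Group (Aut Γ)

  FiniteOrbits : Set (c ⊔ ℓ ⊔ e ⊔ p)
  FiniteOrbits = ∀ v → Finite (subset vertices (SameOrbit v))

  quotient : Digraph c (c ⊔ ℓ ⊔ e ⊔ p) (c ⊔ ℓ ⊔ e ⊔ p)
  quotient = record
    { vertices = orbits
    ; E        = λ A B → ∃₂ λ v w → SameOrbit A v × SameOrbit B w × E v w
    ; E-resp   = λ A≈A′ B≈B′ (v , w , Av , Bw , a) →
        v , w , O.trans (O.sym A≈A′) Av , O.trans (O.sym B≈B′) Bw , a
    }
    where module O = Setoid orbits

  quotientMap : Homomorphism Γ quotient
  quotientMap = record
    { to      = id
    ; to-cong = λ u≈v → Group.ε (Aut Γ) , ε-closed , u≈v
    ; to-arc  = λ {u} {v} a → u , v , O.refl , O.refl , a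
    }
    where module O = Setoid orbits

  CaseI : Set (c ⊔ ℓ ⊔ e ⊔ p)
  CaseI = Isomorphism quotient ℤ-digraph × (Aut Γ /ᴳ N) ≅ᴳ D∞

  CaseII : Set (c ⊔ ℓ ⊔ e ⊔ p)
  CaseII = Isomorphism quotient ℤ⃗-digraph × (Aut Γ /ᴳ N) ≅ᴳ ℤ-group

  projection : CaseI ⊎ CaseII → V → ℤ
  projection (inj₁ (iso , _)) = to iso ∘ Homomorphism.to quotientMap
  projection (inj₂ (iso , _)) = to iso ∘ Homomorphism.to quotientMap

  layer : CaseI ⊎ CaseII → ℤ → Pred V 0ℓ
  layer s i v = projection s v ≡ i

-- Two rays in different ends are separated by finitely many vertices.  The
-- separations of least order form a distributive lattice on which G = Aut Γ
-- acts, reversing the order when the ends are swapped.  Every vertex lies on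
-- one of them, so each is determined by its separating vertices, intervals of
-- the lattice are finite, and Γ is locally finite.  Counting with sign the
-- vertices between t and g t gives a homomorphism G → D∞, hence a height
-- function V → ℤ with finite fibres on which G acts by affine maps.  By
-- arc-transitivity all arcs change the height by the same amount up to sign.
-- After rescaling, the levels are the orbits of the kernel N, and either all
-- arcs ascend or each vertex has both ascending and descending arcs.
--
-- For given N, (c) follows by counting the arcs between two layers.  For (f)
-- and (g), an element of G_v that preserves the layers fixes all neighbours of
-- v and so, by connectedness, is trivial; hence |G_v| ≤ 2 in case (i).

module Submission where

open import Defs
open import Axiom.ExcludedMiddle using (ExcludedMiddle)
open import Algebra.Bundles using (Group)
import Algebra.Properties.Group as GroupProperties
open import Data.Bool.Base using (Bool)
open import Data.Empty using (⊥; ⊥-elim)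
open import Data.Fin.Base using (Fin; inject₁; fromℕ) renaming (zero to fzero; suc to fsuc)
import Data.Fin.Properties as Fin
open import Data.Integer.Base as ℤ using (ℤ; 0ℤ; 1ℤ; -1ℤ; +_; -[1+_]; _+_; _-_; -_; _*_; ∣_∣)
import Data.Integer.Properties as ℤ
open import Data.Integer.Tactic.RingSolver using (solve-∀)
open import Data.List.Base using (List; []; _∷_; _++_; length; map; lookup; applyUpTo)
import Data.List.Properties as List
import Data.List.Membership.Propositional.Properties as Membership
open import Data.List.Relation.Unary.All as All using (All; []; _∷_)
import Data.List.Relation.Unary.All.Properties as All
open import Data.List.Relation.Unary.AllPairs using ([]; _∷_)
open import Data.List.Relation.Unary.Any as Any using (Any; here; there)
import Data.List.Relation.Unary.Any.Properties as Any
open import Data.List.Relation.Unary.Linked using (Linked; []; [-]; _∷_)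
import Data.List.Relation.Unary.Unique.Setoid.Properties as Unique
open import Data.Nat.Base as ℕ using (ℕ; zero; suc; z≤n; s≤s)
import Data.Nat.Properties as ℕ
open import Data.Nat.Divisibility using (_∣_; divides)
open import Data.Product.Base using (Σ; Σ-syntax; ∃; ∃-syntax; ∃₂; _×_; _,_; proj₁; proj₂)
open import Data.Sign.Base as Sign using (Sign)
import Data.Sign.Properties as Sign
open import Data.Unit.Base using (⊤; tt)
open import Data.Sum.Base using (_⊎_; inj₁; inj₂; [_,_]′; swap)
open import Function.Base using (_∘_; id)
open import Function.Bundles using (_⇔_; mk⇔; Inverse; Injection)
import Function.Construct.Composition as Composition
open import Function.Definitions using (Injective; Congruent)
open import Level using (Lift; lift; lower; 0ℓ)
open import Relation.Binary.Bundles using (Setoid)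
open import Relation.Binary.Definitions using (tri<; tri≈; tri>)
open import Relation.Binary.PropositionalEquality as ≡ using (_≡_; _≢_; refl; sym; trans; cong; cong₂; subst; subst₂)
open import Relation.Nullary.Decidable.Core using (Dec; yes; no; does)
open import Relation.Nullary.Negation.Core using (¬_; contradiction)
open import Relation.Unary using (Pred; _∈_; _⊆_; _≬_; _∩_; _∪_)

-- Local finiteness is not among the assumptions, so no compactness argument is available at the
-- start. The substitute is the number `k`: among separations of least order the zeros of one member
-- never properly contain those of another, and a pointwise infimum of infinitely many members still
-- has at most `k` zeros. Once every vertex is a zero of some member, comparable members with the
-- same zeros coincide. Hence such an infimum is already attained, infinite descent inside an
-- interval is impossible, and the strips between separators turn out finite. Enclosing a vertex
-- strictly between two separations then bounds its neighbours.
--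
-- A given `N` need not be the constructed one. Therefore both directions go through `Levelling`, a
-- map to the integers on which automorphisms act affinely: `N` is built as the kernel of the action
-- on one, and the quotient by a given `N` provides another.

injective⇒≤-size : ∀ {c ℓ c′ ℓ′} {S : Setoid c ℓ} {T : Setoid c′ ℓ′} {m n : ℕ} →
                   HasSize S m → HasSize T n → Injection S T → m ℕ.≤ n
injective⇒≤-size {S = S} {T} a b i = Fin.injective⇒≤ {f = f} f-injective
  where
  module A = Inverse a
  module B = Inverse b
  module I = Injection i
  f : Fin _ → Fin _
  f = B.from ∘ I.to ∘ A.to
  f-injective : Injective _≡_ _≡_ f
  f-injective {x} {y} eq = trans (sym (A.strictlyInverseʳ x))
    (trans (A.from-cong (I.injective (Setoid.trans T (Setoid.sym T (B.strictlyInverseˡ _))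
      (Setoid.trans T (B.to-cong eq) (B.strictlyInverseˡ _))))) (A.strictlyInverseʳ y))

size-unique : ∀ {c ℓ} {S : Setoid c ℓ} {m n : ℕ} → HasSize S m → HasSize S n → m ≡ n
size-unique {S = S} a b = ℕ.≤-antisym (injective⇒≤-size {T = S} a b identity) (injective⇒≤-size {T = S} b a identity)
  where
  identity : Injection S S
  identity = record { to = id ; cong = id ; injective = id }

-- Enumerations of finite sets and sums over them

module Finite {ℓ} (em : ExcludedMiddle ℓ) (S : Setoid ℓ ℓ) where
  open Setoid S renaming (Carrier to V; refl to ≈-refl; sym to ≈-sym; trans to ≈-trans)
  open import Data.List.Membership.Setoid S renaming (_∈_ to _∈ˡ_; _∉_ to _∉ˡ_) using ()
  open import Data.List.Membership.Setoid.Properties using (∈-resp-≈; ∈-lookup; ∈-++⁺ˡ; ∈-++⁺ʳ; ∈-tabulate⁺; ∉⇒All[≉])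
  open import Data.List.Relation.Unary.Unique.Setoid S using (Unique)

  em₀ : {P : Set} → Dec P
  em₀ {P} with em {Lift ℓ P}
  ... | yes a = yes (lower a)
  ... | no ¬a = no (¬a ∘ lift)

  by-contradiction : {P : Set ℓ} → (¬ P → ⊥) → P
  by-contradiction {P} f with em {P}
  ... | yes a = a
  ... | no ¬a = ⊥-elim (f ¬a)

  lookup-injective : ∀ {L} → Unique L → ∀ i j → lookup L i ≈ lookup L j → i ≡ j
  lookup-injective (_ ∷ _)  fzero    fzero    _  = refl
  lookup-injective (x≉ ∷ _) fzero    (fsuc j) eq = contradiction eq (All.lookupWith (λ n e → n ∘ λ h → ≈-trans h e) x≉ (∈-lookup S _ j))
  lookup-injective (x≉ ∷ _) (fsuc i) fzero    eq = contradiction (≈-sym eq) (All.lookupWith (λ n e → n ∘ λ h → ≈-trans h e) x≉ (∈-lookup S _ i))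
  lookup-injective (_ ∷ u)  (fsuc i) (fsuc j) eq = cong fsuc (lookup-injective u i j eq)

  unique-⊆⇒length≤ : ∀ {L M} → Unique L → (∀ {x} → x ∈ˡ L → x ∈ˡ M) → length L ℕ.≤ length M
  unique-⊆⇒length≤ {L} {M} u L⊆M = Fin.injective⇒≤ {f = f} f-injective
    where
    f : Fin (length L) → Fin (length M)
    f i = Any.index (L⊆M (∈-lookup S L i))
    f-injective : Injective _≡_ _≡_ f
    f-injective {i} {j} eq = lookup-injective u i j
      (≈-trans (Any.lookup-index (L⊆M (∈-lookup S L i)))
        (≈-trans (reflexive (cong (lookup M) eq)) (≈-sym (Any.lookup-index (L⊆M (∈-lookup S L j))))))

  record Enum {p} (P : V → Set p) : Set (ℓ Level.⊔ p) where
    field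
      list     : List V
      unique   : Unique list
      sound    : All P list
      complete : ∀ {x} → P x → x ∈ˡ list

  Respects : ∀ {p} → (V → Set p) → Set (ℓ Level.⊔ p)
  Respects P = ∀ {x y} → x ≈ y → P x → P y

  All-∈ : ∀ {p} {P : V → Set p} → Respects P → ∀ {L x} → All P L → x ∈ˡ L → P x
  All-∈ r a x∈ = All.lookupWith (λ px e → r (≈-sym e) px) a x∈

  private
    select : ∀ {p} {P : V → Set p} → (∀ x → Dec (P x)) → Respects P → (L : List V) →
             Σ[ M ∈ List V ] Unique M × All P M × (∀ {x} → x ∈ˡ L → P x → x ∈ˡ M)
    select P? r [] = [] , [] , [] , λ ()
    select P? r (x ∷ L) with select P? r L | P? x
    ... | M , u , s , c | no ¬px = M , u , s , λ
      { (here e) py → contradiction (r e py) ¬px ; (there i) py → c i py }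
    ... | M , u , s , c | yes px with em {x ∈ˡ M}
    ...   | yes x∈M = M , u , s , λ
      { (here e) py → ∈-resp-≈ S (≈-sym e) x∈M ; (there i) py → c i py }
    ...   | no x∉M = x ∷ M , ∉⇒All[≉] S x∉M ∷ u , px ∷ s , λ
      { (here e) py → here e ; (there i) py → there (c i py) }

  abstract
    covered⇒enum : ∀ {p} {P : V → Set p} → (∀ x → Dec (P x)) → Respects P →
                   (L : List V) → (∀ {x} → P x → x ∈ˡ L) → Enum P
    covered⇒enum P? r L cover with select P? r L
    ... | M , u , s , c = record { list = M ; unique = u ; sound = s ; complete = λ px → c (cover px) px }

  members : (L : List V) → Enum (_∈ˡ L)
  members L = covered⇒enum (λ _ → em) (∈-resp-≈ S) L id

  abstract
    -- A duplicate-free list of members is enlarged as long as some member is missing. Fuel plus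
    -- length stays at `suc n`, so running out of fuel would leave a list longer than the bound
    -- allows.
    bounded⇒enum : {P : V → Set} → Respects P → (n : ℕ) →
                   (∀ L → Unique L → All P L → length L ℕ.≤ n) → Enum P
    bounded⇒enum {P} r n bound = grow (suc n) [] [] [] (ℕ.≤-reflexive (cong suc (sym (ℕ.+-identityʳ n))))
      where
      grow : ∀ fuel L → Unique L → All P L → n ℕ.< fuel ℕ.+ length L → Enum P
      grow zero L u s n<l = contradiction (bound L u s) (ℕ.<⇒≱ n<l)
      grow (suc fuel) L u s n<l with em {∃[ x ] P x × x ∉ˡ L}
      ... | yes (x , px , x∉L) = grow fuel (x ∷ L) (∉⇒All[≉] S x∉L ∷ u) (px ∷ s)
              (subst (n ℕ.<_) (sym (ℕ.+-suc fuel (length L))) n<l)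
      ... | no ¬more = record { list = L ; unique = u ; sound = s
              ; complete = λ {x} px → by-contradiction λ x∉L → ¬more (x , px , x∉L) }

  Covering : ∀ {p} → (V → Set p) → Set (ℓ Level.⊔ p)
  Covering P = Σ[ L ∈ List V ] (∀ {v} → P v → v ∈ˡ L)

  covering-⊎ : ∀ {p q r} {P : V → Set p} {Q : V → Set q} {T : V → Set r} →
               (∀ {v} → T v → P v ⊎ Q v) → Covering P → Covering Q → Covering T
  covering-⊎ {P = P} {Q} T⇒ (L , c) (M , d) = L ++ M , λ tv → side (T⇒ tv)
    where
    side : ∀ {v} → P v ⊎ Q v → v ∈ˡ (L ++ M)
    side (inj₁ p) = ∈-++⁺ˡ S (c p)
    side (inj₂ q) = ∈-++⁺ʳ S L (d q)

  covering-map : ∀ {p q} {P : V → Set p} {Q : V → Set q} → (∀ {v} → Q v → P v) → Covering P → Covering Q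
  covering-map Q⇒P (L , c) = L , c ∘ Q⇒P

  covering-⋃ : ∀ {q} {Q : V → V → Set q} → (∀ {u w v} → u ≈ w → Q u v → Q w v) →
               (∀ w → Covering (Q w)) → ∀ L → Covering (λ v → ∃[ w ] w ∈ˡ L × Q w v)
  covering-⋃ Q-resp C [] = [] , λ ()
  covering-⋃ Q-resp C (u ∷ L) = covering-⊎
    (λ { (w , here e , q) → inj₁ (Q-resp e q) ; (w , there i , q) → inj₂ (w , i , q) }) (C u) (covering-⋃ Q-resp C L)

  enum⇒size : ∀ {p} {P : V → Set p} → (A : Enum P) → HasSize (subset S P) (length (Enum.list A))
  enum⇒size {P = P} A = record
    { to        = λ i → lookup list i , All.lookup sound (Membership.∈-lookup i)
    ; from      = λ (x , px) → Any.index (complete px)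
    ; to-cong   = λ { refl → ≈-refl }
    ; from-cong = λ {(x , px)} {(y , py)} x≈y → lookup-injective unique _ _
        (≈-trans (≈-sym (Any.lookup-index (complete px))) (≈-trans x≈y (Any.lookup-index (complete py))))
    ; inverse   = (λ { {x , px} refl → ≈-sym (Any.lookup-index (complete px)) })
                , (λ {i} {(x , px)} e → lookup-injective unique _ _
                    (≈-trans (≈-sym (Any.lookup-index (complete px))) e))
    }
    where
    open Enum A

  size⇒enum : ∀ {p} {P : V → Set p} {n} → HasSize (subset S P) n →
              Σ[ A ∈ Enum P ] length (Enum.list A) ≡ n
  size⇒enum {P = P} {n} f = record
    { list     = tabulate (proj₁ ∘ to)
    ; unique   = Unique.tabulate⁺ S {f = proj₁ ∘ to} λ {i} {j} e →
        trans (sym (strictlyInverseʳ i)) (trans (from-cong e) (strictlyInverseʳ j))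
    ; sound    = All.tabulate⁺ (proj₂ ∘ to)
    ; complete = λ {x} px → ∈-resp-≈ S (strictlyInverseˡ (x , px)) (∈-tabulate⁺ S (from (x , px)))
    } , List.length-tabulate (proj₁ ∘ to)
    where
    open Inverse f
    open import Data.List.Base using (tabulate)

  sum : (V → ℤ) → List V → ℤ
  sum f []      = 0ℤ
  sum f (x ∷ L) = f x + sum f L

  sum-cong : ∀ {f g} L → (∀ {x} → x ∈ˡ L → f x ≡ g x) → sum f L ≡ sum g L
  sum-cong []      f≡g = refl
  sum-cong (x ∷ L) f≡g = cong₂ _+_ (f≡g (here ≈-refl)) (sum-cong L (f≡g ∘ there))

  sum-zero : ∀ {f} L → (∀ {x} → x ∈ˡ L → f x ≡ 0ℤ) → sum f L ≡ 0ℤ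
  sum-zero []      f≡0 = refl
  sum-zero (x ∷ L) f≡0 = cong₂ _+_ (f≡0 (here ≈-refl)) (sum-zero L (f≡0 ∘ there))

  sum-+ : ∀ f g L → sum (λ x → f x + g x) L ≡ sum f L + sum g L
  sum-+ f g []      = refl
  sum-+ f g (x ∷ L) = trans (cong (_+_ (f x + g x)) (sum-+ f g L)) (rearrange (f x) (g x) (sum f L) (sum g L))
    where
    rearrange : ∀ a b c d → (a + b) + (c + d) ≡ (a + c) + (b + d)
    rearrange = solve-∀

  sum-neg : ∀ f L → sum (λ x → - f x) L ≡ - sum f L
  sum-neg f []      = refl
  sum-neg f (x ∷ L) = trans (cong (_+_ (- f x)) (sum-neg f L)) (sym (ℤ.neg-distrib-+ (f x) (sum f L)))

  sum-mono : ∀ {f g} L → (∀ x → f x ℤ.≤ g x) → sum f L ℤ.≤ sum g L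
  sum-mono []      f≤g = ℤ.≤-refl
  sum-mono (x ∷ L) f≤g = ℤ.+-mono-≤ (f≤g x) (sum-mono L f≤g)

  sum-squeeze : ∀ {f g} L → (∀ x → f x ℤ.≤ g x) → sum g L ℤ.≤ sum f L → All (λ x → f x ≡ g x) L
  sum-squeeze []      f≤g g≤f = []
  sum-squeeze {f} {g} (x ∷ L) f≤g g≤f =
      ℤ.≤-antisym (f≤g x) (ℤ.≮⇒≥ λ fx<gx → ℤ.<⇒≱ (ℤ.+-mono-<-≤ fx<gx (sum-mono L f≤g)) g≤f)
    ∷ sum-squeeze L f≤g (ℤ.≮⇒≥ λ <ΣL → ℤ.<⇒≱ (ℤ.+-mono-≤-< (f≤g x) <ΣL) g≤f)

  sum-1 : ∀ L → sum (λ _ → 1ℤ) L ≡ + length L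
  sum-1 []      = refl
  sum-1 (x ∷ L) = cong (_+_ 1ℤ) (sum-1 L)

  sum-map : ∀ f g L → sum f (map g L) ≡ sum (f ∘ g) L
  sum-map f g []      = refl
  sum-map f g (x ∷ L) = cong (_+_ (f (g x))) (sum-map f g L)

  sum-swap : ∀ (f : V → V → ℤ) L M → sum (λ x → sum (f x) M) L ≡ sum (λ y → sum (λ x → f x y) L) M
  sum-swap f []      M = sym (sum-zero M λ _ → refl)
  sum-swap f (x ∷ L) M = trans (cong (_+_ (sum (f x) M)) (sum-swap f L M)) (sym (sum-+ (f x) _ M))

  private
    -- The Kronecker delta of `x` and `y`, scaled by `c`.
    at : V → V → ℤ → ℤ
    at x y c with em {x ≈ y}
    ... | yes _ = c
    ... | no _  = 0ℤ

    at-≈ : ∀ {x y} c → x ≈ y → at x y c ≡ c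
    at-≈ {x} {y} c x≈y with em {x ≈ y}
    ... | yes _ = refl
    ... | no x≉y = contradiction x≈y x≉y

    at-≉ : ∀ {x y} c → ¬ x ≈ y → at x y c ≡ 0ℤ
    at-≉ {x} {y} c x≉y with em {x ≈ y}
    ... | yes x≈y = contradiction x≈y x≉y
    ... | no _ = refl

    at-swap : ∀ (f : V → ℤ) → (∀ {x y} → x ≈ y → f x ≡ f y) → ∀ x y → at x y (f x) ≡ at y x (f y)
    at-swap f f-cong x y with em {x ≈ y}
    ... | yes x≈y = trans (f-cong x≈y) (sym (at-≈ _ (≈-sym x≈y)))
    ... | no x≉y  = sym (at-≉ _ (x≉y ∘ ≈-sym))

    sum-at : ∀ {x L} c → Unique L → x ∈ˡ L → sum (λ y → at x y c) L ≡ c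
    sum-at {x} {y ∷ L} c (y≉ ∷ u) (here x≈y) = trans
      (cong₂ _+_ (at-≈ c x≈y) (sum-zero L λ {z} z∈L → at-≉ c λ x≈z →
        All-∈ (λ e n h → n (≈-trans h (≈-sym e))) y≉ z∈L (≈-trans (≈-sym x≈y) x≈z)))
      (ℤ.+-identityʳ c)
    sum-at {x} {y ∷ L} c (y≉ ∷ u) (there x∈L) = trans
      (cong₂ _+_ (at-≉ c λ x≈y → All-∈ (λ e n h → n (≈-trans h (≈-sym e))) y≉ x∈L (≈-sym x≈y)) (sum-at c u x∈L))
      (ℤ.+-identityˡ c)

    sum-resum : ∀ f {L M} → Unique M → (∀ {x} → x ∈ˡ L → f x ≢ 0ℤ → x ∈ˡ M) →
                sum f L ≡ sum (λ x → sum (λ y → at x y (f x)) M) L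
    sum-resum f {L} {M} u c = sum-cong L λ {x} x∈L → eq x x∈L
      where
      eq : ∀ x → x ∈ˡ L → f x ≡ sum (λ y → at x y (f x)) M
      eq x x∈L with em {x ∈ˡ M}
      ... | yes x∈M = sym (sum-at (f x) u x∈M)
      ... | no x∉M with f x ℤ.≟ 0ℤ
      ...   | no fx≢0 = contradiction (c x∈L fx≢0) x∉M
      ...   | yes fx≡0 rewrite fx≡0 = sym (sum-zero M λ {y} y∈M → at-≉ 0ℤ λ x≈y → x∉M (∈-resp-≈ S (≈-sym x≈y) y∈M))

  -- Both sums are rewritten as a double sum over pairs of equal entries, one from each list, where
  -- the order of summation can be exchanged; no bijection between the lists has to be built. This
  -- is why orders and signed counts do not depend on the list chosen.
  sum-support : ∀ (f : V → ℤ) → (∀ {x y} → x ≈ y → f x ≡ f y) → ∀ {L M} → Unique L → Unique M →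
                (∀ {x} → x ∈ˡ L → f x ≢ 0ℤ → x ∈ˡ M) → (∀ {x} → x ∈ˡ M → f x ≢ 0ℤ → x ∈ˡ L) →
                sum f L ≡ sum f M
  sum-support f f-cong {L} {M} u v c d = begin
    sum f L                                     ≡⟨ sum-resum f v c ⟩
    sum (λ x → sum (λ y → at x y (f x)) M) L    ≡⟨ sum-swap _ L M ⟩
    sum (λ y → sum (λ x → at x y (f x)) L) M    ≡⟨ sum-cong M (λ {y} _ → sum-cong L λ {x} _ → at-swap f f-cong x y) ⟩
    sum (λ y → sum (λ x → at y x (f y)) L) M    ≡⟨ sum-resum f u d ⟨
    sum f M                                     ∎
    where open ≡.≡-Reasoning

Eventually : ∀ {p} → (ℕ → Set p) → Set p
Eventually P = ∃[ n ] (∀ m → n ℕ.≤ m → P m)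

eventually-× : ∀ {p q} {P : ℕ → Set p} {Q : ℕ → Set q} → Eventually P → Eventually Q → Eventually (λ n → P n × Q n)
eventually-× (m , f) (n , g) = m ℕ.⊔ n , λ k le →
  f k (ℕ.≤-trans (ℕ.m≤m⊔n m n) le) , g k (ℕ.≤-trans (ℕ.m≤n⊔m m n) le)

eventually-map : ∀ {p q} {P : ℕ → Set p} {Q : ℕ → Set q} → (∀ {n} → P n → Q n) → Eventually P → Eventually Q
eventually-map f (n , g) = n , λ m le → f (g m le)

eventually-witness : ∀ {p} {P : ℕ → Set p} → Eventually P → ∃ P
eventually-witness (n , f) = n , f n ℕ.≤-refl

fin-induction : ∀ {p n} (P : Fin (suc n) → Set p) → P fzero →
                (∀ i → P (inject₁ i) → P (fsuc i)) → ∀ i → P i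
fin-induction P base step fzero = base
fin-induction {n = suc n} P base step (fsuc i) =
  fin-induction (P ∘ fsuc) (step fzero base) (step ∘ fsuc) i

-- A separation sends the separating vertices to ⓪ and the two sides to ⊖ and ⊕.
data Side : Set where
  ⊖ ⓪ ⊕ : Side

-- Rays and separations

module Connectivity {ℓ} (em : ExcludedMiddle ℓ) (Γ : Digraph ℓ ℓ ℓ) where
  open Digraph Γ renaming (refl to ≈-refl; sym to ≈-sym; trans to ≈-trans)
  open Finite em vertices
  open import Data.List.Membership.Setoid vertices renaming (_∈_ to _∈ˡ_; _∉_ to _∉ˡ_) using ()
  open import Data.List.Membership.Setoid.Properties using (∈-resp-≈; ∈-lookup; ∈-++⁺ˡ; ∈-++⁺ʳ; ∉⇒All[≉]; ∈-applyUpTo⁺)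
  open import Data.List.Relation.Unary.Unique.Setoid vertices using (Unique)

  adjacent-sym : ∀ {u v} → Adjacent u v → Adjacent v u
  adjacent-sym = swap

  adjacent-resp : ∀ {u u′ v v′} → u ≈ u′ → v ≈ v′ → Adjacent u v → Adjacent u′ v′
  adjacent-resp p q (inj₁ a) = inj₁ (E-resp p q a)
  adjacent-resp p q (inj₂ a) = inj₂ (E-resp q p a)

  connected-induction : ∀ {p} → Connected Γ → (P : V → Set p) → Respects P →
                        (∀ {u v} → Adjacent u v → P u → P v) → ∀ u v → P u → P v
  connected-induction conn P r step u v pu with conn u v
  ... | path , e , e′ = r e′ (fin-induction (P ∘ at) (r (≈-sym e) pu) (λ i → step (adjacent i)) (fromℕ _))
    where open Path path

  -- By disjointness each vertex of `L` lies in at most one `A n`, so beyond the last such index all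
  -- of `L` is missed. The sets are single ray vertices in one use and connecting paths in the
  -- other.
  eventually-avoids : (A : ℕ → V → Set ℓ) → (∀ {m n x} → m ≢ n → A m x → ¬ A n x) →
                      ∀ L → Eventually (λ n → All (λ x → ¬ A n x) L)
  eventually-avoids A disjoint [] = 0 , λ _ _ → []
  eventually-avoids A disjoint (x ∷ L) with em {∃[ n ] A n x} | eventually-avoids A disjoint L
  ... | no ¬hit       | ev = eventually-map (λ {n} a → (λ h → ¬hit (n , h)) ∷ a) ev
  ... | yes (n , hit) | ev = eventually-map (λ { (a , b) → a ∷ b })
        (eventually-× (suc n , λ m n<m → disjoint (ℕ.<⇒≢ n<m) hit) ev)

  -- A `Path` in list form that stays inside `A`, so that vertices can be prepended and initial
  -- segments dropped by recursion. The end points are fixed only up to `≈`, hence can be replaced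
  -- without touching the list.
  record SimplePath (A : V → Set ℓ) (u v : V) : Set ℓ where
    field
      first  : V
      rest   : List V
      start  : first ≈ u
      linked : Linked Adjacent (first ∷ rest)
      unique : Unique (first ∷ rest)
      end    : lookup (first ∷ rest) (fromℕ (length rest)) ≈ v
      inside : All A (first ∷ rest)

  private
    linked-lookup : ∀ {x xs} → Linked Adjacent (x ∷ xs) → ∀ i →
                    Adjacent (lookup (x ∷ xs) (inject₁ i)) (lookup (x ∷ xs) (fsuc i))
    linked-lookup (a ∷ l) fzero    = a
    linked-lookup (a ∷ l) (fsuc i) = linked-lookup l i

    suffix : ∀ {A u v w} (P : SimplePath A u v) → w ∈ˡ (SimplePath.first P ∷ SimplePath.rest P) →
             SimplePath A w v
    suffix P (here w≈) = record { SimplePath P; start = ≈-sym w≈ }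
    suffix P (there w∈) with SimplePath.rest P | SimplePath.linked P | SimplePath.unique P | SimplePath.end P | SimplePath.inside P | w∈
    ... | y ∷ ys | _ ∷ l | _ ∷ u | e | _ ∷ a | w∈′ = suffix {u = y} (record
      { first = y ; rest = ys ; start = ≈-refl ; linked = l ; unique = u ; end = e ; inside = a }) w∈′

  toPath : ∀ {A u v} → SimplePath A u v → Path Γ
  toPath P = record
    { length = length rest ; at = lookup (first ∷ rest)
    ; adjacent = linked-lookup linked ; distinct = λ {i} {j} → lookup-injective unique i j }
    where open SimplePath P

  trivial-path : ∀ {A u} → A u → SimplePath A u u
  trivial-path {u = u} a = record
    { first = u ; rest = [] ; start = ≈-refl ; linked = [-] ; unique = [] ∷ [] ; end = ≈-refl ; inside = a ∷ [] }

  -- If `w` already lies on the path, the part from `w` onwards is taken instead of prepending `w`,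
  -- which keeps the vertices distinct.
  extend-path : ∀ {A u v w} → A w → Adjacent w u → SimplePath A u v → SimplePath A w v
  extend-path {w = w} a adj P with em {w ∈ˡ (SimplePath.first P ∷ SimplePath.rest P)}
  ... | yes w∈ = suffix P w∈
  ... | no w∉ = record
    { first = w ; rest = first ∷ rest ; start = ≈-refl
    ; linked = adjacent-resp ≈-refl (≈-sym start) adj ∷ linked
    ; unique = ∉⇒All[≉] vertices w∉ ∷ unique ; end = end ; inside = a ∷ inside }
    where open SimplePath P

  -- If no finite set separated the rays, a connecting path avoiding all vertices used so far could
  -- be chosen at every stage, and these pairwise disjoint paths would make the rays equivalent.
  finite-separator : ∀ R S → ¬ Equivalent Γ R S →
    Σ[ F ∈ List V ] (∀ m n → ¬ SimplePath (_∉ˡ F) (Ray.at R m) (Ray.at S n))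
  finite-separator R S inequivalent = by-contradiction λ none → inequivalent (equivalent none)
    where
    equivalent : ¬ (Σ[ F ∈ List V ] (∀ m n → ¬ SimplePath (_∉ˡ F) (Ray.at R m) (Ray.at S n))) →
                 Equivalent Γ R S
    equivalent none = (λ n → toPath (path n))
      , (λ n → (proj₁ (avoiding (used n)) , SimplePath.start (path n))
             , (proj₁ (proj₂ (avoiding (used n))) , SimplePath.end (path n)))
      , disjoint
      where
      avoiding : ∀ F → ∃₂ λ m n → SimplePath (_∉ˡ F) (Ray.at R m) (Ray.at S n)
      avoiding F = by-contradiction λ ¬p → none (F , λ m n p → ¬p (m , n , p))

      used : ℕ → List V
      path : ∀ n → SimplePath (_∉ˡ used n) _ _
      trace : ℕ → List V
      used zero    = []
      used (suc n) = trace n ++ used n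
      path n = proj₂ (proj₂ (avoiding (used n)))
      trace n = SimplePath.first (path n) ∷ SimplePath.rest (path n)

      trace⊆used : ∀ {m n x} → m ℕ.<′ n → x ∈ˡ trace m → x ∈ˡ used n
      trace⊆used ℕ.≤′-refl x∈ = ∈-++⁺ˡ vertices x∈
      trace⊆used {n = suc n} (ℕ.≤′-step m<n) x∈ = ∈-++⁺ʳ vertices (trace n) (trace⊆used m<n x∈)

      disjoint-< : ∀ {m n} → m ℕ.< n → ∀ i j → ¬ lookup (trace m) i ≈ lookup (trace n) j
      disjoint-< {m} {n} m<n i j e = All.lookup (SimplePath.inside (path n)) (Membership.∈-lookup j)
        (∈-resp-≈ vertices e (trace⊆used (ℕ.≤⇒≤′ m<n) (∈-lookup vertices (trace m) i)))

      disjoint : ∀ m n → m ≢ n → Disjoint Γ (toPath (path m)) (toPath (path n))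
      disjoint m n m≢n i j e with ℕ.<-cmp m n
      ... | tri< m<n _ _ = disjoint-< m<n i j e
      ... | tri≈ _ m≡n _ = m≢n m≡n
      ... | tri> _ _ n<m = disjoint-< n<m j i (≈-sym e)

  ray-leaves : (T : Ray Γ) → ∀ L → Eventually (λ n → Ray.at T n ∉ˡ L)
  ray-leaves T L = eventually-map
    (λ off i → All-∈ (λ x≈y n h → n (≈-trans h (≈-sym x≈y))) off i ≈-refl)
    (eventually-avoids (λ n x → Ray.at T n ≈ x)
      (λ m≢n p q → m≢n (Ray.distinct T (≈-trans p (≈-sym q)))) L)

  -- Adjacency is symmetric, so `apart` excludes edges between the two sides in either order of the
  -- end points.
  record Cut (t : V → Side) : Set ℓ where
    field
      t-cong : ∀ {u v} → u ≈ v → t u ≡ t v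
      apart  : ∀ {u v} → Adjacent u v → t u ≡ ⊖ → t v ≢ ⊕
      zeros  : Enum (λ v → t v ≡ ⓪)

    order : ℕ
    order = length (Enum.list zeros)

    constant-off-zeros : ∀ {u v} → Adjacent u v → t u ≢ ⓪ → t v ≢ ⓪ → t u ≡ t v
    constant-off-zeros {u} {v} a u≢0 v≢0 with t u in eu | t v in ev
    ... | ⊖ | ⊖ = refl
    ... | ⊖ | ⓪ = contradiction refl v≢0
    ... | ⊖ | ⊕ = contradiction ev (apart a eu)
    ... | ⓪ | _ = contradiction refl u≢0
    ... | ⊕ | ⊖ = contradiction eu (apart (adjacent-sym a) ev)
    ... | ⊕ | ⓪ = contradiction refl v≢0
    ... | ⊕ | ⊕ = refl

    eventually-off-zeros : (T : Ray Γ) → Eventually (λ n → t (Ray.at T n) ≢ ⓪)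
    eventually-off-zeros T = eventually-map
      (λ off e → off (Enum.complete zeros e)) (ray-leaves T (Enum.list zeros))

    eventually-constant : (T : Ray Γ) → ∃[ s ] s ≢ ⓪ × Eventually (λ n → t (Ray.at T n) ≡ s)
    eventually-constant T with eventually-off-zeros T
    ... | n , nonzero = t (Ray.at T n) , nonzero n ℕ.≤-refl , n , λ m n≤m → go m (ℕ.≤⇒≤′ n≤m)
      where
      go : ∀ m → n ℕ.≤′ m → t (Ray.at T m) ≡ t (Ray.at T n)
      go m ℕ.≤′-refl = refl
      go (suc m) (ℕ.≤′-step le) = trans (sym (constant-off-zeros (Ray.adjacent T m)
        (nonzero m (ℕ.≤′⇒≤ le)) (nonzero (suc m) (ℕ.m≤n⇒m≤1+n (ℕ.≤′⇒≤ le))))) (go m le)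

    -- Of infinitely many disjoint connecting paths one misses the zeros as well as the initial
    -- segments of both rays. It joins the two tails and never meets a zero, so it stays on one
    -- side.
    equivalent⇒same-side : ∀ {T R s} → Equivalent Γ T R → s ≢ ⓪ →
      Eventually (λ n → t (Ray.at R n) ≡ s) → Eventually (λ n → t (Ray.at T n) ≡ s)
    equivalent⇒same-side {T} {R} {s} (P , on , disjoint) s≢0 (n₂ , R-tail)
      with eventually-constant T
    ... | s₁ , _ , n₁ , T-tail = n₁ , λ m n₁≤m → trans (T-tail m n₁≤m) s₁≡s
      where
      avoided : List V
      avoided = Enum.list zeros ++ applyUpTo (Ray.at T) n₁ ++ applyUpTo (Ray.at R) n₂

      meets : ℕ → V → Set ℓ
      meets n x = ∃[ i ] Path.at (P n) i ≈ x

      free : Eventually (λ n → All (λ x → ¬ meets n x) avoided)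
      free = eventually-avoids meets
        (λ m≢n (i , p) (j , q) → disjoint _ _ m≢n i j (≈-trans p (≈-sym q))) avoided

      N : ℕ
      N = proj₁ (eventually-witness free)

      misses : ∀ {x} → x ∈ˡ avoided → ¬ meets N x
      misses = All-∈ (λ x≈y n (i , h) → n (i , ≈-trans h (≈-sym x≈y))) (proj₂ (eventually-witness free))

      open Path (P N) using (at; adjacent; initial; terminal) renaming (length to len)

      off : ∀ i → t (at i) ≢ ⓪
      off i e = misses (∈-++⁺ˡ vertices (Enum.complete zeros e)) (i , ≈-refl)

      along : ∀ i → t initial ≡ t (at i)
      along = fin-induction _ refl λ i eq → trans eq (constant-off-zeros (adjacent i) (off _) (off _))

      a b : ℕ
      a = proj₁ (proj₁ (on N))
      b = proj₁ (proj₂ (on N))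

      n₁≤a : n₁ ℕ.≤ a
      n₁≤a = ℕ.≮⇒≥ λ a<n₁ → misses (∈-++⁺ʳ vertices (Enum.list zeros) (∈-++⁺ˡ vertices
        (∈-applyUpTo⁺ vertices (Ray.at T) a<n₁))) (fzero , proj₂ (proj₁ (on N)))

      n₂≤b : n₂ ℕ.≤ b
      n₂≤b = ℕ.≮⇒≥ λ b<n₂ → misses (∈-++⁺ʳ vertices (Enum.list zeros) (∈-++⁺ʳ vertices (applyUpTo (Ray.at T) n₁)
        (∈-applyUpTo⁺ vertices (Ray.at R) b<n₂))) (fromℕ len , proj₂ (proj₂ (on N)))

      s₁≡s : s₁ ≡ s
      s₁≡s = begin
        s₁               ≡⟨ T-tail a n₁≤a ⟨
        t (Ray.at T a)   ≡⟨ t-cong (proj₂ (proj₁ (on N))) ⟨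
        t initial        ≡⟨ along (fromℕ len) ⟩
        t terminal       ≡⟨ t-cong (proj₂ (proj₂ (on N))) ⟩
        t (Ray.at R b)   ≡⟨ R-tail b n₂≤b ⟩
        s                ∎
        where open ≡.≡-Reasoning

  record Separation (R S : Ray Γ) (t : V → Side) : Set ℓ where
    field
      cut    : Cut t
      R-tail : Eventually (λ n → t (Ray.at R n) ≡ ⊕)
      S-tail : Eventually (λ n → t (Ray.at S n) ≡ ⊖)
    open Cut cut public

  -- Off the finite separator `F`, the side ⊖ consists of the vertices that reach `S` by a path
  -- avoiding `F`, and ⊕ is the rest. An edge between the two sides would prolong such a path into
  -- ⊕.
  separation-exists : ∀ R S → ¬ Equivalent Γ R S → ∃ (Separation R S)
  separation-exists R S inequivalent with finite-separator R S inequivalent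
  ... | F , separates = t , record
    { cut = record
      { t-cong = t-cong
      ; apart = apart
      ; zeros = covered⇒enum (λ v → em₀) (λ x≈y e → trans (sym (t-cong x≈y)) e) F zero⇒∈ }
    ; R-tail = eventually-map (λ {n} → R-side n) (ray-leaves R F)
    ; S-tail = eventually-map (λ {n} → S-side n) (ray-leaves S F) }
    where
    Reach : V → Set ℓ
    Reach v = ∃[ n ] SimplePath (_∉ˡ F) v (Ray.at S n)

    t : V → Side
    t v with em {v ∈ˡ F} | em {Reach v}
    ... | yes _ | _     = ⓪
    ... | no _  | yes _ = ⊖
    ... | no _  | no _  = ⊕

    zero⇒∈ : ∀ {v} → t v ≡ ⓪ → v ∈ˡ F
    zero⇒∈ {v} e with em {v ∈ˡ F} | em {Reach v}
    zero⇒∈ e  | yes v∈ | _     = v∈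
    zero⇒∈ () | no _   | yes _
    zero⇒∈ () | no _   | no _

    reach-resp : ∀ {u v} → u ≈ v → Reach u → Reach v
    reach-resp u≈v (n , p) = n , record { SimplePath p; start = ≈-trans (SimplePath.start p) u≈v }

    t-cong : ∀ {u v} → u ≈ v → t u ≡ t v
    t-cong {u} {v} u≈v with em {u ∈ˡ F} | em {Reach u} | em {v ∈ˡ F} | em {Reach v}
    ... | yes _ | _ | yes _ | _ = refl
    ... | yes i | _ | no ∉ | _ = contradiction (∈-resp-≈ vertices u≈v i) ∉
    ... | no ∉ | _ | yes i | _ = contradiction (∈-resp-≈ vertices (≈-sym u≈v) i) ∉
    ... | no _ | yes _ | no _ | yes _ = refl
    ... | no _ | no _ | no _ | no _ = refl
    ... | no _ | yes r | no _ | no ¬r = contradiction (reach-resp u≈v r) ¬r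
    ... | no _ | no ¬r | no _ | yes r = contradiction (reach-resp (≈-sym u≈v) r) ¬r

    apart : ∀ {u v} → Adjacent u v → t u ≡ ⊖ → t v ≢ ⊕
    apart {u} {v} a eu ev with em {u ∈ˡ F} | em {Reach u} | em {v ∈ˡ F} | em {Reach v}
    apart a () ev | yes _ | _    | _     | _
    apart a () ev | no _ | no _  | _     | _
    apart a eu () | no _ | yes _ | yes _ | _
    apart a eu () | no _ | yes _ | no _  | yes _
    apart a eu ev | no _ | yes (n , p) | no v∉ | no ¬r = ¬r (n , extend-path v∉ (adjacent-sym a) p)

    S-side : ∀ n → Ray.at S n ∉ˡ F → t (Ray.at S n) ≡ ⊖
    S-side n ∉ with em {Ray.at S n ∈ˡ F} | em {Reach (Ray.at S n)}
    ... | yes i | _     = contradiction i ∉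
    ... | no _  | yes _ = refl
    ... | no _  | no ¬r = contradiction (n , trivial-path ∉) ¬r

    R-side : ∀ n → Ray.at R n ∉ˡ F → t (Ray.at R n) ≡ ⊕
    R-side n ∉ with em {Ray.at R n ∈ˡ F} | em {Reach (Ray.at R n)}
    ... | yes i | _           = contradiction i ∉
    ... | no _  | yes (m , p) = contradiction p (separates n m)
    ... | no _  | no _        = refl

-- The three-element chain of sides

infixr 7 _⊓_
infixr 6 _⊔_
infix 4 _≼_

_⊓_ _⊔_ : Side → Side → Side
⊖ ⊓ b = ⊖
⓪ ⊓ ⊖ = ⊖
⓪ ⊓ ⓪ = ⓪
⓪ ⊓ ⊕ = ⓪
⊕ ⊓ b = b
⊖ ⊔ b = b
⓪ ⊔ ⊖ = ⓪
⓪ ⊔ ⓪ = ⓪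
⓪ ⊔ ⊕ = ⊕
⊕ ⊔ b = ⊕

flip : Side → Side
flip ⊖ = ⊕
flip ⓪ = ⓪
flip ⊕ = ⊖

-- Sums of `isZero` give orders. `value` is odd under `flip`, so that an automorphism swapping the
-- ends negates signed counts.
isZero value : Side → ℤ
isZero ⊖ = 0ℤ
isZero ⓪ = 1ℤ
isZero ⊕ = 0ℤ
value ⊖ = -1ℤ
value ⓪ = 0ℤ
value ⊕ = 1ℤ

data _≼_ : Side → Side → Set where
  ⊖≼  : ∀ {b} → ⊖ ≼ b
  ≼⊕  : ∀ {a} → a ≼ ⊕
  ⓪≼⓪ : ⓪ ≼ ⓪

≼-refl : ∀ {a} → a ≼ a
≼-refl {⊖} = ⊖≼
≼-refl {⓪} = ⓪≼⓪
≼-refl {⊕} = ≼⊕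

≼-reflexive : ∀ {a b} → a ≡ b → a ≼ b
≼-reflexive refl = ≼-refl

≼-trans : ∀ {a b d} → a ≼ b → b ≼ d → a ≼ d
≼-trans ⊖≼  _   = ⊖≼
≼-trans ≼⊕  ≼⊕  = ≼⊕
≼-trans ⓪≼⓪ q   = q

≼-antisym : ∀ {a b} → a ≼ b → b ≼ a → a ≡ b
≼-antisym ⊖≼  ⊖≼  = refl
≼-antisym ≼⊕  ≼⊕  = refl
≼-antisym ⓪≼⓪ _   = refl

⊓-lower₁ : ∀ a b → a ⊓ b ≼ a
⊓-lower₁ ⊖ b = ⊖≼
⊓-lower₁ ⓪ ⊖ = ⊖≼
⊓-lower₁ ⓪ ⓪ = ⓪≼⓪
⊓-lower₁ ⓪ ⊕ = ⓪≼⓪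
⊓-lower₁ ⊕ b = ≼⊕

⊓-lower₂ : ∀ a b → a ⊓ b ≼ b
⊓-lower₂ ⊖ b = ⊖≼
⊓-lower₂ ⓪ ⊖ = ⊖≼
⊓-lower₂ ⓪ ⓪ = ⓪≼⓪
⊓-lower₂ ⓪ ⊕ = ≼⊕
⊓-lower₂ ⊕ b = ≼-refl

⊓-greatest : ∀ {a b d} → d ≼ a → d ≼ b → d ≼ a ⊓ b
⊓-greatest ⊖≼  _   = ⊖≼
⊓-greatest ≼⊕  q   = q
⊓-greatest ⓪≼⓪ ≼⊕  = ⓪≼⓪
⊓-greatest ⓪≼⓪ ⓪≼⓪ = ⓪≼⓪

⊔-upper₁ : ∀ a b → a ≼ a ⊔ b
⊔-upper₁ ⊖ b = ⊖≼
⊔-upper₁ ⓪ ⊖ = ⓪≼⓪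
⊔-upper₁ ⓪ ⓪ = ⓪≼⓪
⊔-upper₁ ⓪ ⊕ = ≼⊕
⊔-upper₁ ⊕ b = ≼⊕

⊔-upper₂ : ∀ a b → b ≼ a ⊔ b
⊔-upper₂ ⊖ b = ≼-refl
⊔-upper₂ ⓪ ⊖ = ⊖≼
⊔-upper₂ ⓪ ⓪ = ⓪≼⓪
⊔-upper₂ ⓪ ⊕ = ≼⊕
⊔-upper₂ ⊕ b = ≼⊕

⊔-least : ∀ {a b d} → a ≼ d → b ≼ d → a ⊔ b ≼ d
⊔-least ⊖≼  q   = q
⊔-least ≼⊕  _   = ≼⊕
⊔-least ⓪≼⓪ ⊖≼  = ⓪≼⓪
⊔-least ⓪≼⓪ ⓪≼⓪ = ⓪≼⓪

flip-involutive : ∀ a → flip (flip a) ≡ a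
flip-involutive ⊖ = refl
flip-involutive ⓪ = refl
flip-involutive ⊕ = refl

flip-⊓ : ∀ a b → flip (a ⊓ b) ≡ flip a ⊔ flip b
flip-⊓ ⊖ b = refl
flip-⊓ ⓪ ⊖ = refl
flip-⊓ ⓪ ⓪ = refl
flip-⊓ ⓪ ⊕ = refl
flip-⊓ ⊕ b = refl

flip-antitone : ∀ {a b} → a ≼ b → flip b ≼ flip a
flip-antitone ⊖≼  = ≼⊕
flip-antitone ≼⊕  = ⊖≼
flip-antitone ⓪≼⓪ = ⓪≼⓪

-- In a chain the meet and the join of two elements are those two elements again, possibly
-- exchanged.
⊓-⊔-modular : ∀ (f : Side → ℤ) a b → f (a ⊓ b) + f (a ⊔ b) ≡ f a + f b
⊓-⊔-modular f ⊖ b = refl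
⊓-⊔-modular f ⓪ ⊖ = ℤ.+-comm (f ⊖) (f ⓪)
⊓-⊔-modular f ⓪ ⓪ = refl
⊓-⊔-modular f ⓪ ⊕ = refl
⊓-⊔-modular f ⊕ b = ℤ.+-comm (f b) (f ⊕)

≡⊖? : ∀ a → Dec (a ≡ ⊖)
≡⊖? ⊖ = yes refl
≡⊖? ⓪ = no λ ()
≡⊖? ⊕ = no λ ()

≡⊕? : ∀ a → Dec (a ≡ ⊕)
≡⊕? ⊖ = no λ ()
≡⊕? ⓪ = no λ ()
≡⊕? ⊕ = yes refl

≡⓪? : ∀ a → Dec (a ≡ ⓪)
≡⓪? ⊖ = no λ ()
≡⓪? ⓪ = yes refl
≡⓪? ⊕ = no λ ()

≢⊖∧≢⊕⇒≡⓪ : ∀ {a} → a ≢ ⊖ → a ≢ ⊕ → a ≡ ⓪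
≢⊖∧≢⊕⇒≡⓪ {⊖} p q = contradiction refl p
≢⊖∧≢⊕⇒≡⓪ {⓪} p q = refl
≢⊖∧≢⊕⇒≡⓪ {⊕} p q = contradiction refl q

≢⊖∧≢⓪⇒≡⊕ : ∀ {a} → a ≢ ⊖ → a ≢ ⓪ → a ≡ ⊕
≢⊖∧≢⓪⇒≡⊕ p q with ≡⊕? _
... | yes e = e
... | no ¬e = contradiction (≢⊖∧≢⊕⇒≡⓪ p ¬e) q

≢⊕∧≢⓪⇒≡⊖ : ∀ {a} → a ≢ ⊕ → a ≢ ⓪ → a ≡ ⊖
≢⊕∧≢⓪⇒≡⊖ {⊖} p q = refl
≢⊕∧≢⓪⇒≡⊖ {⓪} p q = contradiction refl q
≢⊕∧≢⓪⇒≡⊖ {⊕} p q = contradiction refl p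

⊕-least : ∀ {a} → ⊕ ≼ a → a ≡ ⊕
⊕-least ≼⊕ = refl

⊖-greatest : ∀ {a} → a ≼ ⊖ → a ≡ ⊖
⊖-greatest ⊖≼ = refl

-- The lattice of minimal separations

module Separations {ℓ} (em : ExcludedMiddle ℓ) (Γ : Digraph ℓ ℓ ℓ) where
  open Digraph Γ renaming (refl to ≈-refl; sym to ≈-sym; trans to ≈-trans)
  open Finite em vertices
  open Connectivity em Γ
  open import Data.List.Membership.Setoid vertices renaming (_∈_ to _∈ˡ_; _∉_ to _∉ˡ_) using ()
  open import Data.List.Membership.Setoid.Properties using (∈-++⁺ˡ; ∈-++⁺ʳ; ∉⇒All[≉])
  open import Data.List.Relation.Unary.Unique.Setoid vertices using (Unique)

  infix 4 _≗_ _⊑_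
  infixr 7 _∧_
  infixr 6 _∨_

  -- Going up enlarges the ⊕ side, which contains the tail of `R`, so the separator moves towards
  -- the end of `S`.
  _≗_ _⊑_ : (V → Side) → (V → Side) → Set ℓ
  s ≗ t = ∀ v → s v ≡ t v
  s ⊑ t = ∀ v → s v ≼ t v

  _∧_ _∨_ : (V → Side) → (V → Side) → V → Side
  (s ∧ t) v = s v ⊓ t v
  (s ∨ t) v = s v ⊔ t v

  -- Minimality lies in the value of `k`, which `Lattice` and `Intervals` require to be a lower
  -- bound for all orders.
  Minimal : Ray Γ → Ray Γ → ℕ → (V → Side) → Set ℓ
  Minimal R S k t = Σ[ σ ∈ Separation R S t ] Separation.order σ ≡ k

  zero-resp : ∀ {t : V → Side} {a} → (∀ {u v} → u ≈ v → t u ≡ t v) → Respects (λ v → t v ≡ a)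
  zero-resp t-cong u≈v e = trans (sym (t-cong u≈v)) e

  minimal-resp : ∀ {R S k s t} → s ≗ t → Minimal R S k s → Minimal R S k t
  minimal-resp {s = s} {t} s≗t (σ , o) = record
    { cut = record
      { t-cong = λ {u} {v} u≈v → trans (sym (s≗t u)) (trans (t-cong u≈v) (s≗t v))
      ; apart = λ a eu ev → apart a (trans (s≗t _) eu) (trans (s≗t _) ev)
      ; zeros = record
        { list = Enum.list zeros ; unique = Enum.unique zeros
        ; sound = All.map (λ e → trans (sym (s≗t _)) e) (Enum.sound zeros)
        ; complete = λ e → Enum.complete zeros (trans (s≗t _) e) } }
    ; R-tail = eventually-map (trans (sym (s≗t _))) R-tail
    ; S-tail = eventually-map (trans (sym (s≗t _))) S-tail } , o
    where open Separation σ

  flip-separation : ∀ {R S t} → Separation R S t → Separation S R (flip ∘ t)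
  flip-separation {t = t} σ = record
    { cut = record
      { t-cong = cong flip ∘ t-cong
      ; apart = λ a eu ev → apart (adjacent-sym a) (unflip ev) (unflip eu)
      ; zeros = record
        { list = Enum.list zeros ; unique = Enum.unique zeros
        ; sound = All.map (cong flip) (Enum.sound zeros)
        ; complete = λ e → Enum.complete zeros (unflip e) } }
    ; R-tail = eventually-map (cong flip) S-tail
    ; S-tail = eventually-map (cong flip) R-tail }
    where
    open Separation σ
    unflip : ∀ {v a} → flip (t v) ≡ a → t v ≡ flip a
    unflip e = trans (sym (flip-involutive _)) (cong flip e)

  flip-minimal : ∀ {R S k t} → Minimal R S k t → Minimal S R k (flip ∘ t)
  flip-minimal (σ , o) = flip-separation σ , o

  ∧-separation : ∀ {R S s t} → Separation R S s → Separation R S t → Separation R S (s ∧ t)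
  ∧-separation {s = s} {t} σ τ = record
    { cut = record
      { t-cong = ∧-cong
      ; apart = ∧-apart
      ; zeros = covered⇒enum (λ _ → ≡⓪? _) (zero-resp ∧-cong)
          (Enum.list σ.zeros ++ Enum.list τ.zeros) (∧-zero _) }
    ; R-tail = eventually-map (λ (p , q) → cong₂ _⊓_ p q) (eventually-× σ.R-tail τ.R-tail)
    ; S-tail = eventually-map (λ p → cong (_⊓ _) p) σ.S-tail }
    where
    module σ = Separation σ
    module τ = Separation τ
    ∧-cong : ∀ {u v} → u ≈ v → (s ∧ t) u ≡ (s ∧ t) v
    ∧-cong u≈v = cong₂ _⊓_ (σ.t-cong u≈v) (τ.t-cong u≈v)
    ∧-apart : ∀ {u v} → Adjacent u v → (s ∧ t) u ≡ ⊖ → (s ∧ t) v ≢ ⊕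
    ∧-apart {u} {v} a eu ev with s u in su | t u in tu
    ... | ⊖ | _ = σ.apart a su (⊕-least (subst (_≼ s v) ev (⊓-lower₁ (s v) (t v))))
    ... | ⓪ | ⊖ = τ.apart a tu (⊕-least (subst (_≼ t v) ev (⊓-lower₂ (s v) (t v))))
    ... | ⊕ | ⊖ = τ.apart a tu (⊕-least (subst (_≼ t v) ev (⊓-lower₂ (s v) (t v))))
    ∧-zero : ∀ v → (s ∧ t) v ≡ ⓪ → v ∈ˡ (Enum.list σ.zeros ++ Enum.list τ.zeros)
    ∧-zero v e with s v in sv | t v in tv
    ... | ⓪ | _ = ∈-++⁺ˡ vertices (Enum.complete σ.zeros sv)
    ... | ⊕ | ⓪ = ∈-++⁺ʳ vertices (Enum.list σ.zeros) (Enum.complete τ.zeros tv)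

  -- By duality: `flip` exchanges meet with join and `R` with `S`. `minimal-resp` only carries the
  -- result over to a pointwise equal function.
  ∨-separation : ∀ {R S s t} → Separation R S s → Separation R S t → Separation R S (s ∨ t)
  ∨-separation {R} {S} {s} {t} σ τ = proj₁ (minimal-resp
    (λ v → trans (flip-⊓ (flip (s v)) (flip (t v)))
      (cong₂ _⊔_ (flip-involutive (s v)) (flip-involutive (t v))))
    (flip-separation (∧-separation (flip-separation σ) (flip-separation τ)) , refl))

  order-sum : ∀ {R S t} (σ : Separation R S t) {W} → Unique W → (∀ {v} → t v ≡ ⓪ → v ∈ˡ W) →
              + Separation.order σ ≡ sum (isZero ∘ t) W
  order-sum {t = t} σ {W} u c = begin
    + length (Enum.list zeros)               ≡⟨ sum-1 (Enum.list zeros) ⟨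
    sum (λ _ → 1ℤ) (Enum.list zeros)         ≡⟨ sum-cong _ (λ v∈ → sym (cong isZero (All-∈ (zero-resp t-cong) (Enum.sound zeros) v∈))) ⟩
    sum (isZero ∘ t) (Enum.list zeros)       ≡⟨ sum-support (isZero ∘ t) (cong isZero ∘ t-cong) (Enum.unique zeros) u
                                                 (λ _ nz → c (nonzero nz)) (λ _ nz → Enum.complete zeros (nonzero nz)) ⟩
    sum (isZero ∘ t) W                       ∎
    where
    open Separation σ
    open ≡.≡-Reasoning
    nonzero : ∀ {a} → isZero a ≢ 0ℤ → a ≡ ⓪
    nonzero {⊖} nz = contradiction refl nz
    nonzero {⓪} nz = refl
    nonzero {⊕} nz = contradiction refl nz

  -- The pointwise identity `⊓-⊔-modular` for `isZero` is summed over a list that contains the zeros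
  -- of all four separations.
  order-modular : ∀ {R S s t} (σ : Separation R S s) (τ : Separation R S t) →
    let open Separation in
    order (∧-separation σ τ) ℕ.+ order (∨-separation σ τ) ≡ order σ ℕ.+ order τ
  order-modular {s = s} {t} σ τ = ℤ.+-injective (begin
    + order (∧-separation σ τ) + + order (∨-separation σ τ)
      ≡⟨ cong₂ _+_ (order-sum (∧-separation σ τ) u (covers ∘ ∧-zero _ _)) (order-sum (∨-separation σ τ) u (covers ∘ ∨-zero _ _)) ⟩
    sum (isZero ∘ (s ∧ t)) W + sum (isZero ∘ (s ∨ t)) W      ≡⟨ sum-+ _ _ W ⟨
    sum (λ v → isZero (s v ⊓ t v) + isZero (s v ⊔ t v)) W    ≡⟨ sum-cong W (λ {v} _ → ⊓-⊔-modular isZero (s v) (t v)) ⟩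
    sum (λ v → isZero (s v) + isZero (t v)) W                ≡⟨ sum-+ _ _ W ⟩
    sum (isZero ∘ s) W + sum (isZero ∘ t) W
      ≡⟨ cong₂ _+_ (order-sum σ u (covers ∘ inj₁)) (order-sum τ u (covers ∘ inj₂)) ⟨
    + order σ + + order τ                                    ∎)
    where
    open Separation
    open ≡.≡-Reasoning
    all-zeros : Enum (_∈ˡ (Enum.list (zeros σ) ++ Enum.list (zeros τ)))
    all-zeros = members _
    W = Enum.list all-zeros
    u = Enum.unique all-zeros
    covers : ∀ {v} → s v ≡ ⓪ ⊎ t v ≡ ⓪ → v ∈ˡ W
    covers (inj₁ e) = Enum.complete all-zeros (∈-++⁺ˡ vertices (Enum.complete (zeros σ) e))
    covers (inj₂ e) = Enum.complete all-zeros (∈-++⁺ʳ vertices (Enum.list (zeros σ)) (Enum.complete (zeros τ) e))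
    ∧-zero : ∀ a b → a ⊓ b ≡ ⓪ → a ≡ ⓪ ⊎ b ≡ ⓪
    ∧-zero ⓪ b e = inj₁ refl
    ∧-zero ⊕ b e = inj₂ e
    ∨-zero : ∀ a b → a ⊔ b ≡ ⓪ → a ≡ ⓪ ⊎ b ≡ ⓪
    ∨-zero ⓪ b e = inj₁ refl
    ∨-zero ⊖ b e = inj₂ e

  module Lattice (R S : Ray Γ) (k : ℕ) (k-least : ∀ {t} (σ : Separation R S t) → k ℕ.≤ Separation.order σ) where

    Min : (V → Side) → Set ℓ
    Min = Minimal R S k

    -- The two orders add up to `k + k` and neither is less than `k`.
    min-∧-∨ : ∀ {s t} → Min s → Min t → Min (s ∧ t) × Min (s ∨ t)
    min-∧-∨ (σ , σ≡k) (τ , τ≡k) =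
        (∧-separation σ τ , squeeze (k-least (∧-separation σ τ)) (k-least (∨-separation σ τ)) total)
      , (∨-separation σ τ , squeeze (k-least (∨-separation σ τ)) (k-least (∧-separation σ τ))
          (trans (ℕ.+-comm (Separation.order (∨-separation σ τ)) _) total))
      where
      total = trans (order-modular σ τ) (cong₂ ℕ._+_ σ≡k τ≡k)
      squeeze : ∀ {a b} → k ℕ.≤ a → k ℕ.≤ b → a ℕ.+ b ≡ k ℕ.+ k → a ≡ k
      squeeze {a} {b} k≤a k≤b e = ℕ.≤-antisym (ℕ.+-cancelʳ-≤ k a k
        (ℕ.≤-trans (ℕ.+-monoʳ-≤ a k≤b) (ℕ.≤-reflexive e))) k≤a

    min-∧ : ∀ {s t} → Min s → Min t → Min (s ∧ t)
    min-∧ a b = proj₁ (min-∧-∨ a b)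

    min-∨ : ∀ {s t} → Min s → Min t → Min (s ∨ t)
    min-∨ a b = proj₂ (min-∧-∨ a b)

    module Min {t} (m : Min t) = Separation (proj₁ m)

    -- Both separations have exactly `k` zeros; a zero of `t` that is not one of `s` would give `t`
    -- at least `k + 1` of them.
    zeros-⊆⇒⊇ : ∀ {s t} → Min s → Min t → (∀ v → s v ≡ ⓪ → t v ≡ ⓪) → ∀ v → t v ≡ ⓪ → s v ≡ ⓪
    zeros-⊆⇒⊇ {s} {t} a b s⊆t v tv with ≡⓪? (s v)
    ... | yes sv = sv
    ... | no ¬sv = contradiction (unique-⊆⇒length≤ (∉⇒All[≉] vertices v∉ ∷ Enum.unique (Min.zeros a)) ⊆t)
            (ℕ.<⇒≱ (ℕ.≤-reflexive (cong suc (trans (proj₂ b) (sym (proj₂ a))))))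
      where
      s-zero : ∀ {x} → x ∈ˡ Enum.list (Min.zeros a) → s x ≡ ⓪
      s-zero = All-∈ (zero-resp (Min.t-cong a)) (Enum.sound (Min.zeros a))
      v∉ : v ∉ˡ Enum.list (Min.zeros a)
      v∉ v∈ = ¬sv (s-zero v∈)
      ⊆t : ∀ {x} → x ∈ˡ (v ∷ Enum.list (Min.zeros a)) → x ∈ˡ Enum.list (Min.zeros b)
      ⊆t (here e)   = Enum.complete (Min.zeros b) (trans (Min.t-cong b e) tv)
      ⊆t (there x∈) = Enum.complete (Min.zeros b) (s⊆t _ (s-zero x∈))

    module Covered (cover : ∀ v → ∃[ t ] Min t × t v ≡ ⓪) where

      -- If s and t differ at v, clipping a minimal separation through v to
      -- the interval [s , t] produces one with an additional zero.
      zeros-determine : ∀ {s t} → Min s → Min t → s ⊑ t → (∀ v → s v ≡ ⓪ → t v ≡ ⓪) → s ≗ t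
      zeros-determine {s} {t} a b s⊑t s⊆t v = compare (s v) (t v) refl refl
        where
        t⊆s = zeros-⊆⇒⊇ a b s⊆t
        clipped-zero : ∀ {x y} d → x ≡ ⓪ → y ≡ ⓪ → (d ⊔ x) ⊓ y ≡ ⓪
        clipped-zero ⊖ refl refl = refl
        clipped-zero ⓪ refl refl = refl
        clipped-zero ⊕ refl refl = refl
        not-apart : s v ≡ ⊖ → t v ≢ ⊕
        not-apart sv tv with cover v
        ... | u , m , uv = contradiction
          (trans (sym tv) (zeros-⊆⇒⊇ b (min-∧ (min-∨ m a) b) (λ x tx → clipped-zero (u x) (t⊆s x tx) tx) v
            (cong₂ _⊓_ (cong₂ _⊔_ uv sv) tv))) (λ ())
        compare : ∀ x y → s v ≡ x → t v ≡ y → s v ≡ t v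
        compare ⊖ ⊖ p q = trans p (sym q)
        compare ⊖ ⓪ p q = trans (t⊆s v q) (sym q)
        compare ⊖ ⊕ p q = contradiction q (not-apart p)
        compare ⓪ _ p q = trans p (sym (s⊆t v p))
        compare ⊕ _ p q = trans p (sym (⊕-least (subst (_≼ t v) p (s⊑t v))))

      abstract
        -- On any finite list the pointwise infimum agrees with a finite meet of members. Hence it
        -- has at most `k` zeros and is a separation of order `k`. A member agreeing with it on its
        -- zeros lies above it and has the same zeros, so `zeros-determine` identifies the two.
        least-element : (P : (V → Side) → Set ℓ) → (∀ {s} → P s → Min s) →
                        (∀ {s t} → P s → P t → P (s ∧ t)) →
                        ∀ {s₀ b} → P s₀ → Min b → (∀ {s} → P s → b ⊑ s) →
                        ∃[ m ] P m × (∀ {s} → P s → m ⊑ s)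
        least-element P P⇒min P-∧ {s₀} {b} Ps₀ b-min b⊑ =
          -- The member `s` is returned in place of `inf`, as `P` is not assumed to respect
          -- pointwise equality.
          s , Ps , λ Pt v → ≼-trans (≼-reflexive (sym (inf≗s v))) (inf⊑ Pt v)
          where
          inf : V → Side
          inf v with em {∃[ s ] P s × s v ≡ ⊖} | em {∃[ s ] P s × s v ≡ ⓪}
          ... | yes _ | _     = ⊖
          ... | no _  | yes _ = ⓪
          ... | no _  | no _  = ⊕

          inf⊑ : ∀ {s} → P s → inf ⊑ s
          inf⊑ {s} Ps v with em {∃[ s ] P s × s v ≡ ⊖} | em {∃[ s ] P s × s v ≡ ⓪}
          ... | yes _ | _     = ⊖≼
          ... | no n  | no n′ = ≼-reflexive (sym (≢⊖∧≢⓪⇒≡⊕ (λ e → n (s , Ps , e)) (λ e → n′ (s , Ps , e))))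
          ... | no n  | yes _ with s v in sv
          ...   | ⊖ = contradiction (s , Ps , sv) n
          ...   | ⓪ = ⓪≼⓪
          ...   | ⊕ = ≼⊕

          attained : ∀ v → ∃[ s ] P s × s v ≡ inf v
          attained v with em {∃[ s ] P s × s v ≡ ⊖} | em {∃[ s ] P s × s v ≡ ⓪}
          ... | yes p | _     = p
          ... | no _  | yes p = p
          ... | no n  | no n′ = s₀ , Ps₀ , ≢⊖∧≢⓪⇒≡⊕ (λ e → n (s₀ , Ps₀ , e)) (λ e → n′ (s₀ , Ps₀ , e))

          attained-on : ∀ L → ∃[ s ] P s × All (λ v → s v ≡ inf v) L
          attained-on [] = s₀ , Ps₀ , []
          attained-on (v ∷ L) with attained v | attained-on L
          ... | s , Ps , e | t , Pt , es = s ∧ t , P-∧ Ps Pt ,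
              ≼-antisym (≼-trans (⊓-lower₁ (s v) (t v)) (≼-reflexive e)) (inf⊑ (P-∧ Ps Pt) v)
            ∷ All.map (λ {x} e → ≼-antisym (≼-trans (⊓-lower₂ (s x) (t x)) (≼-reflexive e)) (inf⊑ (P-∧ Ps Pt) x)) es

          inf-cong-≼ : ∀ {u v} → u ≈ v → inf u ≼ inf v
          inf-cong-≼ {u} {v} u≈v with attained v
          ... | s , Ps , e = ≼-trans (inf⊑ Ps u) (≼-reflexive (trans (Min.t-cong (P⇒min Ps) u≈v) e))

          inf-cong : ∀ {u v} → u ≈ v → inf u ≡ inf v
          inf-cong u≈v = ≼-antisym (inf-cong-≼ u≈v) (inf-cong-≼ (≈-sym u≈v))

          inf-apart : ∀ {u v} → Adjacent u v → inf u ≡ ⊖ → inf v ≢ ⊕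
          inf-apart {u} {v} a eu ev with attained u
          ... | s , Ps , e = Min.apart (P⇒min Ps) a (trans e eu) (⊕-least (subst (_≼ s v) ev (inf⊑ Ps v)))

          few-zeros : ∀ L → Unique L → All (λ v → inf v ≡ ⓪) L → length L ℕ.≤ k
          few-zeros L u z with attained-on L
          ... | s , Ps , es = ℕ.≤-trans (unique-⊆⇒length≤ u L⊆) (ℕ.≤-reflexive (proj₂ (P⇒min Ps)))
            where
            s-zero : All (λ v → s v ≡ ⓪) L
            s-zero = All.zipWith (λ (p , q) → trans p q) (es , z)
            L⊆ : ∀ {x} → x ∈ˡ L → x ∈ˡ Enum.list (Min.zeros (P⇒min Ps))
            L⊆ x∈ = Enum.complete (Min.zeros (P⇒min Ps)) (All-∈ (zero-resp (Min.t-cong (P⇒min Ps))) s-zero x∈)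

          inf-zeros : Enum (λ v → inf v ≡ ⓪)
          inf-zeros = bounded⇒enum (zero-resp inf-cong) k few-zeros

          inf-separation : Separation R S inf
          inf-separation = record
            { cut = record { t-cong = inf-cong ; apart = inf-apart ; zeros = inf-zeros }
            -- Where `b` is ⊕ every member is ⊕, and so is the infimum; without a lower bound the
            -- separators could escape along `R`.
            ; R-tail = eventually-map (λ {n} e → let s , Ps , e′ = attained (Ray.at R n) in
                trans (sym e′) (⊕-least (subst (_≼ s (Ray.at R n)) e (b⊑ Ps _)))) (Min.R-tail b-min)
            ; S-tail = eventually-map (λ {n} e → ⊖-greatest (subst (inf (Ray.at S n) ≼_) e (inf⊑ Ps₀ _))) (Min.S-tail (P⇒min Ps₀)) }

          inf-min : Min inf
          inf-min = inf-separation , ℕ.≤-antisym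
            (few-zeros (Enum.list inf-zeros) (Enum.unique inf-zeros) (Enum.sound inf-zeros)) (k-least inf-separation)

          s : V → Side
          s = proj₁ (attained-on (Enum.list inf-zeros))
          Ps : P s
          Ps = proj₁ (proj₂ (attained-on (Enum.list inf-zeros)))

          inf≗s : inf ≗ s
          inf≗s = zeros-determine inf-min (P⇒min Ps) (inf⊑ Ps) λ v e → trans
            (All-∈ (λ x≈y p → trans (sym (Min.t-cong (P⇒min Ps) x≈y)) (trans p (inf-cong x≈y)))
              (proj₂ (proj₂ (attained-on (Enum.list inf-zeros)))) (Enum.complete inf-zeros e)) e

-- Finiteness of intervals of minimal separations

module Intervals {ℓ} (em : ExcludedMiddle ℓ) (Γ : Digraph ℓ ℓ ℓ)
  (R S : Ray Γ) (k : ℕ)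
  (k-least : ∀ {t} (σ : Connectivity.Separation em Γ R S t) → k ℕ.≤ Connectivity.Separation.order {em = em} σ)
  (cover : ∀ v → ∃[ t ] Separations.Minimal em Γ R S k t × t v ≡ ⓪)
  where
  open Digraph Γ renaming (refl to ≈-refl; sym to ≈-sym; trans to ≈-trans)
  open Finite em vertices
  open Connectivity em Γ
  open Separations em Γ
  open Lattice R S k k-least
  open Covered cover

  private
    flip-least : ∀ {t} (σ : Separation S R t) → k ℕ.≤ Separation.order σ
    flip-least σ = k-least (flip-separation σ)

    flip-cover : ∀ v → ∃[ t ] Minimal S R k t × t v ≡ ⓪
    flip-cover v = let t , m , e = cover v in flip ∘ t , flip-minimal m , cong flip e

    module Dual = Lattice.Covered S R k flip-least flip-cover

    flip-flip : (t : V → Side) → flip ∘ flip ∘ t ≗ t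
    flip-flip t v = flip-involutive (t v)

    unflip-⊑ : ∀ {s t : V → Side} → flip ∘ s ⊑ t → flip ∘ t ⊑ s
    unflip-⊑ {s} le v = subst (_ ≼_) (flip-involutive (s v)) (flip-antitone (le v))

    ⊑-unflip : ∀ {s t : V → Side} → s ⊑ flip ∘ t → t ⊑ flip ∘ s
    ⊑-unflip {t = t} le v = subst (_≼ _) (flip-involutive (t v)) (flip-antitone (le v))

  abstract
    greatest-element : (P : (V → Side) → Set ℓ) → (∀ {s t} → s ≗ t → P s → P t) → (∀ {s} → P s → Min s) →
                       (∀ {s t} → P s → P t → P (s ∨ t)) →
                       ∀ {s₀ b} → P s₀ → Min b → (∀ {s} → P s → s ⊑ b) →
                       ∃[ m ] P m × (∀ {s} → P s → s ⊑ m)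
    greatest-element P P-resp P⇒min P-∨ {s₀} {b} Ps₀ b-min ⊑b =
      let m , Pm , least = Dual.least-element (λ s → P (flip ∘ s))
            (λ {s} Ps → minimal-resp (flip-flip s) (flip-minimal (P⇒min Ps)))
            (λ {s} {t} Ps Pt → P-resp (λ v → sym (flip-⊓ (s v) (t v))) (P-∨ Ps Pt))
            (P-resp (λ v → sym (flip-flip s₀ v)) Ps₀) (flip-minimal b-min)
            (λ {s} Ps → unflip-⊑ {s} (⊑b Ps))
      in flip ∘ m , Pm , λ {s} Ps → ⊑-unflip {m} {s} (least (P-resp (λ v → sym (flip-flip s v)) Ps))

    -- An infinite strictly descending sequence is a ∧-closed family without a
    -- least element.
    minimal-element : (P : (V → Side) → Set ℓ) → (∀ {s} → P s → Min s) →
                      ∀ {s₀ b} → P s₀ → Min b → (∀ {s} → P s → b ⊑ s) →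
                      ∃[ m ] P m × (∀ {s} → P s → s ⊑ m → s ≗ m)
    minimal-element P P⇒min {s₀} {b} Ps₀ b-min b⊑ = by-contradiction descend
      where
      descend : ¬ (∃[ m ] P m × (∀ {s} → P s → s ⊑ m → s ≗ m)) → ⊥
      descend none = let m , (n , m≗) , least = limit in
        proj₂ (proj₂ (proj₂ (smaller (proj₂ (sequence n)))))
          λ v → ≼-antisym (proj₁ (proj₂ (proj₂ (smaller (proj₂ (sequence n))))) v)
                          (≼-trans (≼-reflexive (sym (m≗ v))) (least (suc n , λ _ → refl) v))
        where
        smaller : ∀ {s} → P s → ∃[ t ] P t × t ⊑ s × ¬ t ≗ s
        smaller {s} Ps = by-contradiction λ ¬smaller →
          none (s , Ps , λ {t} Pt t⊑s → by-contradiction λ t≢s → ¬smaller (t , Pt , t⊑s , t≢s))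

        sequence : ℕ → ∃ P
        sequence zero    = s₀ , Ps₀
        sequence (suc n) = let t , Pt , _ = smaller (proj₂ (sequence n)) in t , Pt

        antitone : ∀ {m n} → m ℕ.≤′ n → proj₁ (sequence n) ⊑ proj₁ (sequence m)
        antitone ℕ.≤′-refl v = ≼-refl
        antitone {n = suc n} (ℕ.≤′-step le) v =
          ≼-trans (proj₁ (proj₂ (proj₂ (smaller (proj₂ (sequence n))))) v) (antitone le v)

        Member : (V → Side) → Set ℓ
        Member s = ∃[ n ] s ≗ proj₁ (sequence n)

        member-min : ∀ {s} → Member s → Min s
        member-min (n , e) = minimal-resp (λ v → sym (e v)) (P⇒min (proj₂ (sequence n)))

        member-∧ : ∀ {s t} → Member s → Member t → Member (s ∧ t)
        member-∧ (m , e) (n , f) with ℕ.≤-total m n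
        ... | inj₁ m≤n = n , λ v → trans (cong₂ _⊓_ (e v) (f v))
              (≼-antisym (⊓-lower₂ _ _) (⊓-greatest (antitone (ℕ.≤⇒≤′ m≤n) v) ≼-refl))
        ... | inj₂ n≤m = m , λ v → trans (cong₂ _⊓_ (e v) (f v))
              (≼-antisym (⊓-lower₁ _ _) (⊓-greatest ≼-refl (antitone (ℕ.≤⇒≤′ n≤m) v)))

        limit : ∃[ m ] Member m × (∀ {s} → Member s → m ⊑ s)
        limit = least-element Member member-min member-∧ (0 , λ _ → refl) b-min
          (λ (n , e) v → ≼-trans (b⊑ (proj₂ (sequence n)) v) (≼-reflexive (sym (e v))))

  -- For `s ⊑ t` this is the strip enclosed by the two separators, including both of them.
  Between : (s t : V → Side) → V → Set
  Between s t v = s v ≢ ⊕ × t v ≢ ⊖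

  zeros-covering : ∀ {t} → Min t → Covering (λ v → t v ≡ ⓪)
  zeros-covering m = Enum.list (Min.zeros m) , Enum.complete (Min.zeros m)

  abstract
    -- Suppose the strip is infinite, and let `m` be the greatest separation in the interval that
    -- cuts off a finite part of it. Take `c` minimal among those strictly above `m`. The strip from
    -- `m` to `c` contains only zeros of `m` and of `c`, so `c` also cuts off a finite part, against
    -- the choice of `m`.
    between-finite : ∀ {s t} → Min s → Min t → s ⊑ t → Covering (Between s t)
    between-finite {s} {t} s-min t-min s⊑t = by-contradiction λ infinite →
      let m , (m-min , s⊑m , m⊑t , C) , m-greatest = top
          c , (c-min , m⊑c , c⊑t , c≢m) , c-minimal = atom m m-min m⊑t C infinite
          c⊑m = m-greatest (c-min , (λ v → ≼-trans (s⊑m v) (m⊑c v)) , c⊑t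
                , covering-⊎ (split m c) C (covering-⊎ (λ {v} → zero-of-end m m-min m⊑t c c-min m⊑c c⊑t c-minimal v)
                    (zeros-covering m-min) (zeros-covering c-min)))
      in c≢m (λ v → ≼-antisym (c⊑m v) (m⊑c v))
      where
      P : (V → Side) → Set ℓ
      P x = Min x × s ⊑ x × x ⊑ t × Covering (Between s x)

      P-resp : ∀ {x y} → x ≗ y → P x → P y
      P-resp x≗y (m , s⊑x , x⊑t , L , c) = minimal-resp x≗y m
        , (λ v → subst (s v ≼_) (x≗y v) (s⊑x v)) , (λ v → subst (_≼ t v) (x≗y v) (x⊑t v))
        , L , λ (p , q) → c (p , λ e → q (trans (sym (x≗y _)) e))

      P-∨ : ∀ {x y} → P x → P y → P (x ∨ y)
      P-∨ {x} {y} (m , s⊑x , x⊑t , C) (n , s⊑y , y⊑t , D) = min-∨ m n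
        , (λ v → ≼-trans (s⊑x v) (⊔-upper₁ (x v) (y v))) , (λ v → ⊔-least (x⊑t v) (y⊑t v))
        , covering-⊎ split C D
        where
        split : ∀ {v} → Between s (x ∨ y) v → Between s x v ⊎ Between s y v
        split {v} (p , q) with x v
        ... | ⊖ = inj₂ (p , q)
        ... | ⓪ = inj₁ (p , λ ())
        ... | ⊕ = inj₁ (p , λ ())

      top : ∃[ m ] P m × (∀ {x} → P x → x ⊑ m)
      top = greatest-element P P-resp proj₁ P-∨
        (s-min , (λ _ → ≼-refl) , s⊑t
          , covering-⊎ {T = Between s s} (λ (p , q) → inj₁ (≢⊖∧≢⊕⇒≡⓪ q p)) (zeros-covering s-min) (zeros-covering s-min))
        t-min (λ (_ , _ , x⊑t , _) → x⊑t)

      Above : (V → Side) → (V → Side) → Set ℓ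
      Above m x = Min x × m ⊑ x × x ⊑ t × ¬ x ≗ m

      atom : ∀ m → Min m → m ⊑ t → Covering (Between s m) → ¬ Covering (Between s t) →
             ∃[ c ] Above m c × (∀ {x} → Above m x → x ⊑ c → x ≗ c)
      atom m m-min m⊑t (L , c) infinite = minimal-element (Above m) proj₁
        (t-min , m⊑t , (λ _ → ≼-refl) , λ t≗m → infinite (L , λ (p , q) → c (p , λ e → q (trans (t≗m _) e))))
        m-min (λ (_ , m⊑x , _) → m⊑x)

      zero-of-end : ∀ m → Min m → m ⊑ t → ∀ c → Min c → m ⊑ c → c ⊑ t →
                    (∀ {x} → Above m x → x ⊑ c → x ≗ c) → ∀ v → Between m c v → m v ≡ ⓪ ⊎ c v ≡ ⓪
      zero-of-end m m-min m⊑t c c-min m⊑c c⊑t c-minimal v (p , q) with ≡⓪? (m v) | ≡⓪? (c v)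
      ... | yes e | _     = inj₁ e
      ... | no _  | yes e = inj₂ e
      ... | no m≢0 | no c≢0 with cover v
      ...   | u , u-min , uv = contradiction
              (trans (sym yv) (trans (c-minimal above (λ v → ⊓-lower₂ _ _) v) cv)) (λ ())
        where
        -- The separation `u` through `v`, clipped to the interval from `m` to `c`. Its zero at `v`,
        -- where `m` is ⊖ and `c` is ⊕, makes it differ from both, contradicting the minimality of
        -- `c`.
        y : V → Side
        y = (u ∨ m) ∧ c
        mv : m v ≡ ⊖
        mv = ≢⊕∧≢⓪⇒≡⊖ p m≢0
        cv : c v ≡ ⊕
        cv = ≢⊖∧≢⓪⇒≡⊕ q c≢0
        yv : y v ≡ ⓪
        yv = cong₂ _⊓_ (cong₂ _⊔_ uv mv) cv
        above : Above m y
        above = min-∧ (min-∨ u-min m-min) c-min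
          , (λ x → ⊓-greatest (⊔-upper₂ (u x) (m x)) (m⊑c x))
          , (λ x → ≼-trans (⊓-lower₂ _ _) (c⊑t x))
          , λ y≗m → contradiction (trans (sym yv) (trans (y≗m v) mv)) (λ ())

      split : ∀ m c {v} → Between s c v → Between s m v ⊎ Between m c v
      split m c {v} (p , q) with ≡⊖? (m v)
      ... | no m≢⊖ = inj₁ (p , m≢⊖)
      ... | yes mv = inj₂ ((λ e → contradiction (trans (sym mv) e) λ ()) , q)

infixr 7 _•_
_•_ : Sign → Side → Side
Sign.+ • a = a
Sign.- • a = flip a

•-assoc : ∀ e f a → (e Sign.* f) • a ≡ e • (f • a)
•-assoc Sign.+ f      a = refl
•-assoc Sign.- Sign.+ a = refl
•-assoc Sign.- Sign.- a = sym (flip-involutive a)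

•-⓪ : ∀ e {a} → e • a ≡ ⓪ → a ≡ ⓪
•-⓪ Sign.+ p = p
•-⓪ Sign.- {⓪} p = refl

⓪-• : ∀ e {a} → a ≡ ⓪ → e • a ≡ ⓪
⓪-• Sign.+ refl = refl
⓪-• Sign.- refl = refl

least : ∀ {ℓ} → ExcludedMiddle ℓ → (P : ℕ → Set ℓ) → ∃ P → ∃[ n ] P n × (∀ {m} → P m → n ℕ.≤ m)
least em P (n , Pn) = descend n n ℕ.≤-refl Pn
  where
  below : ∀ n → (∃[ m ] m ℕ.< n × P m) ⊎ (∀ {m} → P m → n ℕ.≤ m)
  below zero = inj₂ λ _ → z≤n
  below (suc n) with below n | em {P n}
  ... | inj₁ (m , m<n , Pm) | _ = inj₁ (m , ℕ.m<n⇒m<1+n m<n , Pm)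
  ... | inj₂ n≤ | yes Pn = inj₁ (n , ℕ.≤-refl , Pn)
  ... | inj₂ n≤ | no ¬Pn = inj₂ λ {m} Pm → ℕ.≤∧≢⇒< (n≤ Pm) λ { refl → ¬Pn Pm }
  descend : ∀ fuel n → n ℕ.≤ fuel → P n → ∃[ n ] P n × (∀ {m} → P m → n ℕ.≤ m)
  descend fuel n n≤fuel Pn with below n
  ... | inj₂ n≤ = n , Pn , n≤
  descend zero n z≤n Pn | inj₁ (m , () , Pm)
  descend (suc fuel) n n≤fuel Pn | inj₁ (m , m<n , Pm) =
    descend fuel m (ℕ.≤-pred (ℕ.≤-trans m<n n≤fuel)) Pm

-- The action on minimal separations

module EndAction {ℓ} (em : ExcludedMiddle ℓ) (Γ : Digraph ℓ ℓ ℓ)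
  (R S : Ray Γ) (R≁S : ¬ Equivalent Γ R S) (ends : ∀ T → Equivalent Γ T R ⊎ Equivalent Γ T S)
  where
  open Digraph Γ renaming (refl to ≈-refl; sym to ≈-sym; trans to ≈-trans)
  open Finite em vertices
  open Connectivity em Γ
  open Separations em Γ
  open Group (Aut Γ) using (_∙_; _⁻¹) renaming (ε to 𝟙; _≈_ to _≈ᴬ_)
  open Isomorphism using (to; from; to-cong; from-cong; from-arc; strictlyInverseˡ; strictlyInverseʳ)
  open import Data.List.Membership.Setoid.Properties using (∈-map⁺; ∈-resp-≈)

  from-injective : ∀ (g : Automorphism Γ) {u v} → from g u ≈ from g v → u ≈ v
  from-injective g e = ≈-trans (≈-sym (strictlyInverseˡ g _)) (≈-trans (to-cong g e) (strictlyInverseˡ g _))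

  to-injective : ∀ (g : Automorphism Γ) {u v} → to g u ≈ to g v → u ≈ v
  to-injective g = from-injective (g ⁻¹)

  to≈⇒from≈ : ∀ (g : Automorphism Γ) {u v} → to g u ≈ v → from g v ≈ u
  to≈⇒from≈ g e = ≈-trans (from-cong g (≈-sym e)) (strictlyInverseʳ g _)

  from-adjacent : ∀ (g : Automorphism Γ) {u v} → Adjacent u v → Adjacent (from g u) (from g v)
  from-adjacent g (inj₁ a) = inj₁ (from-arc g a)
  from-adjacent g (inj₂ a) = inj₂ (from-arc g a)

  pull-back-ray : Automorphism Γ → Ray Γ → Ray Γ
  pull-back-ray g T = record
    { at = from g ∘ Ray.at T ; adjacent = λ n → from-adjacent g (Ray.adjacent T n)
    ; distinct = λ e → Ray.distinct T (from-injective g e) }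

  act : Sign → Automorphism Γ → (V → Side) → V → Side
  act e g t v = e • t (from g v)

  act-cut : ∀ e g {t} → Cut t → Cut (act e g t)
  act-cut e g {t} κ = record
    { t-cong = act-cong
    ; apart  = act-apart e
    ; zeros  = record
      { list = map (to g) (Enum.list zeros)
      ; unique = Unique.map⁺ vertices vertices (to-injective g) (Enum.unique zeros)
      ; sound = All.map⁺ (All.map (λ {v} e₀ → ⓪-• e (trans (t-cong (strictlyInverseʳ g v)) e₀)) (Enum.sound zeros))
      ; complete = λ {v} e₀ → ∈-resp-≈ vertices (strictlyInverseˡ g v)
          (∈-map⁺ vertices vertices (to-cong g) (Enum.complete zeros (•-⓪ e e₀))) } }
    where
    open Cut κ
    act-cong : ∀ {u v} → u ≈ v → act e g t u ≡ act e g t v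
    act-cong u≈v = cong (e •_) (t-cong (from-cong g u≈v))
    act-apart : ∀ e {u v} → Adjacent u v → act e g t u ≡ ⊖ → act e g t v ≢ ⊕
    act-apart Sign.+ a eu ev = apart (from-adjacent g a) eu ev
    act-apart Sign.- a eu ev = apart (from-adjacent g (adjacent-sym a))
      (trans (sym (flip-involutive _)) (cong flip ev)) (trans (sym (flip-involutive _)) (cong flip eu))

  -- The sign tells whether `g` fixes or swaps the two ends. It is stated by its effect on the tails
  -- of every separation, so that it can be applied again to an already transformed separation,
  -- which makes signs multiplicative.
  record IsSign (g : Automorphism Γ) (e : Sign) : Set ℓ where
    constructor is-sign
    field
      tails : ∀ {t} → Separation R S t →
        Eventually (λ n → act e g t (Ray.at R n) ≡ ⊕) × Eventually (λ n → act e g t (Ray.at S n) ≡ ⊖)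
  open IsSign

  act-separation : ∀ {g e t} → IsSign g e → Separation R S t → Separation R S (act e g t)
  act-separation {g} {e} g-e σ = record
    { cut = act-cut e g (Separation.cut σ) ; R-tail = proj₁ (tails g-e σ) ; S-tail = proj₂ (tails g-e σ) }

  private
    t₀ : V → Side
    t₀ = proj₁ (separation-exists R S R≁S)

    σ₀ : Separation R S t₀
    σ₀ = proj₂ (separation-exists R S R≁S)

  abstract
    -- The preimages of `R` and `S` under `g` each belong to one of the two ends. They cannot belong
    -- to the same one: `t₀` composed with `g` is a cut that puts their tails on opposite sides.
    sign-exists : ∀ g → ∃ (IsSign g)
    sign-exists g = by-cases (ends R′) (ends S′)
      where
      R′ S′ : Ray Γ
      R′ = pull-back-ray g R
      S′ = pull-back-ray g S

      not-both : ∀ {T} → Equivalent Γ R′ T → ¬ Equivalent Γ S′ T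
      not-both {T} R~ S~ = contradiction (trans R≡ (sym S≡)) λ ()
        where
        κ : Cut (act Sign.+ (g ⁻¹) t₀)
        κ = act-cut Sign.+ (g ⁻¹) (Separation.cut σ₀)
        constant : ∃[ s ] s ≢ ⓪ × Eventually (λ n → act Sign.+ (g ⁻¹) t₀ (Ray.at T n) ≡ s)
        constant = Cut.eventually-constant κ T
        s : Side
        s = proj₁ constant
        restore : ∀ v → t₀ (to g (from g v)) ≡ t₀ v
        restore v = Separation.t-cong σ₀ (strictlyInverseˡ g v)
        R≡ : ⊕ ≡ s
        R≡ = let _ , p , q = eventually-witness (eventually-× (Separation.R-tail σ₀)
                   (Cut.equivalent⇒same-side κ {R′} {T} R~ (proj₁ (proj₂ constant)) (proj₂ (proj₂ constant))))
             in trans (sym p) (trans (sym (restore _)) q)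
        S≡ : ⊖ ≡ s
        S≡ = let _ , p , q = eventually-witness (eventually-× (Separation.S-tail σ₀)
                   (Cut.equivalent⇒same-side κ {S′} {T} S~ (proj₁ (proj₂ constant)) (proj₂ (proj₂ constant))))
             in trans (sym p) (trans (sym (restore _)) q)

      by-cases : Equivalent Γ R′ R ⊎ Equivalent Γ R′ S → Equivalent Γ S′ R ⊎ Equivalent Γ S′ S → ∃ (IsSign g)
      by-cases (inj₁ r) (inj₁ s) = contradiction s (not-both {R} r)
      by-cases (inj₂ r) (inj₂ s) = contradiction s (not-both {S} r)
      by-cases (inj₁ r) (inj₂ s) = Sign.+ , is-sign λ τ → let open Separation τ in
          equivalent⇒same-side {R′} {R} r (λ ()) R-tail , equivalent⇒same-side {S′} {S} s (λ ()) S-tail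
      by-cases (inj₂ r) (inj₁ s) = Sign.- , is-sign λ τ → let open Separation τ in
          eventually-map (cong flip) (equivalent⇒same-side {R′} {S} r (λ ()) S-tail)
        , eventually-map (cong flip) (equivalent⇒same-side {S′} {R} s (λ ()) R-tail)

  sign-unique : ∀ {g h e f} → g ≈ᴬ h → IsSign g e → IsSign h f → e ≡ f
  sign-unique {g} {h} {e} {f} g≈h g-e h-f =
    let n , p , q = eventually-witness (eventually-× (proj₁ (tails g-e {t₀} σ₀)) (proj₁ (tails h-f {t₀} σ₀)))
    in compare e f p (trans (cong {A = Side} (f •_) (Separation.t-cong σ₀ (Group.⁻¹-cong (Aut Γ) {g} {h} g≈h _))) q)
    where
    compare : ∀ e f {a} → e • a ≡ ⊕ → f • a ≡ ⊕ → e ≡ f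
    compare Sign.+ Sign.+ p q = refl
    compare Sign.- Sign.- p q = refl
    compare Sign.+ Sign.- refl ()
    compare Sign.- Sign.+ () refl

  sign : Automorphism Γ → Sign
  sign g = proj₁ (sign-exists g)

  isSign : ∀ g → IsSign g (sign g)
  isSign g = proj₂ (sign-exists g)

  sign-cong : ∀ {g h} → g ≈ᴬ h → sign g ≡ sign h
  sign-cong {g} {h} g≈h = sign-unique {g} {h} g≈h (isSign g) (isSign h)

  sign-𝟙 : sign 𝟙 ≡ Sign.+
  sign-𝟙 = sign-unique {𝟙} {𝟙} (λ _ → ≈-refl) (isSign 𝟙) (is-sign λ σ → Separation.R-tail σ , Separation.S-tail σ)

  sign-∙ : ∀ g h → sign (g ∙ h) ≡ sign g Sign.* sign h
  sign-∙ g h = sign-unique {g ∙ h} {g ∙ h} (λ _ → ≈-refl) (isSign (g ∙ h)) (is-sign λ {t} σ →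
    let p , q = tails (isSign g) {act (sign h) h t} (act-separation (isSign h) σ)
    in eventually-map (trans (•-assoc (sign g) (sign h) _)) p
     , eventually-map (trans (•-assoc (sign g) (sign h) _)) q)

  sign-⁻¹ : ∀ g → sign (g ⁻¹) ≡ sign g
  sign-⁻¹ g = cancel (sign (g ⁻¹)) (sign g) (trans (sym (sign-∙ (g ⁻¹) g))
    (trans (sign-cong {(g ⁻¹) ∙ g} {𝟙} (Group.inverseˡ (Aut Γ) g)) sign-𝟙))
    where
    cancel : ∀ e f → e Sign.* f ≡ Sign.+ → e ≡ f
    cancel Sign.+ f      p = sym p
    cancel Sign.- Sign.- p = refl

  infixr 6 _▹_
  _▹_ : Automorphism Γ → (V → Side) → V → Side
  g ▹ t = act (sign g) g t

  ▹-minimal : ∀ g {k t} → Minimal R S k t → Minimal R S k (g ▹ t)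
  ▹-minimal g (σ , o) = act-separation (isSign g) σ
    , trans (List.length-map (to g) (Enum.list (Separation.zeros σ))) o

  ▹-∙ : ∀ g h t → (g ∙ h) ▹ t ≗ g ▹ h ▹ t
  ▹-∙ g h t v = trans (cong (_• t (from h (from g v))) (sign-∙ g h)) (•-assoc (sign g) (sign h) _)

  ▹-cong : ∀ {g h t} → g ≈ᴬ h → Cut t → g ▹ t ≗ h ▹ t
  ▹-cong {g} {h} {t} g≈h κ v = cong₂ _•_ (sign-cong {g} {h} g≈h)
    (Cut.t-cong κ (Group.⁻¹-cong (Aut Γ) {g} {h} g≈h v))

  minimal-exists : ∃₂ λ k t → Minimal R S k t × (∀ {s} (σ : Separation R S s) → k ℕ.≤ Separation.order σ)
  minimal-exists =
    let k , (t , m) , k≤ = least em (λ n → ∃ (Minimal R S n)) (Separation.order σ₀ , t₀ , σ₀ , refl)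
    in k , t , m , λ {s} σ → k≤ (s , σ , refl)

  module _ (connected : Connected Γ) where

    -- Without zeros the side would be constant on the connected digraph, yet the two tails lie on
    -- different sides.
    zero-exists : ∀ {t} → Separation R S t → ∃[ v ] t v ≡ ⓪
    zero-exists {t} σ = by-contradiction λ none →
      let m , r = eventually-witness R-tail
          n , s = eventually-witness S-tail
      in contradiction (trans (sym s) (connected-induction connected (λ v → t v ≡ ⊕) (zero-resp t-cong)
           (λ {u} {v} a p → trans (sym (constant-off-zeros a (λ e → none (u , e)) (λ e → none (v , e)))) p) _ _ r)) (λ ())
      where open Separation σ

    module _ (transitive : VertexTransitive Γ) where

      abstract
        minimal-through : ∀ {k t} → Minimal R S k t → ∀ v → ∃[ s ] Minimal R S k s × s v ≡ ⓪
        minimal-through {t = t} m v =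
          let z , tz = zero-exists (proj₁ m)
              g , gz≈v = transitive z v
          in g ▹ t , ▹-minimal g m , ⓪-• (sign g) (trans (Separation.t-cong (proj₁ m) (to≈⇒from≈ g gz≈v)) tz)

        -- Were no minimal separation to have v on side a, then all automorphisms
        -- taking x or y to v would swap the ends.  Hence some automorphism fixing
        -- the ends takes x to y, by arc-transitivity one takes any vertex to any
        -- neighbour, and by connectedness one takes x to v.
        minimal-with-side : ArcTransitive Γ → ∀ {k t a x y} → Minimal R S k t →
          Adjacent x y → t x ≡ a → t y ≡ a → ∀ v → ∃[ s ] Minimal R S k s × s v ≡ a
        minimal-with-side arc-transitive {t = t} {a} {x} {y} m xy tx ty v = by-contradiction λ none →
          let swaps : ∀ {z} → t z ≡ a → ∀ g → to g z ≈ v → sign g ≡ Sign.-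
              swaps tz g gz≈v = negative λ g+ → none (g ▹ t , ▹-minimal g m ,
                trans (cong (_• t (from g v)) g+) (trans (Separation.t-cong (proj₁ m) (to≈⇒from≈ g gz≈v)) tz))
              g , gx = transitive x v
              h , hy = transitive y v
              g- = swaps tx g gx
              h- = swaps ty h hy
              f : Automorphism Γ
              f = (h ⁻¹) ∙ g
              f+ = trans (sign-∙ (h ⁻¹) g) (cong₂ Sign._*_ (trans (sign-⁻¹ h) h-) g-)
              x~y : x ~ y
              x~y = f , ≈-trans (from-cong h gx) (to≈⇒from≈ h hy) , f+
              k , kx , k+ = connected-induction connected (x ~_) (λ e (k , kx , k+) → k , ≈-trans kx e , k+)
                (λ uv x~u → ~-trans x~u (adjacent-~ x~y xy uv)) x v (𝟙 , ≈-refl , sign-𝟙)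
          in contradiction (trans (sym k+) (swaps tx k kx)) (λ ())
          where
          _~_ : V → V → Set ℓ
          u ~ w = Σ[ g ∈ Automorphism Γ ] to g u ≈ w × sign g ≡ Sign.+

          ~-sym : ∀ {u w} → u ~ w → w ~ u
          ~-sym (g , gu , g+) = g ⁻¹ , to≈⇒from≈ g gu , trans (sign-⁻¹ g) g+

          ~-trans : ∀ {u v w} → u ~ v → v ~ w → u ~ w
          ~-trans (g , gu , g+) (h , hv , h+) = h ∙ g , ≈-trans (to-cong h gu) hv
            , trans (sign-∙ h g) (cong₂ Sign._*_ h+ g+)

          negative : ∀ {e} → e ≢ Sign.+ → e ≡ Sign.-
          negative {Sign.+} e≢+ = contradiction refl e≢+
          negative {Sign.-} e≢+ = refl

          arc-~ : ∀ {x y u w} → x ~ y → E x y → E u w → u ~ w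
          arc-~ (f , fx , f+) xy uw =
            let g , gx , gy = arc-transitive xy uw
            in g ∙ (f ∙ (g ⁻¹)) , ≈-trans (to-cong g (≈-trans (to-cong f (to≈⇒from≈ g gx)) fx)) gy
             , trans (sign-∙ g (f ∙ (g ⁻¹))) (trans (cong (sign g Sign.*_) (trans (sign-∙ f (g ⁻¹))
                 (cong₂ Sign._*_ f+ (sign-⁻¹ g)))) (Sign.s*s≡+ (sign g)))

          adjacent-~ : ∀ {x y u w} → x ~ y → Adjacent x y → Adjacent u w → u ~ w
          adjacent-~ f (inj₁ xy) (inj₁ uw) = arc-~ f xy uw
          adjacent-~ f (inj₁ xy) (inj₂ wu) = ~-sym (arc-~ f xy wu)
          adjacent-~ f (inj₂ yx) (inj₁ uw) = arc-~ (~-sym f) yx uw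
          adjacent-~ f (inj₂ yx) (inj₂ wu) = ~-sym (arc-~ (~-sym f) yx wu)

value-• : ∀ e a → value (e • a) ≡ e ⋆ value a
value-• Sign.+ a = refl
value-• Sign.- ⊖ = refl
value-• Sign.- ⓪ = refl
value-• Sign.- ⊕ = refl

value-mono : ∀ {a b} → a ≼ b → value a ℤ.≤ value b
value-mono {b = ⊖} ⊖≼  = ℤ.≤-refl
value-mono {b = ⓪} ⊖≼  = ℤ.-≤+
value-mono {b = ⊕} ⊖≼  = ℤ.-≤+
value-mono {⊖}     ≼⊕  = ℤ.-≤+
value-mono {⓪}     ≼⊕  = ℤ.+≤+ z≤n
value-mono {⊕}     ≼⊕  = ℤ.≤-refl
value-mono         ⓪≼⓪ = ℤ.≤-refl

value-injective : ∀ {a b} → value a ≡ value b → a ≡ b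
value-injective {⊖} {⊖} e = refl
value-injective {⓪} {⓪} e = refl
value-injective {⊕} {⊕} e = refl

⋆-+ : ∀ e i j → e ⋆ (i + j) ≡ e ⋆ i + e ⋆ j
⋆-+ Sign.+ i j = refl
⋆-+ Sign.- i j = ℤ.neg-distrib-+ i j

⋆-- : ∀ e i j → e ⋆ (i - j) ≡ e ⋆ i - e ⋆ j
⋆-- Sign.+ i j = refl
⋆-- Sign.- i j = ℤ.neg-distrib-+ i (- j)

⋆-assoc : ∀ e f i → (e Sign.* f) ⋆ i ≡ e ⋆ f ⋆ i
⋆-assoc Sign.+ f      i = refl
⋆-assoc Sign.- Sign.+ i = refl
⋆-assoc Sign.- Sign.- i = sym (ℤ.neg-involutive i)

∣⋆∣ : ∀ e i → ∣ e ⋆ i ∣ ≡ ∣ i ∣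
∣⋆∣ Sign.+ i = refl
∣⋆∣ Sign.- i = ℤ.∣-i∣≡∣i∣ i

sum≡0⇒neg : ∀ {i j} → i + j ≡ 0ℤ → j ≡ - i
sum≡0⇒neg {i} {j} e = trans (isolate i j) (trans (cong (_- i) e) (ℤ.+-identityˡ (- i)))
  where
  isolate : ∀ i j → j ≡ (i + j) - i
  isolate = solve-∀

idempotent⇒0 : ∀ {i} → i + i ≡ i → i ≡ 0ℤ
idempotent⇒0 {i} e = trans (isolate i) (trans (cong (_- i) e) (ℤ.+-inverseʳ i))
  where
  isolate : ∀ i → i ≡ (i + i) - i
  isolate = solve-∀

-- The height function

module Heights {ℓ} (em : ExcludedMiddle ℓ) (Γ : Digraph ℓ ℓ ℓ)
  (connected : Connected Γ) (transitive : VertexTransitive Γ) (arc-transitive : ArcTransitive Γ)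
  (R S : Ray Γ) (R≁S : ¬ Equivalent Γ R S) (ends : ∀ T → Equivalent Γ T R ⊎ Equivalent Γ T S)
  (k : ℕ) (t₀ : Digraph.V Γ → Side) (m₀ : Separations.Minimal em Γ R S k t₀)
  (k-least : ∀ {t} (σ : Connectivity.Separation em Γ R S t) → k ℕ.≤ Connectivity.Separation.order {em = em} σ)
  where
  open Digraph Γ renaming (refl to ≈-refl; sym to ≈-sym; trans to ≈-trans)
  open Finite em vertices
  open Connectivity em Γ
  open Separations em Γ
  open EndAction em Γ R S R≁S ends
  open Lattice R S k k-least

  private
    cover : ∀ v → ∃[ t ] Min t × t v ≡ ⓪
    cover = minimal-through connected transitive m₀

  open Covered cover
  open Intervals em Γ R S k k-least cover
  open Group (Aut Γ) using (_∙_; _⁻¹) renaming (_≈_ to _≈ᴬ_)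
  open Isomorphism using (to; from; to-cong; from-cong; strictlyInverseˡ; strictlyInverseʳ)
  open import Data.List.Membership.Setoid vertices renaming (_∈_ to _∈ˡ_) using ()
  open import Data.List.Membership.Setoid.Properties using (∈-map⁺; ∈-map⁻; ∈-resp-≈; ∈-++⁺ˡ; ∈-++⁺ʳ)
  open import Data.List.Relation.Unary.Unique.Setoid vertices using (Unique)

  abstract
    -- Two consecutive vertices far out on `R` form the edge inside the ⊕ side from which
    -- `minimal-with-side` starts.
    above : ∀ v → ∃[ t ] Min t × t v ≡ ⊕
    above v = let n , tail = Min.R-tail m₀ in minimal-with-side connected transitive arc-transitive m₀
      (Ray.adjacent R n) (tail n ℕ.≤-refl) (tail (suc n) (ℕ.n≤1+n n)) v

    below : ∀ v → ∃[ t ] Min t × t v ≡ ⊖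
    below v = let n , tail = Min.S-tail m₀ in minimal-with-side connected transitive arc-transitive m₀
      (Ray.adjacent S n) (tail n ℕ.≤-refl) (tail (suc n) (ℕ.n≤1+n n)) v

    -- Choose `t` with `v` on its ⊕ side and `s` with `v` on its ⊖ side. No neighbour of `v` is on
    -- the ⊖ side of `t` or on the ⊕ side of `s`, so all lie in the finite strip from `t ∧ s` to
    -- `t ∨ s`. Meet and join are taken because `t` and `s` need not be comparable.
    neighbours-finite : ∀ v → Covering (Adjacent v)
    neighbours-finite v with above v | below v
    ... | t , m , tv | s , n , sv = covering-map (λ a →
            (λ e → Min.apart n a sv (⊕-least (subst (_≼ s _) e (⊓-lower₂ (t _) (s _)))))
          , (λ e → Min.apart m (adjacent-sym a) (⊖-greatest (subst (t _ ≼_) e (⊔-upper₁ (t _) (s _)))) tv))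
        (between-finite (min-∧ m n) (min-∨ m n) λ x → ≼-trans (⊓-lower₁ (t x) (s x)) (⊔-upper₁ (t x) (s x)))

  Within : ℕ → V → V → Set ℓ
  Within zero    u v = u ≈ v
  Within (suc n) u v = Within n u v ⊎ ∃[ w ] Within n u w × Adjacent w v

  within-respˡ : ∀ n {u u′ v} → u ≈ u′ → Within n u v → Within n u′ v
  within-respˡ zero    e p = ≈-trans (≈-sym e) p
  within-respˡ (suc n) e (inj₁ p) = inj₁ (within-respˡ n e p)
  within-respˡ (suc n) e (inj₂ (w , p , a)) = inj₂ (w , within-respˡ n e p , a)

  within-respʳ : ∀ n {u v v′} → v ≈ v′ → Within n u v → Within n u v′
  within-respʳ zero    e p = ≈-trans p e
  within-respʳ (suc n) e (inj₁ p) = inj₁ (within-respʳ n e p)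
  within-respʳ (suc n) e (inj₂ (w , p , a)) = inj₂ (w , p , adjacent-resp ≈-refl e a)

  within-step : ∀ n {u w v} → Adjacent u w → Within n w v → Within (suc n) u v
  within-step zero    a p = inj₂ (_ , ≈-refl , adjacent-resp ≈-refl p a)
  within-step (suc n) a (inj₁ p) = inj₁ (within-step n a p)
  within-step (suc n) a (inj₂ (x , p , b)) = inj₂ (x , within-step n a p , b)

  within-sym : ∀ n {u v} → Within n u v → Within n v u
  within-sym zero    p = ≈-sym p
  within-sym (suc n) (inj₁ p) = inj₁ (within-sym n p)
  within-sym (suc n) (inj₂ (w , p , a)) = within-step n (adjacent-sym a) (within-sym n p)

  within-mono : ∀ {m n u v} → m ℕ.≤′ n → Within m u v → Within n u v
  within-mono ℕ.≤′-refl p = p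
  within-mono (ℕ.≤′-step le) p = inj₁ (within-mono le p)

  within-to : ∀ (g : Automorphism Γ) n {u v} → Within n u v → Within n (to g u) (to g v)
  within-to g zero p = to-cong g p
  within-to g (suc n) (inj₁ p) = inj₁ (within-to g n p)
  within-to g (suc n) (inj₂ (w , p , a)) = inj₂ (to g w , within-to g n p , from-adjacent (g ⁻¹) a)

  within-finite : ∀ n u → Covering (Within n u)
  within-finite zero u = u ∷ [] , λ p → here (≈-sym p)
  within-finite (suc n) u = let L , c = within-finite n u in
    covering-⊎ (λ { (inj₁ p) → inj₁ (c p) ; (inj₂ (w , p , a)) → inj₂ (w , c p , a) }) (L , id)
      (covering-⋃ (λ e → adjacent-resp e ≈-refl) neighbours-finite L)

  within-some : ∀ u v → ∃[ n ] Within n u v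
  within-some u v = connected-induction connected (λ v → ∃[ n ] Within n u v) (λ e (n , p) → n , within-respʳ n e p)
    (λ a (n , p) → suc n , inj₂ (_ , p , a)) u v (0 , ≈-refl)

  within-all : ∀ u L → ∃[ n ] (∀ {v} → v ∈ˡ L → Within n u v)
  within-all u [] = 0 , λ ()
  within-all u (x ∷ L) with within-some u x | within-all u L
  ... | m , p | n , f = m ℕ.⊔ n , λ
    { (here e) → within-mono (ℕ.≤⇒≤′ (ℕ.m≤m⊔n m n)) (within-respʳ m (≈-sym e) p)
    ; (there i) → within-mono (ℕ.≤⇒≤′ (ℕ.m≤n⊔m m n)) (f i) }

  constant-within : ∀ {t} → Cut t → ∀ n {u v} → (∀ {x} → Within n u x → t x ≢ ⓪) → Within n u v → t v ≡ t u
  constant-within κ zero    nz p = sym (Cut.t-cong κ p)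
  constant-within κ (suc n) nz (inj₁ p) = constant-within κ n (nz ∘ inj₁) p
  constant-within κ (suc n) nz (inj₂ (w , p , a)) = trans
    (sym (Cut.constant-off-zeros κ a (nz (inj₁ p)) (nz (inj₂ (w , p , a))))) (constant-within κ n (nz ∘ inj₁) p)

  -- The zeros of `s` are also zeros of `s ∧ t`. Both have `k` zeros and they are comparable, so
  -- they coincide.
  zeros-above⇒⊑ : ∀ {s t} → Min s → Min t → (∀ x → s x ≡ ⓪ → t x ≡ ⊕) → s ⊑ t
  zeros-above⇒⊑ {s} {t} a b s⇒t v = subst (_≼ t v) (∧≗s v) (⊓-lower₂ (s v) (t v))
    where
    ∧≗s : s ∧ t ≗ s
    ∧≗s = zeros-determine (min-∧ a b) a (λ x → ⊓-lower₁ (s x) (t x))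
      (zeros-⊆⇒⊇ a (min-∧ a b) λ x sx → cong₂ _⊓_ sx (s⇒t x sx))

  zeros-below⇒⊒ : ∀ {s t} → Min s → Min t → (∀ x → s x ≡ ⓪ → t x ≡ ⊖) → t ⊑ s
  zeros-below⇒⊒ {s} {t} a b s⇒t v = subst (t v ≼_) (sym (s≗∨ v)) (⊔-upper₂ (s v) (t v))
    where
    s≗∨ : s ≗ s ∨ t
    s≗∨ = zeros-determine a (min-∨ a b) (λ x → ⊔-upper₁ (s x) (t x))
      (λ x sx → cong₂ _⊔_ sx (s⇒t x sx))

  difference : (s t : V → Side) → V → ℤ
  difference s t v = value (t v) - value (s v)

  abstract
    -- Outside the strip from the meet to the join, `s` and `t` are both ⊕ or both ⊖.
    difference-list : ∀ {s t} → Min s → Min t → Σ[ W ∈ List V ] Unique W × (∀ {v} → s v ≢ t v → v ∈ˡ W)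
    difference-list {s} {t} a b = Enum.list D , Enum.unique D , λ n → Enum.complete D (proj₂ differences n)
      where
      differences : Covering (λ v → s v ≢ t v)
      differences = covering-map
        (λ {v} s≢t → (λ e → s≢t (trans (⊕-least (subst (_≼ s v) e (⊓-lower₁ (s v) (t v))))
                                   (sym (⊕-least (subst (_≼ t v) e (⊓-lower₂ (s v) (t v)))))))
                   , (λ e → s≢t (trans (⊖-greatest (subst (s v ≼_) e (⊔-upper₁ (s v) (t v))))
                                   (sym (⊖-greatest (subst (t v ≼_) e (⊔-upper₂ (s v) (t v))))))))
        (between-finite (min-∧ a b) (min-∨ a b) λ x → ≼-trans (⊓-lower₁ (s x) (t x)) (⊔-upper₁ (s x) (t x)))
      D : Enum (_∈ˡ proj₁ differences)
      D = members (proj₁ differences)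

    -- The signed distance between two separations. A vertex passing from ⊖ to ⊕ counts twice and
    -- one that only enters or leaves the separator counts once; as a sum of differences it is
    -- additive.
    δ : ∀ {s t} → Min s → Min t → ℤ
    δ {s} {t} a b = sum (difference s t) (proj₁ (difference-list a b))

    δ-sum : ∀ {s t} (a : Min s) (b : Min t) {W} → Unique W → (∀ {v} → s v ≢ t v → v ∈ˡ W) →
            δ a b ≡ sum (difference s t) W
    δ-sum {s} {t} a b u c = sum-support (difference s t)
      (λ e → cong₂ (λ x y → value x - value y) (Min.t-cong b e) (Min.t-cong a e)) (proj₁ (proj₂ (difference-list a b))) u
      (λ _ nz → c (differ nz)) (λ _ nz → proj₂ (proj₂ (difference-list a b)) (differ nz))
      where
      differ : ∀ {v} → difference s t v ≢ 0ℤ → s v ≢ t v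
      differ {v} nz e = nz (trans (cong (λ x → value (t v) - value x) e) (ℤ.+-inverseʳ (value (t v))))

  δ-trans : ∀ {s t u} (a : Min s) (b : Min t) (d : Min u) → δ a b + δ b d ≡ δ a d
  δ-trans {s} {t} {u} a b d = begin
    δ a b + δ b d
      ≡⟨ cong₂ _+_ (δ-sum a b (Enum.unique D) (λ n → Enum.complete D (inAB n)))
                   (δ-sum b d (Enum.unique D) (λ n → Enum.complete D (inBD n))) ⟩
    sum (difference s t) W + sum (difference t u) W         ≡⟨ sum-+ _ _ W ⟨
    sum (λ v → difference s t v + difference t u v) W       ≡⟨ sum-cong W (λ {v} _ → telescope (value (s v)) (value (t v)) (value (u v))) ⟩
    sum (difference s u) W                                  ≡⟨ δ-sum a d (Enum.unique D) (λ n → Enum.complete D (split n)) ⟨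
    δ a d                                                   ∎
    where
    open ≡.≡-Reasoning
    AB = difference-list a b
    BD = difference-list b d
    D : Enum (_∈ˡ (proj₁ AB ++ proj₁ BD))
    D = members (proj₁ AB ++ proj₁ BD)
    W : List V
    W = Enum.list D
    inAB : ∀ {v} → s v ≢ t v → v ∈ˡ (proj₁ AB ++ proj₁ BD)
    inAB n = ∈-++⁺ˡ vertices (proj₂ (proj₂ AB) n)
    inBD : ∀ {v} → t v ≢ u v → v ∈ˡ (proj₁ AB ++ proj₁ BD)
    inBD n = ∈-++⁺ʳ vertices (proj₁ AB) (proj₂ (proj₂ BD) n)
    split : ∀ {v} → s v ≢ u v → v ∈ˡ (proj₁ AB ++ proj₁ BD)
    split {v} n with em₀ {s v ≡ t v}
    ... | yes e = inBD λ e′ → n (trans e e′)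
    ... | no ¬e = inAB ¬e
    telescope : ∀ x y z → (y - x) + (z - y) ≡ z - x
    telescope = solve-∀

  δ-resp : ∀ {s s′ t t′} (a : Min s) (b : Min t) (a′ : Min s′) (b′ : Min t′) → s ≗ s′ → t ≗ t′ → δ a b ≡ δ a′ b′
  δ-resp a b a′ b′ p q = let W , u , c = difference-list a b in trans (δ-sum a b u c)
    (trans (sum-cong W λ {v} _ → cong₂ (λ x y → value x - value y) (q v) (p v))
      (sym (δ-sum a′ b′ u λ n → c λ e → n (trans (sym (p _)) (trans e (q _))))))

  δ-self : ∀ {s} (a : Min s) → δ a a ≡ 0ℤ
  δ-self a = idempotent⇒0 (δ-trans a a a)

  δ-swap : ∀ {s t} (a : Min s) (b : Min t) → δ b a ≡ - δ a b
  δ-swap a b = sum≡0⇒neg (trans (δ-trans a b a) (δ-self a))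

  δ-nonneg : ∀ {s t} (a : Min s) (b : Min t) → s ⊑ t → 0ℤ ℤ.≤ δ a b
  δ-nonneg {s} {t} a b s⊑t = let W , u , c = difference-list a b in
    subst (0ℤ ℤ.≤_) (sym (δ-sum a b u c)) (subst (ℤ._≤ sum (difference s t) W) (sum-zero W (λ _ → refl))
      (sum-mono {f = λ _ → 0ℤ} W λ v → ℤ.i≤j⇒0≤j-i (value-mono (s⊑t v))))

  -- All summands are nonnegative, so a vanishing sum would force `s` and `t` to agree at `v`.
  δ-pos : ∀ {s t} (a : Min s) (b : Min t) → s ⊑ t → ∀ v → s v ≢ t v → 1ℤ ℤ.≤ δ a b
  δ-pos {s} {t} a b s⊑t v s≢t = ℤ.i<j⇒suc[i]≤j (ℤ.≤∧≢⇒< (δ-nonneg a b s⊑t) λ 0≡δ →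
    let W , u , c = difference-list a b
        zero = sum-squeeze {f = λ _ → 0ℤ} {difference s t} W (λ v → ℤ.i≤j⇒0≤j-i (value-mono (s⊑t v)))
          (ℤ.≤-reflexive (trans (sym (δ-sum a b u c)) (trans (sym 0≡δ) (sym (sum-zero W (λ _ → refl))))))
    in s≢t (value-injective (sym (ℤ.i-j≡0⇒i≡j (value (t v)) (value (s v)) (sym (All-∈
         (λ e z → trans z (cong₂ (λ x y → value x - value y) (Min.t-cong b e) (Min.t-cong a e))) zero (c s≢t)))))))

  δ-▹ : ∀ g {s t} (a : Min s) (b : Min t) → δ (▹-minimal g a) (▹-minimal g b) ≡ sign g ⋆ δ a b
  δ-▹ g {s} {t} a b = begin
    δ (▹-minimal g a) (▹-minimal g b)
      ≡⟨ δ-sum (▹-minimal g a) (▹-minimal g b) (Unique.map⁺ vertices vertices (to-injective g) u) moved ⟩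
    sum (difference (g ▹ s) (g ▹ t)) (map (to g) W)            ≡⟨ sum-map _ (to g) W ⟩
    sum (λ v → difference (g ▹ s) (g ▹ t) (to g v)) W          ≡⟨ sum-cong W (λ {v} _ → pointwise v) ⟩
    sum (λ v → sign g ⋆ difference s t v) W                    ≡⟨ sum-⋆ (sign g) ⟩
    sign g ⋆ sum (difference s t) W                            ≡⟨ cong (sign g ⋆_) (δ-sum a b u c) ⟨
    sign g ⋆ δ a b                                             ∎
    where
    open ≡.≡-Reasoning
    W = proj₁ (difference-list a b)
    u = proj₁ (proj₂ (difference-list a b))
    c : ∀ {v} → s v ≢ t v → v ∈ˡ W
    c = proj₂ (proj₂ (difference-list a b))
    moved : ∀ {v} → (g ▹ s) v ≢ (g ▹ t) v → v ∈ˡ map (to g) W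
    moved {v} n = ∈-resp-≈ vertices (strictlyInverseˡ g v)
      (∈-map⁺ vertices vertices (to-cong g) (c λ e → n (cong (sign g •_) e)))
    pointwise : ∀ v → difference (g ▹ s) (g ▹ t) (to g v) ≡ sign g ⋆ difference s t v
    pointwise v = trans (cong₂ (λ x y → value (sign g • x) - value (sign g • y))
        (Min.t-cong b (strictlyInverseʳ g v)) (Min.t-cong a (strictlyInverseʳ g v)))
      (trans (cong₂ _-_ (value-• (sign g) (t v)) (value-• (sign g) (s v))) (sym (⋆-- (sign g) (value (t v)) (value (s v)))))
    sum-⋆ : ∀ e → sum (λ v → e ⋆ difference s t v) W ≡ e ⋆ sum (difference s t) W
    sum-⋆ Sign.+ = refl
    sum-⋆ Sign.- = sum-neg (difference s t) W

  -- At a zero `z` of `t`, the meet with a separation that has `z` on its ⊖ side is strictly smaller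
  -- than `t`. Iteration leads arbitrarily far from `t₀`.
  pushed-down : ∀ {t} → Min t → ∃[ s ] Σ[ m ∈ Min s ] (∀ (b : Min t) → δ b m ℤ.≤ -1ℤ)
  pushed-down {t} b =
    let z , tz = zero-exists connected (proj₁ b)
        s , m , sz = below z
        n = min-∧ b m
    in t ∧ s , n , λ b′ → subst (ℤ._≤ -1ℤ) (sym (δ-swap n b′)) (ℤ.neg-mono-≤
         (δ-pos n b′ (λ v → ⊓-lower₁ (t v) (s v)) z
           λ e → contradiction (trans (sym (cong₂ _⊓_ tz sz)) (trans e tz)) λ ()))

  pushed-up : ∀ {t} → Min t → ∃[ s ] Σ[ m ∈ Min s ] (∀ (b : Min t) → 1ℤ ℤ.≤ δ b m)
  pushed-up {t} b =
    let z , tz = zero-exists connected (proj₁ b)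
        s , m , sz = above z
        n = min-∨ b m
    in t ∨ s , n , λ b′ → δ-pos b′ n (λ v → ⊔-upper₁ (t v) (s v)) z
         λ e → contradiction (trans (sym tz) (trans e (cong₂ _⊔_ tz sz))) λ ()

  abstract
    far-below : ∀ M → ∃[ s ] Σ[ m ∈ Min s ] δ m₀ m ℤ.≤ -[1+ M ]
    far-below zero = let s , m , le = pushed-down m₀ in s , m , le m₀
    far-below (suc M) =
      let s , m , le = far-below M
          t , n , le′ = pushed-down m
      in t , n , subst₂ ℤ._≤_ (δ-trans m₀ m n) (cong (-[1+_] ∘ suc) (ℕ.+-identityʳ M)) (ℤ.+-mono-≤ le (le′ m))

    far-above : ∀ M → ∃[ s ] Σ[ m ∈ Min s ] + suc M ℤ.≤ δ m₀ m
    far-above zero = let s , m , le = pushed-up m₀ in s , m , le m₀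
    far-above (suc M) =
      let s , m , le = far-above M
          t , n , le′ = pushed-up m
      in t , n , subst₂ ℤ._≤_ (cong (+_ ∘ suc) (ℕ.+-comm M 1)) (δ-trans m₀ m n) (ℤ.+-mono-≤ le (le′ m))

  -- Paired with `sign` this is the homomorphism to `D∞`: the rule `μ-∙` is the first component of
  -- multiplication in the semidirect product.
  μ : Automorphism Γ → ℤ
  μ g = δ m₀ (▹-minimal g m₀)

  μ-cong : ∀ {g h} → g ≈ᴬ h → μ g ≡ μ h
  μ-cong {g} {h} g≈h = δ-resp m₀ (▹-minimal g m₀) m₀ (▹-minimal h m₀) (λ _ → refl)
    (▹-cong {g} {h} g≈h (Separation.cut (proj₁ m₀)))

  μ-∙ : ∀ g h → μ (g ∙ h) ≡ μ g + sign g ⋆ μ h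
  μ-∙ g h = begin
    μ (g ∙ h)                                   ≡⟨ δ-resp m₀ (▹-minimal (g ∙ h) m₀) m₀ ghm (λ _ → refl) (▹-∙ g h t₀) ⟩
    δ m₀ ghm                                    ≡⟨ δ-trans m₀ gm ghm ⟨
    μ g + δ gm ghm                              ≡⟨ cong (_+_ (μ g)) (δ-▹ g m₀ (▹-minimal h m₀)) ⟩
    μ g + sign g ⋆ μ h                          ∎
    where
    open ≡.≡-Reasoning
    gm : Min (g ▹ t₀)
    gm = ▹-minimal g m₀
    ghm : Min (g ▹ h ▹ t₀)
    ghm = ▹-minimal g (▹-minimal h m₀)

  v₀ : V
  v₀ = Ray.at R 0

  -- The ball about v₀ that contains the support of g ▹ t₀ - t₀ is finite and
  -- g-invariant, so the two functions have the same sum over it.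
  μ-fixed : ∀ g → to g v₀ ≈ v₀ → sign g ≡ Sign.+ → μ g ≡ 0ℤ
  μ-fixed g gv₀ g+ = begin
    μ g                                                     ≡⟨ δ-sum m₀ (▹-minimal g m₀) (Enum.unique ball) (λ n → Enum.complete ball (in-ball (c n))) ⟩
    sum (λ v → value ((g ▹ t₀) v) - value (t₀ v)) B         ≡⟨ sum-+ _ _ B ⟩
    sum (value ∘ (g ▹ t₀)) B + sum (λ v → - value (t₀ v)) B ≡⟨ cong₂ _+_ (sum-cong B λ {v} _ → cong (λ e → value (e • t₀ (from g v))) g+) (sum-neg _ B) ⟩
    sum (value ∘ t₀ ∘ from g) B - sum (value ∘ t₀) B        ≡⟨ cong (_- sum (value ∘ t₀) B) (sum-map (value ∘ t₀) (from g) B) ⟨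
    sum (value ∘ t₀) (map (from g) B) - sum (value ∘ t₀) B  ≡⟨ cong (_- sum (value ∘ t₀) B) permuted ⟩
    sum (value ∘ t₀) B - sum (value ∘ t₀) B                 ≡⟨ ℤ.+-inverseʳ (sum (value ∘ t₀) B) ⟩
    0ℤ                                                      ∎
    where
    open ≡.≡-Reasoning
    W : List V
    W = proj₁ (difference-list m₀ (▹-minimal g m₀))
    c : ∀ {v} → t₀ v ≢ (g ▹ t₀) v → v ∈ˡ W
    c = proj₂ (proj₂ (difference-list m₀ (▹-minimal g m₀)))
    n : ℕ
    n = proj₁ (within-all v₀ W)
    in-ball : ∀ {v} → v ∈ˡ W → Within n v₀ v
    in-ball = proj₂ (within-all v₀ W)
    ball : Enum (Within n v₀)
    ball = covered⇒enum (λ _ → em) (λ e → within-respʳ n e) (proj₁ (within-finite n v₀)) (proj₂ (within-finite n v₀))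
    B : List V
    B = Enum.list ball
    ball-sound : ∀ {v} → v ∈ˡ B → Within n v₀ v
    ball-sound = All-∈ (λ e → within-respʳ n e) (Enum.sound ball)
    permuted : sum (value ∘ t₀) (map (from g) B) ≡ sum (value ∘ t₀) B
    permuted = sum-support (value ∘ t₀) (cong value ∘ Min.t-cong m₀)
      (Unique.map⁺ vertices vertices (from-injective g) (Enum.unique ball)) (Enum.unique ball)
      (λ x∈ _ → let y , y∈ , x≈ = ∈-map⁻ vertices vertices x∈ in Enum.complete ball
        (within-respˡ n (to≈⇒from≈ g gv₀) (within-respʳ n (≈-sym x≈) (within-to (g ⁻¹) n (ball-sound y∈)))))
      (λ {x} x∈ _ → ∈-resp-≈ vertices (strictlyInverseʳ g x) (∈-map⁺ vertices vertices (from-cong g)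
        (Enum.complete ball (within-respˡ n gv₀ (within-to g n (ball-sound x∈))))))

  affine : Automorphism Γ → ℤ → ℤ
  affine g y = μ g + μ g + sign g ⋆ y

  affine-∙ : ∀ g h y → affine (g ∙ h) y ≡ affine g (affine h y)
  affine-∙ g h y = trans
    (cong₂ (λ a b → a + a + b) (μ-∙ g h) (trans (cong (_⋆ y) (sign-∙ g h)) (⋆-assoc (sign g) (sign h) y)))
    (distribute (sign g) (μ g) (μ h) (sign h ⋆ y))
    where
    distribute : ∀ e a b z → (a + e ⋆ b) + (a + e ⋆ b) + e ⋆ z ≡ a + a + e ⋆ (b + b + z)
    distribute Sign.+ = plus
      where
      plus : ∀ a b z → (a + b) + (a + b) + z ≡ a + a + (b + b + z)
      plus = solve-∀
    distribute Sign.- = minus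
      where
      minus : ∀ a b z → (a + - b) + (a + - b) + - z ≡ a + a + - (b + b + z)
      minus = solve-∀

  affine-cong : ∀ {g h} → g ≈ᴬ h → ∀ y → affine g y ≡ affine h y
  affine-cong {g} {h} g≈h y = cong₂ (λ a e → a + a + e ⋆ y) (μ-cong {g} {h} g≈h) (sign-cong {g} {h} g≈h)

  private
    Reflection : Set ℓ
    Reflection = Σ[ σ ∈ Automorphism Γ ] to σ v₀ ≈ v₀ × sign σ ≡ Sign.-

  -- A point of ℤ fixed by the affine action of the stabilizer of v₀; doubling μ
  -- makes the centre of a reflection an integer.
  base-exists : ∃[ x ] (∀ g → to g v₀ ≈ v₀ → affine g x ≡ x)
  base-exists with em {Reflection}
  ... | no none = 0ℤ , λ g gv₀ → fixes g gv₀ (sign g) refl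
    where
    fixes : ∀ g → to g v₀ ≈ v₀ → ∀ e → sign g ≡ e → affine g 0ℤ ≡ 0ℤ
    fixes g gv₀ Sign.+ g+ = cong₂ (λ a e → a + a + e ⋆ 0ℤ) (μ-fixed g gv₀ g+) g+
    fixes g gv₀ Sign.- g- = contradiction (g , gv₀ , g-) none
  ... | yes (σ , σv₀ , σ-) = μ σ , λ g gv₀ → fixes g gv₀ (sign g) refl
    where
    fixes : ∀ g → to g v₀ ≈ v₀ → ∀ e → sign g ≡ e → affine g (μ σ) ≡ μ σ
    fixes g gv₀ Sign.+ g+ = trans (cong₂ (λ a e → a + a + e ⋆ μ σ) (μ-fixed g gv₀ g+) g+) (ℤ.+-identityˡ (μ σ))
    fixes g gv₀ Sign.- g- = trans (cong₂ (λ a e → a + a + e ⋆ μ σ) μg≡μσ g-) (cancel (μ σ))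
      where
      cancel : ∀ a → a + a + - a ≡ a
      cancel = solve-∀
      μg≡μσ : μ g ≡ μ σ
      μg≡μσ = sym (ℤ.i-j≡0⇒i≡j (μ σ) (μ g) (trans
        (sym (trans (μ-∙ σ g) (cong (λ e → μ σ + e ⋆ μ g) σ-)))
        (μ-fixed (σ ∙ g) (≈-trans (to-cong σ gv₀) σv₀) (trans (sign-∙ σ g) (cong₂ Sign._*_ σ- g-)))))

  private
    base : ℤ
    base = proj₁ base-exists

    to-vertex : ∀ v → Σ[ g ∈ Automorphism Γ ] to g v₀ ≈ v
    to-vertex = transitive v₀

  -- The orbit map taking the image of `v₀` under `g` to the image of `base`. It does not depend on
  -- `g`, since the stabilizer of `v₀` fixes `base`.
  height : V → ℤ
  height v = affine (proj₁ (to-vertex v)) base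

  height-via : ∀ g {v} → to g v₀ ≈ v → affine g base ≡ height v
  height-via g {v} gv₀ = begin
    affine g base                      ≡⟨ cong (affine g) (proj₂ base-exists σ σv₀) ⟨
    affine g (affine σ base)           ≡⟨ affine-∙ g σ base ⟨
    affine (g ∙ σ) base                ≡⟨ affine-cong {g ∙ σ} {f} (λ x → strictlyInverseˡ g (to f x)) base ⟩
    height v                           ∎
    where
    open ≡.≡-Reasoning
    f σ : Automorphism Γ
    f = proj₁ (to-vertex v)
    σ = (g ⁻¹) ∙ f
    σv₀ : to σ v₀ ≈ v₀
    σv₀ = ≈-trans (from-cong g (proj₂ (to-vertex v))) (to≈⇒from≈ g gv₀)

  height-cong : ∀ {u v} → u ≈ v → height u ≡ height v
  height-cong {u} u≈v = height-via (proj₁ (to-vertex u)) (≈-trans (proj₂ (to-vertex u)) u≈v)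

  height-to : ∀ g v → height (to g v) ≡ affine g (height v)
  height-to g v = trans (sym (height-via (g ∙ f) (to-cong g (proj₂ (to-vertex v))))) (affine-∙ g f base)
    where
    f = proj₁ (to-vertex v)

  -- Take `b` and `c` farther than `M` below and above `t₀`, and `n` such that the zeros of `t₀` lie
  -- within distance `n` of `v₀`; then those of `g ▹ t₀` lie within `n` of `v`. Unless `v` is within
  -- `n` of a zero of `b` or `c`, these zeros are on the same side of `b` and of `c` as `v` is. With
  -- `v` on the ⊕ side of `b` this would give `g ▹ t₀ ⊑ b`, and with `v` on the ⊖ side of `c` it
  -- would give `c ⊑ g ▹ t₀`; either makes the shift larger than `M`. So `v` lies in the finite
  -- strip between them.
  bounded-shift : ∀ M → Covering (λ v → Σ[ g ∈ Automorphism Γ ] to g v₀ ≈ v × ∣ μ g ∣ ℕ.≤ M)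
  bounded-shift M with far-below M | far-above M | within-all v₀ (Enum.list (Min.zeros m₀))
  ... | b , b-min , low | c , c-min , high | n , near =
    covering-⊎ (λ {v} → split v) (nearby {b} (Min.zeros b-min))
      (covering-⊎ {P = λ v → ∃[ w ] w ∈ˡ Enum.list (Min.zeros c-min) × Within n w v} {Q = Between (b ∧ c) (b ∨ c)}
        {T = λ v → (∃[ w ] w ∈ˡ Enum.list (Min.zeros c-min) × Within n w v) ⊎ Between (b ∧ c) (b ∨ c) v} id
        (nearby {c} (Min.zeros c-min))
        (between-finite (min-∧ b-min c-min) (min-∨ b-min c-min) λ x → ≼-trans (⊓-lower₁ (b x) (c x)) (⊔-upper₁ (b x) (c x))))
    where
    nearby : ∀ {t} (Z : Enum (λ v → t v ≡ ⓪)) → Covering (λ v → ∃[ w ] w ∈ˡ Enum.list Z × Within n w v)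
    nearby Z = covering-⋃ (λ e → within-respˡ n e) (within-finite n) (Enum.list Z)

    moved-zeros : ∀ g {v} → to g v₀ ≈ v → ∀ x → (g ▹ t₀) x ≡ ⓪ → Within n v x
    moved-zeros g gv₀ x e = within-respˡ n gv₀ (within-respʳ n (strictlyInverseˡ g x)
      (within-to g n (near (Enum.complete (Min.zeros m₀) (•-⓪ (sign g) e)))))

    off : ∀ {t} (m : Min t) {v} → ¬ (∃[ w ] w ∈ˡ Enum.list (Min.zeros m) × Within n w v) →
          ∀ {x} → Within n v x → t x ≢ ⓪
    off m ¬near p e = ¬near (_ , Enum.complete (Min.zeros m) e , within-sym n p)

    split : ∀ v → (Σ[ g ∈ Automorphism Γ ] to g v₀ ≈ v × ∣ μ g ∣ ℕ.≤ M) →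
            (∃[ w ] w ∈ˡ Enum.list (Min.zeros b-min) × Within n w v) ⊎
            ((∃[ w ] w ∈ˡ Enum.list (Min.zeros c-min) × Within n w v) ⊎ Between (b ∧ c) (b ∨ c) v)
    split v (g , gv₀ , small) with em {∃[ w ] w ∈ˡ Enum.list (Min.zeros b-min) × Within n w v}
                                 | em {∃[ w ] w ∈ˡ Enum.list (Min.zeros c-min) × Within n w v}
    ... | yes p | _     = inj₁ p
    ... | no _  | yes p = inj₂ (inj₁ p)
    ... | no ¬b | no ¬c = inj₂ (inj₂
            ( (λ e → not-above (⊕-least (subst (_≼ b v) e (⊓-lower₁ (b v) (c v)))))
            , (λ e → not-below (⊖-greatest (subst (c v ≼_) e (⊔-upper₂ (b v) (c v)))))))
      where
      gm : Min (g ▹ t₀)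
      gm = ▹-minimal g m₀

      not-above : b v ≢ ⊕
      not-above bv = ℕ.<⇒≱ (large (ℤ.≤-trans μ≤ low)) small
        where
        ▹⊑b : g ▹ t₀ ⊑ b
        ▹⊑b = zeros-above⇒⊑ gm b-min λ x e →
          trans (constant-within (Min.cut b-min) n (off b-min ¬b) (moved-zeros g gv₀ x e)) bv
        μ≤ : μ g ℤ.≤ δ m₀ b-min
        μ≤ = subst₂ ℤ._≤_ (ℤ.+-identityʳ (μ g)) (δ-trans m₀ gm b-min)
          (ℤ.+-monoʳ-≤ (μ g) (δ-nonneg gm b-min ▹⊑b))
        large : ∀ {i} → i ℤ.≤ -[1+ M ] → M ℕ.< ∣ i ∣
        large (ℤ.-≤- le) = s≤s le

      not-below : c v ≢ ⊖
      not-below cv = ℕ.<⇒≱ (large (ℤ.≤-trans high ≤μ)) small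
        where
        c⊑▹ : c ⊑ g ▹ t₀
        c⊑▹ = zeros-below⇒⊒ gm c-min λ x e →
          trans (constant-within (Min.cut c-min) n (off c-min ¬c) (moved-zeros g gv₀ x e)) cv
        ≤μ : δ m₀ c-min ℤ.≤ μ g
        ≤μ = subst₂ ℤ._≤_ (ℤ.+-identityʳ (δ m₀ c-min)) (δ-trans m₀ c-min gm)
          (ℤ.+-monoʳ-≤ (δ m₀ c-min) (δ-nonneg c-min gm c⊑▹))
        large : ∀ {i} → + suc M ℤ.≤ i → M ℕ.< ∣ i ∣
        large (ℤ.+≤+ le) = le

  height-finite : ∀ j → Covering (λ v → height v ≡ j)
  height-finite j = covering-map small (bounded-shift (∣ j ∣ ℕ.+ ∣ base ∣))
    where
    small : ∀ {v} → height v ≡ j → Σ[ g ∈ Automorphism Γ ] to g v₀ ≈ v × ∣ μ g ∣ ℕ.≤ ∣ j ∣ ℕ.+ ∣ base ∣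
    small {v} e = g , proj₂ (to-vertex v) , (begin
      ∣ μ g ∣                          ≤⟨ ℕ.m≤m+n ∣ μ g ∣ _ ⟩
      2 ℕ.* ∣ μ g ∣                    ≡⟨ ℤ.abs-* (+ 2) (μ g) ⟨
      ∣ + 2 * μ g ∣                    ≡⟨ cong ∣_∣ (isolate (μ g) (sign g ⋆ base)) ⟩
      ∣ height v - sign g ⋆ base ∣     ≡⟨ cong (λ i → ∣ i - sign g ⋆ base ∣) e ⟩
      ∣ j - sign g ⋆ base ∣            ≤⟨ ℤ.∣i-j∣≤∣i∣+∣j∣ j (sign g ⋆ base) ⟩
      ∣ j ∣ ℕ.+ ∣ sign g ⋆ base ∣      ≡⟨ cong (∣ j ∣ ℕ.+_) (∣⋆∣ (sign g) base) ⟩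
      ∣ j ∣ ℕ.+ ∣ base ∣               ∎)
      where
      open ℕ.≤-Reasoning
      g = proj₁ (to-vertex v)
      isolate : ∀ a b → + 2 * a ≡ a + a + b - b
      isolate = solve-∀

⋆1-injective : ∀ {e f} → e ⋆ 1ℤ ≡ f ⋆ 1ℤ → e ≡ f
⋆1-injective {Sign.+} {Sign.+} _ = refl
⋆1-injective {Sign.-} {Sign.-} _ = refl

⋆-0 : ∀ e → e ⋆ 0ℤ ≡ 0ℤ
⋆-0 Sign.+ = refl
⋆-0 Sign.- = refl

⋆-* : ∀ e i j → (e ⋆ i) * j ≡ e ⋆ (i * j)
⋆-* Sign.+ i j = refl
⋆-* Sign.- i j = sym (ℤ.neg-distribˡ-* i j)

*-step : ∀ e a y d → a + y * d + e ⋆ d ≡ a + (y + e ⋆ 1ℤ) * d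
*-step Sign.+ = forwards
  where
  forwards : ∀ a y d → a + y * d + d ≡ a + (y + 1ℤ) * d
  forwards = solve-∀
*-step Sign.- = backwards
  where
  backwards : ∀ a y d → a + y * d + - d ≡ a + (y + - 1ℤ) * d
  backwards = solve-∀

sign-cases : ∀ {p} {P : Sign → Set p} → P Sign.+ → P Sign.- → ∀ e → P e
sign-cases p q Sign.+ = p
sign-cases p q Sign.- = q

-- Levellings

module _ {ℓ} (Γ : Digraph ℓ ℓ ℓ) where
  open Digraph Γ using (V; E; _≈_)
  open Isomorphism using (to)

  -- The meeting point of the two halves of the proof: normalised heights give a levelling from
  -- which a subgroup is constructed, and the quotient by a given subgroup gives one from which its
  -- properties are read off.
  record Levelling : Set ℓ where
    field
      level        : V → ℤ
      level-cong   : ∀ {u v} → u ≈ v → level u ≡ level v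
      level-arc    : ∀ {u v} → E u v → ∃[ e ] level v ≡ level u + e ⋆ 1ℤ

    Affine : Automorphism Γ → ℤ → Sign → Set ℓ
    Affine g a e = ∀ v → level (to g v) ≡ a + e ⋆ level v

    field
      level-affine : ∀ g → ∃₂ (Affine g)
      level-finite : ∀ j → Σ[ L ∈ List V ] (∀ {v} → level v ≡ j → Any (v ≈_) L)

    level-to-cong : ∀ g {u v} → level u ≡ level v → level (to g u) ≡ level (to g v)
    level-to-cong g {u} {v} eq = let a , e , g≡ = level-affine g in
      trans (g≡ u) (trans (cong (λ i → a + e ⋆ i) eq) (sym (g≡ v)))

    Climbs : Sign → V → Set ℓ
    Climbs e v = ∃[ w ] E v w × level w ≡ level v + e ⋆ 1ℤ

  Oriented : Levelling → Set ℓ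
  Oriented Λ = ∀ {u v} → E u v → level v ≡ level u + 1ℤ
    where open Levelling Λ

-- From heights to the subgroup N

module Levels {ℓ} (em : ExcludedMiddle ℓ) (Γ : Digraph ℓ ℓ ℓ)
  (connected : Connected Γ) (transitive : VertexTransitive Γ) (arc-transitive : ArcTransitive Γ)
  (R : Ray Γ)
  where
  open Digraph Γ renaming (refl to ≈-refl; sym to ≈-sym; trans to ≈-trans)
  open Finite em vertices
  open Connectivity em Γ
  open Isomorphism using (to; to-arc)

  some-arc : ∃₂ E
  some-arc = arc (Ray.adjacent R 0)
    where
    arc : ∀ {u v} → Adjacent u v → ∃₂ E
    arc (inj₁ a) = _ , _ , a
    arc (inj₂ a) = _ , _ , a

  out-neighbour : ∀ v → ∃[ w ] E v w
  out-neighbour v = let p , q , pq = some-arc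
                        g , gp = transitive p v
                    in to g q , E-resp gp ≈-refl (to-arc g pq)

  in-neighbour : ∀ v → ∃[ u ] E u v
  in-neighbour v = let p , q , pq = some-arc
                       g , gq = transitive q v
                   in to g p , E-resp ≈-refl gq (to-arc g pq)

  infinite : ¬ Covering (λ (_ : V) → ⊤)
  infinite (L , c) = let n , R∉ = eventually-witness (ray-leaves R L) in R∉ (c tt)

  module Normalise (h : V → ℤ) (h-cong : ∀ {u v} → u ≈ v → h u ≡ h v)
    (h-affine : ∀ (g : Automorphism Γ) → ∃₂ λ a e → ∀ v → h (to g v) ≡ a + e ⋆ h v)
    (h-finite : ∀ j → Covering (λ v → h v ≡ j))
    where

    private
      p q : V
      p = proj₁ some-arc
      q = proj₁ (proj₂ some-arc)

      d : ℤ
      d = h q - h p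

      arc-difference : ∀ {u v} → E u v → ∃[ e ] h v ≡ h u + e ⋆ d
      arc-difference {u} {v} uv =
        let g , gp , gq = arc-transitive (proj₂ (proj₂ some-arc)) uv
            a , e , g≡ = h-affine g
        in e , (begin
          h v                          ≡⟨ h-cong gq ⟨
          h (to g q)                   ≡⟨ g≡ q ⟩
          a + e ⋆ h q                  ≡⟨ cong (λ i → a + e ⋆ i) (split (h q) (h p)) ⟩
          a + e ⋆ (h p + d)            ≡⟨ cong (_+_ a) (⋆-+ e (h p) d) ⟩
          a + (e ⋆ h p + e ⋆ d)        ≡⟨ ℤ.+-assoc a (e ⋆ h p) (e ⋆ d) ⟨
          a + e ⋆ h p + e ⋆ d          ≡⟨ cong (_+ e ⋆ d) (g≡ p) ⟨
          h (to g p) + e ⋆ d           ≡⟨ cong (_+ e ⋆ d) (h-cong gp) ⟩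
          h u + e ⋆ d                  ∎)
        where
        open ≡.≡-Reasoning
        split : ∀ i j → i ≡ j + (i - j)
        split = solve-∀

      instance
        -- If `d` were zero, connectedness would make the height constant, and its single finite
        -- fibre would contain the whole ray `R`.
        d-nonZero : ℤ.NonZero d
        d-nonZero = ℤ.≢-nonZero λ d≡0 → infinite (covering-map (λ {v} _ → constant d≡0 v) (h-finite (h p)))
          where
          constant : d ≡ 0ℤ → ∀ v → h v ≡ h p
          constant d≡0 v = connected-induction connected (λ v → h v ≡ h p)
            (λ e eq → trans (sym (h-cong e)) eq) step p v refl
            where
            flat : ∀ {u v} → E u v → h v ≡ h u
            flat {u} uv with arc-difference uv
            ... | e , eq rewrite d≡0 | ⋆-0 e = trans eq (ℤ.+-identityʳ (h u))
            step : ∀ {u v} → Adjacent u v → h u ≡ h p → h v ≡ h p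
            step (inj₁ uv) eq = trans (flat uv) eq
            step (inj₂ vu) eq = trans (sym (flat vu)) eq

      -- The factor `y` becomes the level: the height above `p`, measured in units of the change
      -- along one arc.
      multiple-of-d : ∀ v → ∃[ y ] h v ≡ h p + y * d
      multiple-of-d v = connected-induction connected (λ v → ∃[ y ] h v ≡ h p + y * d)
        (λ e (y , eq) → y , trans (sym (h-cong e)) eq) step p v
        (0ℤ , sym (ℤ.+-identityʳ (h p)))
        where
        subtract : ∀ e {a b} y → b ≡ h p + y * d → b ≡ a + e ⋆ d → a ≡ h p + (y + (Sign.- Sign.* e) ⋆ 1ℤ) * d
        subtract e {a} {b} y b≡ b≡′ = begin
          a                                        ≡⟨ isolate a (e ⋆ d) ⟩
          a + e ⋆ d - e ⋆ d                        ≡⟨ cong (_- e ⋆ d) (trans (sym b≡′) b≡) ⟩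
          h p + y * d - e ⋆ d                      ≡⟨ cong (_+_ (h p + y * d)) (⋆-assoc Sign.- e d) ⟨
          h p + y * d + (Sign.- Sign.* e) ⋆ d      ≡⟨ *-step (Sign.- Sign.* e) (h p) y d ⟩
          h p + (y + (Sign.- Sign.* e) ⋆ 1ℤ) * d   ∎
          where
          open ≡.≡-Reasoning
          isolate : ∀ a x → a ≡ (a + x) - x
          isolate = solve-∀
        step : ∀ {u v} → Adjacent u v → ∃[ y ] h u ≡ h p + y * d → ∃[ y ] h v ≡ h p + y * d
        step {u} (inj₁ uv) (y , eq) = let e , eq′ = arc-difference uv in
          y + e ⋆ 1ℤ , trans eq′ (trans (cong (_+ e ⋆ d) eq) (*-step e (h p) y d))
        step (inj₂ vu) (y , eq) = let e , eq′ = arc-difference vu in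
          y + (Sign.- Sign.* e) ⋆ 1ℤ , subtract e y eq eq′

      level : V → ℤ
      level v = proj₁ (multiple-of-d v)

      level-unique : ∀ {v y} → h v ≡ h p + y * d → level v ≡ y
      level-unique {v} {y} eq = ℤ.*-cancelʳ-≡ (level v) y d
        (GroupProperties.∙-cancelˡ ℤ-group (h p) (level v * d) (y * d) (trans (sym (proj₂ (multiple-of-d v))) eq))

    levelling : Levelling Γ
    levelling = record
      { level = level
      ; level-cong = λ {u} {v} u≈v → level-unique (trans (h-cong u≈v) (proj₂ (multiple-of-d v)))
      ; level-arc = λ {u} {v} uv → let e , eq = arc-difference uv in
          e , level-unique (trans eq (trans (cong (_+ e ⋆ d) (proj₂ (multiple-of-d u))) (*-step e (h p) (level u) d)))
      ; level-affine = λ g → let a , e , g≡ = h-affine g in level (to g p) , e , λ v → level-unique (begin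
          h (to g v)                                        ≡⟨ g≡ v ⟩
          a + e ⋆ h v                                       ≡⟨ cong (λ i → a + e ⋆ i) (proj₂ (multiple-of-d v)) ⟩
          a + e ⋆ (h p + level v * d)                       ≡⟨ cong (_+_ a) (⋆-+ e (h p) (level v * d)) ⟩
          a + (e ⋆ h p + e ⋆ (level v * d))                 ≡⟨ ℤ.+-assoc a (e ⋆ h p) (e ⋆ (level v * d)) ⟨
          a + e ⋆ h p + e ⋆ (level v * d)                   ≡⟨ cong₂ _+_ (trans (sym (g≡ p)) (proj₂ (multiple-of-d (to g p)))) (sym (⋆-* e (level v) d)) ⟩
          h p + level (to g p) * d + (e ⋆ level v) * d      ≡⟨ collect (h p) (level (to g p)) (e ⋆ level v) d ⟩
          h p + (level (to g p) + e ⋆ level v) * d          ∎)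
      ; level-finite = λ j → covering-map (λ {v} eq → trans (proj₂ (multiple-of-d v)) (cong (λ y → h p + y * d) eq))
          (h-finite (h p + j * d)) }
      where
      open ≡.≡-Reasoning
      collect : ∀ a x y d → a + x * d + y * d ≡ a + (x + y) * d
      collect = solve-∀

  negated : Levelling Γ → Levelling Γ
  negated Λ = record
    { level = -_ ∘ level
    ; level-cong = cong -_ ∘ level-cong
    ; level-arc = λ {u} uv → let e , eq = level-arc uv in Sign.- Sign.* e ,
        trans (cong -_ eq) (trans (ℤ.neg-distrib-+ (level u) (e ⋆ 1ℤ)) (cong (_+_ (- level u)) (sym (⋆-assoc Sign.- e 1ℤ))))
    ; level-affine = λ g → let a , e , g≡ = level-affine g in - a , e , λ v →
        trans (cong -_ (g≡ v)) (trans (ℤ.neg-distrib-+ a (e ⋆ level v)) (cong (_+_ (- a)) (commute e (level v))))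
    ; level-finite = λ j → covering-map (λ {v} eq → trans (sym (ℤ.neg-involutive (level v))) (cong -_ eq)) (level-finite (- j)) }
    where
    open Levelling Λ
    commute : ∀ e i → - (e ⋆ i) ≡ e ⋆ (- i)
    commute Sign.+ i = refl
    commute Sign.- i = refl

  module Dichotomy (Λ : Levelling Γ) where
    open Levelling Λ

    climbs-to : ∀ g a f e {v} → Affine g a f → Climbs e v → Climbs (f Sign.* e) (to g v)
    climbs-to g a f e {v} g≡ (w , vw , eq) = to g w , to-arc g vw , (begin
      level (to g w)                       ≡⟨ g≡ w ⟩
      a + f ⋆ level w                      ≡⟨ cong (λ i → a + f ⋆ i) eq ⟩
      a + f ⋆ (level v + e ⋆ 1ℤ)           ≡⟨ cong (_+_ a) (⋆-+ f (level v) (e ⋆ 1ℤ)) ⟩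
      a + (f ⋆ level v + f ⋆ e ⋆ 1ℤ)       ≡⟨ ℤ.+-assoc a (f ⋆ level v) (f ⋆ e ⋆ 1ℤ) ⟨
      a + f ⋆ level v + f ⋆ e ⋆ 1ℤ         ≡⟨ cong₂ _+_ (g≡ v) (⋆-assoc f e 1ℤ) ⟨
      level (to g v) + (f Sign.* e) ⋆ 1ℤ   ∎)
      where open ≡.≡-Reasoning

    climbs-resp : ∀ e {u v} → u ≈ v → Climbs e u → Climbs e v
    climbs-resp e u≈v (w , uw , eq) = w , E-resp u≈v ≈-refl uw , trans eq (cong (_+ _) (level-cong u≈v))

    climbs-some : ∀ v → ∃[ e ] Climbs e v
    climbs-some v = let w , vw = out-neighbour v
                        e , eq = level-arc vw
                    in e , w , vw , eq

    -- The automorphism taking `v` to `u` may reverse the levels. A climb at `u` in direction `e` is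
    -- therefore the image of the climb at `v` in direction `f * e`, where `f` is the slope of the
    -- automorphism.
    everywhere-both : ∀ {v} → (∀ e → Climbs e v) → ∀ e u → Climbs e u
    everywhere-both {v} both e u =
      let g , gv = transitive v u
          a , f , g≡ = level-affine g
      in climbs-resp e gv (subst (λ s → Climbs s (to g v)) (square f e) (climbs-to g a f (f Sign.* e) g≡ (both (f Sign.* e))))
      where
      square : ∀ f e → f Sign.* (f Sign.* e) ≡ e
      square f e = trans (sym (Sign.*-assoc f f e)) (cong (Sign._* e) (Sign.s*s≡+ f))

    -- If no vertex climbs in both directions and adjacent vertices climb in
    -- opposite directions, then only two levels occur.
    module _ (none : ¬ (∃[ v ] ∀ e → Climbs e v)) where

      direction : V → Sign
      direction v = proj₁ (climbs-some v)

      direction-unique : ∀ e {v} → Climbs e v → e ≡ direction v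
      direction-unique e {v} c = agree e (direction v) c (proj₂ (climbs-some v))
        where
        agree : ∀ e f → Climbs e v → Climbs f v → e ≡ f
        agree Sign.+ Sign.+ p q = refl
        agree Sign.- Sign.- p q = refl
        agree Sign.+ Sign.- p q = contradiction (v , sign-cases p q) none
        agree Sign.- Sign.+ p q = contradiction (v , sign-cases q p) none

      direction-cong : ∀ {u v} → u ≈ v → direction u ≡ direction v
      direction-cong u≈v = direction-unique _ (climbs-resp (direction _) u≈v (proj₂ (climbs-some _)))

      level-step : ∀ {u v} → E u v → level v ≡ level u + direction u ⋆ 1ℤ
      level-step {u} {v} uv = let e , eq = level-arc uv in
        trans eq (cong (λ s → level u + s ⋆ 1ℤ) (direction-unique e (v , uv , eq)))

      arc-direction : ∀ {p q u v} → E p q → E u v → ∃[ f ] direction u ≡ f Sign.* direction p × direction v ≡ f Sign.* direction q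
      arc-direction {p} {q} {u} {v} pq uv =
        let g , gp , gq = arc-transitive pq uv
            a , f , g≡ = level-affine g
        in f , sym (trans (direction-unique (f Sign.* direction p) (climbs-to g a f (direction p) g≡ (proj₂ (climbs-some p)))) (direction-cong gp))
             , sym (trans (direction-unique (f Sign.* direction q) (climbs-to g a f (direction q) g≡ (proj₂ (climbs-some q)))) (direction-cong gq))

      alternating-impossible : ¬ (∀ {u v} → E u v → direction u ≢ direction v)
      alternating-impossible alternates = infinite (covering-⊎ (λ {v} _ → two-levels v) (level-finite K) (level-finite (K + 1ℤ)))
        where
        -- In the alternating situation the vertices of direction `+` all lie on level `K` and those
        -- of direction `-` on level `K + 1`; subtracting the correction gives a function that is
        -- constant along arcs.
        correction : Sign → ℤ
        correction Sign.+ = 0ℤ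
        correction Sign.- = 1ℤ
        p : V
        p = Ray.at R 0
        K : ℤ
        K = level p - correction (direction p)
        potential-arc : ∀ {u v} → E u v → level v - correction (direction v) ≡ level u - correction (direction u)
        potential-arc {u} {v} uv = flat (direction u) (direction v) (alternates uv) (level-step uv)
          where
          flat : ∀ e f → e ≢ f → level v ≡ level u + e ⋆ 1ℤ → level v - correction f ≡ level u - correction e
          flat Sign.+ Sign.+ e≢f eq = contradiction refl e≢f
          flat Sign.- Sign.- e≢f eq = contradiction refl e≢f
          flat Sign.+ Sign.- e≢f eq = trans (cong (_- 1ℤ) eq) (cancel (level u))
            where
            cancel : ∀ i → i + 1ℤ - 1ℤ ≡ i - 0ℤ
            cancel = solve-∀
          flat Sign.- Sign.+ e≢f eq = trans (ℤ.+-identityʳ (level v)) eq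
        potential : ∀ v → level v - correction (direction v) ≡ K
        potential v = connected-induction connected (λ v → level v - correction (direction v) ≡ K)
          (λ u≈v eq → trans (cong₂ (λ i s → i - correction s) (level-cong (≈-sym u≈v)) (direction-cong (≈-sym u≈v))) eq)
          (λ { (inj₁ uv) eq → trans (potential-arc uv) eq ; (inj₂ vu) eq → trans (sym (potential-arc vu)) eq })
          p v refl
        two-levels : ∀ v → level v ≡ K ⊎ level v ≡ K + 1ℤ
        two-levels v = side (direction v) (potential v)
          where
          side : ∀ e → level v - correction e ≡ K → level v ≡ K ⊎ level v ≡ K + 1ℤ
          side Sign.+ eq = inj₁ (trans (sym (ℤ.+-identityʳ (level v))) eq)
          side Sign.- eq = inj₂ (trans (restore (level v)) (cong (_+ 1ℤ) eq))
            where
            restore : ∀ i → i ≡ i - 1ℤ + 1ℤ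
            restore = solve-∀

      -- An automorphism multiplies both directions at the ends of an arc by the same sign. So if
      -- one arc joins equal directions, all do; otherwise every arc alternates, which is
      -- impossible.
      uniform : ∀ u v → direction u ≡ direction v
      uniform u v = sym (connected-induction connected (λ v → direction v ≡ direction u)
        (λ e eq → trans (sym (direction-cong e)) eq)
        (λ { (inj₁ uv) eq → trans (sym (arcs-agree uv)) eq ; (inj₂ vu) eq → trans (arcs-agree vu) eq }) u v refl)
        where
        arcs-agree : ∀ {u v} → E u v → direction u ≡ direction v
        arcs-agree uv with em₀ {direction (proj₁ some-arc) ≡ direction (proj₁ (proj₂ some-arc))}
        ... | yes same = let f , eu , ev = arc-direction (proj₂ (proj₂ some-arc)) uv in
              trans eu (trans (cong (f Sign.*_) same) (sym ev))
        ... | no differ = contradiction (λ {u} {v} uv → alternates uv) alternating-impossible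
          where
          alternates : ∀ {u v} → E u v → direction u ≢ direction v
          alternates uv eq = let f , eu , ev = arc-direction (proj₂ (proj₂ some-arc)) uv in
            differ (Sign.*-cancelˡ-≡ f _ _ (trans (sym eu) (trans eq ev)))

      oriented : Σ (Levelling Γ) (Oriented Γ)
      oriented = orient (direction v) λ {u} uv → trans (level-step uv) (cong (λ s → level u + s ⋆ 1ℤ) (uniform u v))
        where
        v : V
        v = Ray.at R 0
        orient : ∀ e → (∀ {u w} → E u w → level w ≡ level u + e ⋆ 1ℤ) → Σ (Levelling Γ) (Oriented Γ)
        orient Sign.+ step = Λ , step
        orient Sign.- step = negated Λ , λ {u} uw → trans (cong -_ (step uw)) (ℤ.neg-distrib-+ (level u) -1ℤ)

  dichotomy : Levelling Γ → (Σ[ Λ ∈ Levelling Γ ] (∀ e v → Levelling.Climbs Λ e v)) ⊎ Σ (Levelling Γ) (Oriented Γ)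
  dichotomy Λ with em {∃[ v ] ∀ e → Levelling.Climbs Λ e v}
  ... | yes (v , both) = inj₁ (Λ , Dichotomy.everywhere-both Λ both)
  ... | no none        = inj₂ (Dichotomy.oriented Λ none)

homomorphism⇒≅ᴳ : ∀ {c ℓ c′ ℓ′} {G : Group c ℓ} {H : Group c′ ℓ′} →
  let module G = Group G
      module H = Group H in
  (f : G.Carrier → H.Carrier) → Congruent G._≈_ H._≈_ f →
  (∀ g h → f (g G.∙ h) H.≈ f g H.∙ f h) → Injective G._≈_ H._≈_ f → (∀ y → ∃[ g ] f g H.≈ y) →
  G ≅ᴳ H
homomorphism⇒≅ᴳ {G = G} {H} f f-cong homo injective onto = f , record
  { isGroupMonomorphism = record
    { isGroupHomomorphism = record
      { isMonoidHomomorphism = record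
        { isMagmaHomomorphism = record { isRelHomomorphism = record { cong = f-cong } ; homo = homo }
        ; ε-homo = ε-homo }
      ; ⁻¹-homo = λ g → inverseˡ-unique (f (g G.⁻¹)) (f g)
          (H.trans (H.sym (homo (g G.⁻¹) g)) (H.trans (f-cong (G.inverseˡ g)) ε-homo)) }
    ; injective = injective }
  ; surjective = λ y → let g , fg = onto y in g , λ h≈g → H.trans (f-cong h≈g) fg }
  where
  module G = Group G
  module H = Group H
  open GroupProperties H
  ε-homo : f G.ε H.≈ H.ε
  ε-homo = identityˡ-unique (f G.ε) (f G.ε) (H.trans (H.sym (homo G.ε G.ε)) (f-cong (G.identityˡ G.ε)))

i+1-1≡i : ∀ i → i + 1ℤ - 1ℤ ≡ i
i+1-1≡i i = trans (ℤ.+-assoc i 1ℤ -1ℤ) (ℤ.+-identityʳ i)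

i-1+1≡i : ∀ i → i - 1ℤ + 1ℤ ≡ i
i-1+1≡i i = trans (ℤ.+-assoc i -1ℤ 1ℤ) (ℤ.+-identityʳ i)

ℤ-induction : ∀ {p} {P : ℤ → Set p} → P 0ℤ → (∀ i → P i → P (i + 1ℤ)) → (∀ i → P i → P (i - 1ℤ)) → ∀ i → P i
ℤ-induction {P = P} z up down (+ zero)         = z
ℤ-induction {P = P} z up down (+ suc n)        = subst P (ℤ.+-comm (+ n) 1ℤ) (up (+ n) (ℤ-induction {P = P} z up down (+ n)))
ℤ-induction {P = P} z up down -[1+ zero ]      = down 0ℤ z
ℤ-induction {P = P} z up down -[1+ suc n ]     =
  subst P (cong (-[1+_] ∘ suc) (ℕ.+-identityʳ n)) (down -[1+ n ] (ℤ-induction {P = P} z up down -[1+ n ]))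

-- The subgroup preserving all levels, and its quotient

module LevelKernel {ℓ} (em : ExcludedMiddle ℓ) (Γ : Digraph ℓ ℓ ℓ) (transitive : VertexTransitive Γ)
  (Λ : Levelling Γ) (at-level : ∀ j → ∃[ v ] Levelling.level Λ v ≡ j)
  where
  open Digraph Γ renaming (refl to ≈-refl; sym to ≈-sym; trans to ≈-trans)
  open Finite em vertices
  open Isomorphism using (to; from; to-cong; from-cong; to-arc; from-arc; strictlyInverseˡ; strictlyInverseʳ)
  open Group (Aut Γ) using (_∙_; _⁻¹)
  open Levelling Λ

  -- Every level is attained, so the two affine maps can be compared at 0 and at 1.
  affine-unique : ∀ g h {a b e f} → (∀ v → level (to g v) ≡ level (to h v)) → Affine g a e → Affine h b f → a ≡ b × e ≡ f
  affine-unique g h {a} {b} {e} {f} g~h g≡ h≡ = a≡b , e≡f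
    where
    agree : ∀ j → a + e ⋆ j ≡ b + f ⋆ j
    agree j with at-level j
    ... | v , refl = trans (sym (g≡ v)) (trans (g~h v) (h≡ v))
    at-0 : ∀ a e → a + e ⋆ 0ℤ ≡ a
    at-0 a e = trans (cong (_+_ a) (⋆-0 e)) (ℤ.+-identityʳ a)
    a≡b : a ≡ b
    a≡b = trans (sym (at-0 a e)) (trans (agree 0ℤ) (at-0 b f))
    e≡f : e ≡ f
    e≡f = ⋆1-injective (GroupProperties.∙-cancelˡ ℤ-group a (e ⋆ 1ℤ) (f ⋆ 1ℤ)
      (trans (agree 1ℤ) (cong (_+ f ⋆ 1ℤ) (sym a≡b))))

  affine-∙ : ∀ g h {a b e f} → Affine g a e → Affine h b f → Affine (g ∙ h) (a + e ⋆ b) (e Sign.* f)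
  affine-∙ g h {a} {b} {e} {f} g≡ h≡ v = begin
    level (to g (to h v))                ≡⟨ g≡ (to h v) ⟩
    a + e ⋆ level (to h v)               ≡⟨ cong (λ i → a + e ⋆ i) (h≡ v) ⟩
    a + e ⋆ (b + f ⋆ level v)            ≡⟨ cong (_+_ a) (⋆-+ e b (f ⋆ level v)) ⟩
    a + (e ⋆ b + e ⋆ f ⋆ level v)        ≡⟨ ℤ.+-assoc a (e ⋆ b) (e ⋆ f ⋆ level v) ⟨
    a + e ⋆ b + e ⋆ f ⋆ level v          ≡⟨ cong (_+_ (a + e ⋆ b)) (⋆-assoc e f (level v)) ⟨
    a + e ⋆ b + (e Sign.* f) ⋆ level v   ∎
    where open ≡.≡-Reasoning

  N : NormalSubgroup (Aut Γ) ℓ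
  N = record
    { Member = λ g → ∀ v → level (to g v) ≡ level v
    ; resp = λ g≈h g∈ v → trans (level-cong (≈-sym (g≈h v))) (g∈ v)
    ; ε-closed = λ _ → refl
    ; ∙-closed = λ {g} {h} g∈ h∈ v → trans (g∈ (to h v)) (h∈ v)
    ; ⁻¹-closed = λ {g} g∈ v → trans (sym (g∈ (from g v))) (level-cong (strictlyInverseˡ g v))
    ; conj-closed = λ g {n} n∈ v → trans (level-to-cong g (n∈ (from g v))) (level-cong (strictlyInverseˡ g v)) }

  open NormalSubgroup N using (Member)

  coset⇒same-levels : ∀ g h → Member (g ⁻¹ ∙ h) → ∀ v → level (to g v) ≡ level (to h v)
  coset⇒same-levels g h m v = trans (level-to-cong g (sym (m v))) (level-cong (strictlyInverseˡ g (to h v)))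

  same-levels⇒coset : ∀ g h → (∀ v → level (to g v) ≡ level (to h v)) → Member (g ⁻¹ ∙ h)
  same-levels⇒coset g h eq v = trans (level-to-cong (g ⁻¹) (sym (eq v))) (level-cong (strictlyInverseʳ g v))

  orbit⇒level : ∀ {u v} → SameOrbit Γ N u v → level u ≡ level v
  orbit⇒level {u} (n , n∈ , nu) = trans (sym (n∈ u)) (level-cong nu)

  module _ (level⇒orbit : ∀ {u v} → level u ≡ level v → SameOrbit Γ N u v) where

    finite-orbits : FiniteOrbits Γ N
    finite-orbits v = _ , enum⇒size (covered⇒enum (λ _ → em) (λ e (n , n∈ , nv) → n , n∈ , ≈-trans nv e)
      (proj₁ (level-finite (level v))) λ o → proj₂ (level-finite (level v)) (sym (orbit⇒level o)))

    orbits↔ℤ : Inverse (orbits Γ N) (≡.setoid ℤ)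
    orbits↔ℤ = record
      { to = level ; from = λ j → proj₁ (at-level j) ; to-cong = orbit⇒level
      ; from-cong = λ { refl → Setoid.refl (orbits Γ N) }
      ; inverse = (λ {j} o → trans (orbit⇒level o) (proj₂ (at-level j)))
                , λ { {v} refl → level⇒orbit (proj₂ (at-level (level v))) } }

  affine-of : Automorphism Γ → ℤ × Sign
  affine-of g = proj₁ (level-affine g) , proj₁ (proj₂ (level-affine g))

  is-affine : ∀ g → Affine g (proj₁ (affine-of g)) (proj₂ (affine-of g))
  is-affine g = proj₂ (proj₂ (level-affine g))

  affine-of-unique : ∀ g {a e} → Affine g a e → affine-of g ≡ (a , e)
  affine-of-unique g {a} {e} g≡ =
    let p , q = affine-unique g g {proj₁ (affine-of g)} {a} {proj₂ (affine-of g)} {e} (λ _ → refl) (is-affine g) g≡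
    in cong₂ _,_ p q

  affine-of-cong : ∀ g h → Member (g ⁻¹ ∙ h) → affine-of g ≡ affine-of h
  affine-of-cong g h m = affine-of-unique g λ v → trans (coset⇒same-levels g h m v) (is-affine h v)

  affine-of-∙ : ∀ g h → affine-of (g ∙ h) ≡ Group._∙_ D∞ (affine-of g) (affine-of h)
  affine-of-∙ g h = let a , e = affine-of g
                        b , f = affine-of h
                    in affine-of-unique (g ∙ h) (affine-∙ g h {a} {b} {e} {f} (is-affine g) (is-affine h))

  affine-of-injective : ∀ g h → affine-of g ≡ affine-of h → Member (g ⁻¹ ∙ h)
  affine-of-injective g h eq = same-levels⇒coset g h λ v →
    trans (is-affine g v) (trans (cong (λ (a , e) → a + e ⋆ level v) eq) (sym (is-affine h v)))

  module _ (climbs : ∀ e v → Climbs e v) (arc-transitive : ArcTransitive Γ) where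

    -- An arc at `u` climbing in direction `e` is carried to an arc at `v` climbing in direction
    -- `f`; its two ends determine the affine map. Equal directions give a translation and opposite
    -- ones a reflection, so all of `D∞` is obtained.
    realise : ∀ u v e f → ∃[ g ] to g u ≈ v × Affine g (level v - (e Sign.* f) ⋆ level u) (e Sign.* f)
    realise u v e f =
      let u′ , uu′ , eu = climbs e u
          v′ , vv′ , ev = climbs f v
          g , gu , gu′ = arc-transitive uu′ vv′
          a , s , g≡ = level-affine g
          at-u = trans (sym (g≡ u)) (level-cong gu)
          at-u′ = trans (sym (g≡ u′)) (level-cong gu′)
          s≡ = slope a s at-u (trans (cong (λ i → a + s ⋆ i) (sym eu)) (trans at-u′ ev))
      in g , gu , subst₂ (Affine g) (trans (intercept a (s ⋆ level u)) (cong₂ (λ i t → i - t ⋆ level u) at-u s≡)) s≡ g≡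
      where
      intercept : ∀ a x → a ≡ a + x - x
      intercept = solve-∀
      slope : ∀ a s → a + s ⋆ level u ≡ level v → a + s ⋆ (level u + e ⋆ 1ℤ) ≡ level v + f ⋆ 1ℤ → s ≡ e Sign.* f
      slope a s p q = solve-sign s e f (⋆1-injective (trans (⋆-assoc s e 1ℤ) (GroupProperties.∙-cancelˡ ℤ-group (level v) _ _ (begin
        level v + s ⋆ e ⋆ 1ℤ                  ≡⟨ cong (_+ s ⋆ e ⋆ 1ℤ) p ⟨
        a + s ⋆ level u + s ⋆ e ⋆ 1ℤ          ≡⟨ ℤ.+-assoc a _ _ ⟩
        a + (s ⋆ level u + s ⋆ e ⋆ 1ℤ)        ≡⟨ cong (_+_ a) (⋆-+ s (level u) (e ⋆ 1ℤ)) ⟨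
        a + s ⋆ (level u + e ⋆ 1ℤ)            ≡⟨ q ⟩
        level v + f ⋆ 1ℤ                      ∎))))
        where
        open ≡.≡-Reasoning
        solve-sign : ∀ s e f → s Sign.* e ≡ f → s ≡ e Sign.* f
        solve-sign Sign.+ Sign.+ _ p = p
        solve-sign Sign.+ Sign.- _ refl = refl
        solve-sign Sign.- Sign.+ _ p = p
        solve-sign Sign.- Sign.- _ refl = refl

    level⇒orbit : ∀ {u v} → level u ≡ level v → SameOrbit Γ N u v
    level⇒orbit {u} {v} eq = let g , gu , g≡ = realise u v Sign.+ Sign.+ in
      g , (λ w → trans (g≡ w) (trans (cong (λ i → i - level u + level w) (sym eq)) (cancel (level u) (level w)))) , gu
      where
      cancel : ∀ i j → i - i + j ≡ j
      cancel = solve-∀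

    caseI : CaseI Γ N
    caseI = record
      { inverse-maps = orbits↔ℤ level⇒orbit
      ; to-arc = λ (v , w , Av , Bw , vw) → adjacent-levels
          (orbit⇒level Av) (orbit⇒level Bw) (level-arc vw)
      ; from-arc = λ
        { (inj₁ refl) → lift-arc Sign.+ _ refl
        ; (inj₂ refl) → lift-arc Sign.- _ (sym (i+1-1≡i _)) } }
      , homomorphism⇒≅ᴳ {G = Aut Γ /ᴳ N} {D∞} affine-of
          (λ {g} {h} → affine-of-cong g h) affine-of-∙ (λ {g} {h} → affine-of-injective g h)
          onto
      where
      adjacent-levels : ∀ {a b v w} → a ≡ level v → b ≡ level w → ∃[ e ] level w ≡ level v + e ⋆ 1ℤ → b ≡ a + 1ℤ ⊎ a ≡ b + 1ℤ
      adjacent-levels refl refl (Sign.+ , eq) = inj₁ eq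
      adjacent-levels {a} refl refl (Sign.- , eq) = inj₂ (trans (sym (i-1+1≡i a)) (cong (_+ 1ℤ) (sym eq)))
      lift-arc : ∀ e {i} j → j ≡ i + e ⋆ 1ℤ → Digraph.E (quotient Γ N) (proj₁ (at-level i)) (proj₁ (at-level j))
      lift-arc e {i} j j≡ = let v , v≡ = at-level i
                                w , vw , eq = climbs e v
                            in v , w , Setoid.refl (orbits Γ N)
                             , level⇒orbit (trans (proj₂ (at-level j)) (trans j≡ (trans (cong (_+ e ⋆ 1ℤ) (sym v≡)) (sym eq)))) , vw
      onto : ∀ y → ∃[ g ] affine-of g ≡ y
      onto (a , e) =
        let u , u≡ = at-level 0ℤ
            v , v≡ = at-level a
            g , gu , g≡ = realise u v Sign.+ e
        in g , trans (affine-of-unique g g≡) (cong (_, e) (trans (cong₂ (λ i j → i - e ⋆ j) v≡ u≡)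
             (trans (cong (λ i → a - i) (⋆-0 e)) (ℤ.+-identityʳ a))))

  module _ (oriented : Oriented Γ Λ) (out-neighbour : ∀ v → ∃[ w ] E v w) where

    -- An arc and its image both ascend, so no automorphism reverses the levels.
    slope-positive : ∀ g → proj₂ (affine-of g) ≡ Sign.+
    slope-positive g = let v , v≡ = at-level 0ℤ
                           w , vw = out-neighbour v
                           a , e = affine-of g
                       in sym (⋆1-injective (GroupProperties.∙-cancelˡ ℤ-group (level (to g v)) 1ℤ (e ⋆ 1ℤ) (begin
        level (to g v) + 1ℤ                ≡⟨ oriented (to-arc g vw) ⟨
        level (to g w)                     ≡⟨ is-affine g w ⟩
        a + e ⋆ level w                    ≡⟨ cong (λ i → a + e ⋆ i) (oriented vw) ⟩
        a + e ⋆ (level v + 1ℤ)             ≡⟨ cong (_+_ a) (⋆-+ e (level v) 1ℤ) ⟩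
        a + (e ⋆ level v + e ⋆ 1ℤ)         ≡⟨ ℤ.+-assoc a (e ⋆ level v) (e ⋆ 1ℤ) ⟨
        a + e ⋆ level v + e ⋆ 1ℤ           ≡⟨ cong (_+ e ⋆ 1ℤ) (is-affine g v) ⟨
        level (to g v) + e ⋆ 1ℤ            ∎)))
      where open ≡.≡-Reasoning

    translation : ∀ g v → level (to g v) ≡ proj₁ (affine-of g) + level v
    translation g v = trans (is-affine g v) (cong (λ e → proj₁ (affine-of g) + e ⋆ level v) (slope-positive g))

    realise-translation : ∀ u v → ∃[ g ] to g u ≈ v × proj₁ (affine-of g) ≡ level v - level u
    realise-translation u v = let g , gu = transitive u v in
      g , gu , trans (isolate _ (level u)) (cong (_- level u) (trans (sym (translation g u)) (level-cong gu)))
      where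
      isolate : ∀ a i → a ≡ a + i - i
      isolate = solve-∀

    level⇒orbit′ : ∀ {u v} → level u ≡ level v → SameOrbit Γ N u v
    level⇒orbit′ {u} {v} eq = let g , gu , a≡ = realise-translation u v in
      g , (λ w → trans (translation g w) (trans (cong (_+ level w) (trans a≡ (cong (_- level u) (sym eq)))) (cancel (level u) (level w)))) , gu
      where
      cancel : ∀ i j → i - i + j ≡ j
      cancel = solve-∀

    caseII : CaseII Γ N
    caseII = record
      { inverse-maps = orbits↔ℤ level⇒orbit′
      ; to-arc = λ (v , w , Av , Bw , vw) →
          trans (orbit⇒level Bw) (trans (oriented vw) (cong (_+ 1ℤ) (sym (orbit⇒level Av))))
      ; from-arc = λ {i} {j} j≡ →
          let v , v≡ = at-level i
              w , vw = out-neighbour v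
          in v , w , Setoid.refl (orbits Γ N)
           , level⇒orbit′ (trans (proj₂ (at-level j)) (trans j≡ (trans (cong (_+ 1ℤ) (sym v≡)) (sym (oriented vw))))) , vw }
      , homomorphism⇒≅ᴳ {G = Aut Γ /ᴳ N} {ℤ-group} (proj₁ ∘ affine-of)
          (λ {g} {h} m → cong proj₁ (affine-of-cong g h m))
          (λ g h → trans (cong proj₁ (affine-of-∙ g h))
            (cong (λ e → proj₁ (affine-of g) + e ⋆ proj₁ (affine-of h)) (slope-positive g)))
          (λ {g} {h} eq → affine-of-injective g h (cong₂ _,_ eq (trans (slope-positive g) (sym (slope-positive h)))))
          (λ a → let u , u≡ = at-level 0ℤ
                     v , v≡ = at-level a
                     g , _ , a≡ = realise-translation u v
                 in g , trans a≡ (trans (cong₂ _-_ v≡ u≡) (ℤ.+-identityʳ a)))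

module Existence {ℓ} (em : ExcludedMiddle ℓ) (Γ : Digraph ℓ ℓ ℓ)
  (connected : Connected Γ) (transitive : VertexTransitive Γ) (arc-transitive : ArcTransitive Γ)
  (R S : Ray Γ) (R≁S : ¬ Equivalent Γ R S) (ends : ∀ T → Equivalent Γ T R ⊎ Equivalent Γ T S)
  where
  open Levels em Γ connected transitive arc-transitive R

  abstract
    levelling-exists : Levelling Γ
    levelling-exists =
      let k , t₀ , m₀ , k-least = EndAction.minimal-exists em Γ R S R≁S ends
      in levelling k t₀ m₀ k-least
      where
      levelling : ∀ k t₀ → Separations.Minimal em Γ R S k t₀ →
        (∀ {t} (σ : Connectivity.Separation em Γ R S t) → k ℕ.≤ Connectivity.Separation.order {em = em} σ) → Levelling Γ
      levelling k t₀ m₀ k-least = Normalise.levelling height height-cong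
        (λ g → μ g + μ g , EndAction.sign em Γ R S R≁S ends g , height-to g) height-finite
        where open Heights em Γ connected transitive arc-transitive R S R≁S ends k t₀ m₀ k-least

  all-levels : (Λ : Levelling Γ) → let open Levelling Λ in
    (∀ v → ∃[ w ] level w ≡ level v + 1ℤ) → (∀ v → ∃[ w ] level w ≡ level v - 1ℤ) → ∀ j → ∃[ v ] level v ≡ j
  all-levels Λ up down j =
    let w , eq = ℤ-induction {P = λ i → ∃[ w ] level w ≡ level v + i}
          (v , sym (ℤ.+-identityʳ (level v)))
          (λ i (w , eq) → let x , eq′ = up w in x , trans eq′ (trans (cong (_+ 1ℤ) eq) (ℤ.+-assoc (level v) i 1ℤ)))
          (λ i (w , eq) → let x , eq′ = down w in x , trans eq′ (trans (cong (_- 1ℤ) eq) (ℤ.+-assoc (level v) i -1ℤ)))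
          (j - level v)
    in w , trans eq (cancel (level v) j)
    where
    open Levelling Λ
    v = Ray.at R 0
    cancel : ∀ i j → i + (j - i) ≡ j
    cancel = solve-∀

  climbs⇒all-levels : (Λ : Levelling Γ) → let open Levelling Λ in (∀ e v → Climbs e v) → ∀ j → ∃[ v ] level v ≡ j
  climbs⇒all-levels Λ climbs = all-levels Λ
    (λ v → let w , _ , eq = climbs Sign.+ v in w , eq) (λ v → let w , _ , eq = climbs Sign.- v in w , eq)

  oriented⇒all-levels : (Λ : Levelling Γ) → let open Levelling Λ in Oriented Γ Λ → ∀ j → ∃[ v ] level v ≡ j
  oriented⇒all-levels Λ oriented = all-levels Λ
    (λ v → let w , vw = out-neighbour v in w , oriented vw)
    (λ v → let u , uv = in-neighbour v in u , sym (trans (cong (_- 1ℤ) (oriented uv)) (i+1-1≡i (level u))))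
    where open Levelling Λ

  abstract
    subgroup-exists : Σ[ N ∈ NormalSubgroup (Aut Γ) ℓ ] FiniteOrbits Γ N × (CaseI Γ N ⊎ CaseII Γ N)
    subgroup-exists = by-case (dichotomy levelling-exists)
      where
      by-case : (Σ[ Λ ∈ Levelling Γ ] (∀ e v → Levelling.Climbs Λ e v)) ⊎ Σ (Levelling Γ) (Oriented Γ) →
                Σ[ N ∈ NormalSubgroup (Aut Γ) ℓ ] FiniteOrbits Γ N × (CaseI Γ N ⊎ CaseII Γ N)
      by-case (inj₁ (Λ , climbs)) = N , finite-orbits (level⇒orbit climbs arc-transitive) , inj₁ (caseI climbs arc-transitive)
        where
        open LevelKernel em Γ transitive Λ (climbs⇒all-levels Λ climbs)
      by-case (inj₂ (Λ , oriented)) = N , finite-orbits (level⇒orbit′ oriented out-neighbour) , inj₂ (caseII oriented out-neighbour)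
        where
        open LevelKernel em Γ transitive Λ (oriented⇒all-levels Λ oriented)

-- Levels obtained from the quotient by a given subgroup

i≢i+1 : ∀ {i} → i ≢ i + 1ℤ
i≢i+1 {i} eq with GroupProperties.∙-cancelˡ ℤ-group i 0ℤ 1ℤ (trans (ℤ.+-identityʳ i) eq)
... | ()

i≢i+2 : ∀ {i} → i ≢ i + 1ℤ + 1ℤ
i≢i+2 {i} eq with GroupProperties.∙-cancelˡ ℤ-group i 0ℤ (+ 2)
  (trans (ℤ.+-identityʳ i) (trans eq (ℤ.+-assoc i 1ℤ 1ℤ)))
... | ()

-- Turning round at some point would give two arguments at distance 2 the same value, against
-- injectivity. Applied to the map that an automorphism induces on the orbits, this shows that
-- automorphisms act affinely on the levels.
unit-speed : (f : ℤ → ℤ) → (∀ i → ∃[ e ] f (i + 1ℤ) ≡ f i + e ⋆ 1ℤ) → Injective _≡_ _≡_ f →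
             ∃[ e ] (∀ i → f i ≡ f 0ℤ + e ⋆ i)
unit-speed f step injective = e , ℤ-induction {P = λ i → f i ≡ f 0ℤ + e ⋆ i}
  (sym (trans (cong (_+_ (f 0ℤ)) (⋆-0 e)) (ℤ.+-identityʳ (f 0ℤ))))
  (λ i eq → trans (uniform i) (trans (cong (_+ e ⋆ 1ℤ) eq) (collect i 1ℤ)))
  (λ i eq → begin
    f (i - 1ℤ)                       ≡⟨ isolate (f (i - 1ℤ)) (e ⋆ 1ℤ) ⟩
    f (i - 1ℤ) + e ⋆ 1ℤ - e ⋆ 1ℤ     ≡⟨ cong (_- e ⋆ 1ℤ) (uniform (i - 1ℤ)) ⟨
    f (i - 1ℤ + 1ℤ) - e ⋆ 1ℤ         ≡⟨ cong (λ j → f j - e ⋆ 1ℤ) (i-1+1≡i i) ⟩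
    f i - e ⋆ 1ℤ                     ≡⟨ cong₂ _+_ eq (minus-⋆1 e) ⟩
    f 0ℤ + e ⋆ i + e ⋆ -1ℤ           ≡⟨ collect i -1ℤ ⟩
    f 0ℤ + e ⋆ (i - 1ℤ)              ∎)
  where
  open ≡.≡-Reasoning
  minus-⋆1 : ∀ s → - (s ⋆ 1ℤ) ≡ s ⋆ -1ℤ
  minus-⋆1 Sign.+ = refl
  minus-⋆1 Sign.- = refl
  direction : ℤ → Sign
  direction i = proj₁ (step i)
  e : Sign
  e = direction 0ℤ
  isolate : ∀ i j → i ≡ i + j - j
  isolate = solve-∀
  collect : ∀ i j → f 0ℤ + e ⋆ i + e ⋆ j ≡ f 0ℤ + e ⋆ (i + j)
  collect i j = trans (ℤ.+-assoc (f 0ℤ) (e ⋆ i) (e ⋆ j)) (cong (_+_ (f 0ℤ)) (sym (⋆-+ e i j)))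
  no-turn : ∀ i → direction (i + 1ℤ) ≡ direction i
  no-turn i = agree (direction (i + 1ℤ)) (direction i)
    (trans (proj₂ (step (i + 1ℤ))) (cong (_+ direction (i + 1ℤ) ⋆ 1ℤ) (proj₂ (step i))))
    where
    returns : f (i + 1ℤ + 1ℤ) ≡ f i → ∀ {s t : Sign} → s ≡ t
    returns eq = contradiction (sym (injective eq)) i≢i+2
    agree : ∀ s t → f (i + 1ℤ + 1ℤ) ≡ f i + t ⋆ 1ℤ + s ⋆ 1ℤ → s ≡ t
    agree Sign.+ Sign.+ _ = refl
    agree Sign.- Sign.- _ = refl
    agree Sign.+ Sign.- eq = returns (trans eq (i-1+1≡i (f i)))
    agree Sign.- Sign.+ eq = returns (trans eq (i+1-1≡i (f i)))
  same-direction : ∀ i → direction i ≡ e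
  same-direction = ℤ-induction refl (λ i eq → trans (no-turn i) eq)
    (λ i eq → trans (sym (no-turn (i - 1ℤ))) (trans (cong direction (i-1+1≡i i)) eq))
  uniform : ∀ i → f (i + 1ℤ) ≡ f i + e ⋆ 1ℤ
  uniform i = trans (proj₂ (step i)) (cong (λ s → f i + s ⋆ 1ℤ) (same-direction i))

-- In the quotient of case (i) the orbits over 0 and 1 are joined by arcs both ways, and the
-- directed line has no such pair.
caseI⇒¬caseII : ∀ {ℓ} {Γ : Digraph ℓ ℓ ℓ} {N : NormalSubgroup (Aut Γ) ℓ} → CaseI Γ N → ¬ CaseII Γ N
caseI⇒¬caseII {Γ = Γ} {N} (α , _) (β , _) = impossible
  (β.to-arc (α.from-arc {0ℤ} {1ℤ} (inj₁ refl))) (β.to-arc (α.from-arc {1ℤ} {0ℤ} (inj₂ refl)))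
  where
  module α = Isomorphism α
  module β = Isomorphism β
  impossible : ∀ {i j} → j ≡ i + 1ℤ → i ≡ j + 1ℤ → ⊥
  impossible refl = i≢i+2

module OrbitLevels {ℓ} (em : ExcludedMiddle ℓ) (Γ : Digraph ℓ ℓ ℓ)
  (N : NormalSubgroup (Aut Γ) ℓ) (finite-orbits : FiniteOrbits Γ N)
  where
  open Digraph Γ renaming (refl to ≈-refl; sym to ≈-sym; trans to ≈-trans)
  open Finite em vertices
  open Isomorphism using (to; from; to-cong; from-cong; to-arc; from-arc; strictlyInverseˡ; strictlyInverseʳ)
  open Group (Aut Γ) using (_∙_; _⁻¹) renaming (ε to 𝟙)
  open NormalSubgroup N using (ε-closed; conj-closed)

  orbit-to : ∀ g {u v} → SameOrbit Γ N u v → SameOrbit Γ N (to g u) (to g v)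
  orbit-to g {u} (n , n∈ , nu) = g ∙ n ∙ g ⁻¹ , conj-closed g n∈ , to-cong g (≈-trans (to-cong n (strictlyInverseʳ g u)) nu)

  module Index (f : Inverse (orbits Γ N) (≡.setoid ℤ)) where
    open Inverse f renaming (to to index; from to representative; to-cong to index-cong; from-cong to representative-cong;
      strictlyInverseˡ to index-representative; strictlyInverseʳ to representative-index)

    index-resp : ∀ {u v} → u ≈ v → index u ≡ index v
    index-resp u≈v = index-cong (𝟙 , ε-closed , u≈v)

    index⇒orbit : ∀ {u v} → index u ≡ index v → SameOrbit Γ N u v
    index⇒orbit {u} {v} eq = O.trans (O.sym (representative-index u)) (O.trans (representative-cong eq) (representative-index v))
      where module O = Setoid (orbits Γ N)

    index-finite : ∀ j → Covering (λ v → index v ≡ j)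
    index-finite j = Enum.list A , λ eq → Enum.complete A (index⇒orbit (trans (index-representative j) (sym eq)))
      where
      A : Enum (SameOrbit Γ N (representative j))
      A = proj₁ (size⇒enum (proj₂ (finite-orbits (representative j))))

    induced-map : Automorphism Γ → ℤ → ℤ
    induced-map g i = index (to g (representative i))

    induced-map-index : ∀ g v → index (to g v) ≡ induced-map g (index v)
    induced-map-index g v = sym (index-cong (orbit-to g (representative-index v)))

    induced-map-injective : ∀ g → Injective _≡_ _≡_ (induced-map g)
    induced-map-injective g {i} {j} eq = trans (sym (back i)) (trans (index-cong (orbit-to (g ⁻¹) (index⇒orbit eq))) (back j))
      where
      back : ∀ i → index (from g (to g (representative i))) ≡ i
      back i = trans (index-resp (strictlyInverseʳ g (representative i))) (index-representative i)

  arc-step : ∀ {i j} → Digraph.E ℤ-digraph i j → ∃[ e ] j ≡ i + e ⋆ 1ℤ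
  arc-step (inj₁ eq) = Sign.+ , eq
  arc-step {j = j} (inj₂ refl) = Sign.- , sym (i+1-1≡i j)

  module _ (α : Isomorphism (quotient Γ N) ℤ-digraph) where
    private
      module α = Isomorphism α
    open Index α.inverse-maps

    ℤ-levelling : Levelling Γ
    ℤ-levelling = record
      { level = α.to
      ; level-cong = index-resp
      ; level-arc = λ a → arc-step (α.to-arc (Homomorphism.to-arc (quotientMap Γ N) a))
      ; level-affine = λ g → let e , eq = unit-speed (induced-map g) (speed g) (induced-map-injective g) in
          induced-map g 0ℤ , e , λ v → trans (induced-map-index g v) (eq (α.to v))
      ; level-finite = index-finite }
      where
      speed : ∀ g i → ∃[ e ] induced-map g (i + 1ℤ) ≡ induced-map g i + e ⋆ 1ℤ
      speed g i =
        let v , w , iv , iw , vw = α.from-arc {i} {i + 1ℤ} (inj₁ refl)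
            e , eq = arc-step (α.to-arc (Homomorphism.to-arc (quotientMap Γ N) (to-arc g vw)))
        in e , trans (α.to-cong (orbit-to g iw)) (trans eq (cong (_+ e ⋆ 1ℤ) (sym (α.to-cong (orbit-to g iv)))))

    ℤ-step : ∀ e i → Digraph.E ℤ-digraph i (i + e ⋆ 1ℤ) × Digraph.E ℤ-digraph (i + e ⋆ 1ℤ) i
    ℤ-step Sign.+ i = inj₁ refl , inj₂ refl
    ℤ-step Sign.- i = inj₂ eq , inj₁ eq
      where
      eq : i ≡ i - 1ℤ + 1ℤ
      eq = sym (i-1+1≡i i)

    private
      carry : ∀ {u v} → α.to u ≡ α.to v → Σ[ n ∈ Automorphism Γ ] to n u ≈ v × (∀ w → α.to (to n w) ≡ α.to w)
      carry eq = let n , n∈ , nu = index⇒orbit eq in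
        n , nu , λ w → sym (α.to-cong (n , n∈ , ≈-refl))

    -- An arc of the quotient comes from an arc of `Γ` between the two orbits, and an element of `N`
    -- moves the initial vertex of that arc to `v` without changing any level.
    ℤ-climbs : ∀ e v → Levelling.Climbs ℤ-levelling e v
    ℤ-climbs e v =
      let u , w , iu , jw , uw = α.from-arc (proj₁ (ℤ-step e (α.to v)))
          n , nu , same = carry {u} {v} (trans (sym (α.to-cong iu)) (α.strictlyInverseˡ _))
      in to n w , E-resp nu ≈-refl (to-arc n uw)
       , trans (same w) (trans (sym (α.to-cong jw)) (α.strictlyInverseˡ _))

    ℤ-climbs-in : ∀ e v → ∃[ u ] E u v × α.to u ≡ α.to v + e ⋆ 1ℤ
    ℤ-climbs-in e v =
      let w , u , jw , iu , wu = α.from-arc (proj₂ (ℤ-step e (α.to v)))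
          n , nu , same = carry {u} {v} (trans (sym (α.to-cong iu)) (α.strictlyInverseˡ _))
      in to n w , E-resp ≈-refl nu (to-arc n wu)
       , trans (same w) (trans (sym (α.to-cong jw)) (α.strictlyInverseˡ _))

  module _ (β : Isomorphism (quotient Γ N) ℤ⃗-digraph) where
    private
      module β = Isomorphism β
    open Index β.inverse-maps

    ℤ⃗-levelling : Levelling Γ
    ℤ⃗-levelling = record
      { level = β.to
      ; level-cong = index-resp
      ; level-arc = λ a → Sign.+ , β.to-arc (Homomorphism.to-arc (quotientMap Γ N) a)
      ; level-affine = λ g → let e , eq = unit-speed (induced-map g) (λ i → Sign.+ , speed g i) (induced-map-injective g) in
          induced-map g 0ℤ , e , λ v → trans (induced-map-index g v) (eq (β.to v))
      ; level-finite = index-finite }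
      where
      speed : ∀ g i → induced-map g (i + 1ℤ) ≡ induced-map g i + 1ℤ
      speed g i =
        let v , w , iv , iw , vw = β.from-arc {i} {i + 1ℤ} refl
        in trans (β.to-cong (orbit-to g iw)) (trans (β.to-arc (Homomorphism.to-arc (quotientMap Γ N) (to-arc g vw)))
             (cong (_+ 1ℤ) (sym (β.to-cong (orbit-to g iv)))))

    ℤ⃗-oriented : Oriented Γ ℤ⃗-levelling
    ℤ⃗-oriented a = β.to-arc (Homomorphism.to-arc (quotientMap Γ N) a)

-- Layers of a given N

module Layers {ℓ} (em : ExcludedMiddle ℓ) (Γ : Digraph ℓ ℓ ℓ)
  (connected : Connected Γ) (transitive : VertexTransitive Γ) (arc-transitive : ArcTransitive Γ)
  (Λ : Levelling Γ)
  where
  open Digraph Γ renaming (refl to ≈-refl; sym to ≈-sym; trans to ≈-trans)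
  open Finite em vertices
  open Connectivity em Γ using (connected-induction)
  open Isomorphism using (to; from; to-cong; from-cong; to-arc; from-arc; inverseˡ; inverseʳ; strictlyInverseˡ; strictlyInverseʳ)
  open Group (Aut Γ) using (_∙_; _⁻¹) renaming (ε to 𝟙)
  open Levelling Λ
  open import Data.List.Membership.Setoid vertices renaming (_∈_ to _∈ˡ_) using ()

  Γ[_] : ℤ → Pred V 0ℓ
  Γ[ i ] v = level v ≡ i

  strip : ℤ → Pred V 0ℓ
  strip i = Γ[ i ] ∪ Γ[ i + 1ℤ ]

  i≢i+⋆1 : ∀ e {i} → i ≢ i + e ⋆ 1ℤ
  i≢i+⋆1 Sign.+ eq = i≢i+1 eq
  i≢i+⋆1 Sign.- {i} eq = i≢i+1 {i - 1ℤ} (trans (sym eq) (sym (i-1+1≡i i)))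

  arc-levels-differ : ∀ {u v} → E u v → level u ≢ level v
  arc-levels-differ uv eq = let e , eq′ = level-arc uv in i≢i+⋆1 e (trans eq eq′)

  strip-levels : ∀ {i x x′ v} → E x x′ → x ∈ strip i → x′ ∈ strip i → v ∈ strip i →
                 level v ≡ level x ⊎ level v ≡ level x′
  strip-levels a (inj₁ p) (inj₁ q) _        = contradiction (trans p (sym q)) (arc-levels-differ a)
  strip-levels a (inj₂ p) (inj₂ q) _        = contradiction (trans p (sym q)) (arc-levels-differ a)
  strip-levels a (inj₁ p) _        (inj₁ r) = inj₁ (trans r (sym p))
  strip-levels a (inj₂ p) _        (inj₂ r) = inj₁ (trans r (sym p))
  strip-levels a _        (inj₁ q) (inj₁ r) = inj₂ (trans r (sym q))
  strip-levels a _        (inj₂ q) (inj₂ r) = inj₂ (trans r (sym q))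

  strip-resp : ∀ {i u v} → level u ≡ level v → v ∈ strip i → u ∈ strip i
  strip-resp eq (inj₁ p) = inj₁ (trans eq p)
  strip-resp eq (inj₂ p) = inj₂ (trans eq p)

  -- The ends of an arc inside the strip occupy both of its levels, so each vertex of the strip
  -- shares its level with one of them. Automorphisms preserve equality of levels, hence the images
  -- of the two ends decide where the strip goes.
  strip-to : ∀ (g : Automorphism Γ) {i x x′ y y′ v} → E x x′ → x ∈ strip i → x′ ∈ strip i → y ∈ strip i → y′ ∈ strip i →
             to g x ≈ y → to g x′ ≈ y′ → v ∈ strip i → to g v ∈ strip i
  strip-to g a x∈ x′∈ y∈ y′∈ gx gx′ v∈ with strip-levels a x∈ x′∈ v∈
  ... | inj₁ eq = strip-resp (trans (level-to-cong g eq) (level-cong gx)) y∈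
  ... | inj₂ eq = strip-resp (trans (level-to-cong g eq) (level-cong gx′)) y′∈

  restrict : ∀ i (g : Automorphism Γ) → (∀ {v} → v ∈ strip i → to g v ∈ strip i) → (∀ {v} → v ∈ strip i → from g v ∈ strip i) →
             Automorphism (induced Γ (strip i))
  restrict i g to∈ from∈ = record
    { inverse-maps = record
      { to = λ (v , v∈) → to g v , to∈ v∈ ; from = λ (v , v∈) → from g v , from∈ v∈
      ; to-cong = to-cong g ; from-cong = from-cong g
      ; inverse = (λ e → inverseˡ g e) , (λ e → inverseʳ g e) }
    ; to-arc = to-arc g ; from-arc = from-arc g }

  strip-arc-automorphism : ∀ {i x x′ y y′} → E x x′ → E y y′ → x ∈ strip i → x′ ∈ strip i → y ∈ strip i → y′ ∈ strip i →
    Σ[ g ∈ Automorphism (induced Γ (strip i)) ] (∀ x∈ → proj₁ (to g (x , x∈)) ≈ y) × (∀ x′∈ → proj₁ (to g (x′ , x′∈)) ≈ y′)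
  strip-arc-automorphism {i} xx′ yy′ x∈ x′∈ y∈ y′∈ =
    let g , gx , gx′ = arc-transitive xx′ yy′
    in restrict i g (strip-to g xx′ x∈ x′∈ y∈ y′∈ gx gx′)
         (strip-to (g ⁻¹) yy′ y∈ y′∈ x∈ x′∈ (inverseʳ g (≈-sym gx)) (inverseʳ g (≈-sym gx′)))
     , (λ _ → gx) , (λ _ → gx′)

  strip-arc-transitive : ∀ i → ArcTransitive (induced Γ (strip i))
  strip-arc-transitive i {_ , x∈} {_ , x′∈} {_ , y∈} {_ , y′∈} xx′ yy′ =
    let g , gx , gx′ = strip-arc-automorphism xx′ yy′ x∈ x′∈ y∈ y′∈ in g , gx x∈ , gx′ x′∈

  -- Every vertex is the initial vertex of an arc inside the strip, ascending from the lower layer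
  -- and descending from the upper one, so moving arcs also moves any vertex to any other.
  strip-vertex-transitive : ∀ i → (∀ e v → Climbs e v) → VertexTransitive (induced Γ (strip i))
  strip-vertex-transitive i climbs (x , x∈) (y , y∈) =
    let x′ , xx′ , x′∈ = partner x∈
        y′ , yy′ , y′∈ = partner y∈
        g , gx , _ = strip-arc-automorphism xx′ yy′ x∈ x′∈ y∈ y′∈
    in g , gx x∈
    where
    partner : ∀ {v} → v ∈ strip i → ∃[ w ] E v w × w ∈ strip i
    partner {v} (inj₁ p) = let w , vw , eq = climbs Sign.+ v in w , vw , inj₂ (trans eq (cong (_+ 1ℤ) p))
    partner {v} (inj₂ p) = let w , vw , eq = climbs Sign.- v in w , vw ,
      inj₁ (trans eq (trans (cong (_- 1ℤ) p) (i+1-1≡i i)))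

  strip-bipartite : ∀ i → Bipartite (induced Γ (strip i))
  strip-bipartite i = side , (λ e → cong (λ j → does (j ℤ.≟ i)) (level-cong e)) , λ
    { {_ , u∈} {_ , v∈} (inj₁ uv) → separated (arc-levels-differ uv) u∈ v∈
    ; {_ , u∈} {_ , v∈} (inj₂ vu) → separated (arc-levels-differ vu ∘ sym) u∈ v∈ }
    where
    side : Digraph.V (induced Γ (strip i)) → Bool
    side (v , _) = does (level v ℤ.≟ i)
    separated : ∀ {u v} → level u ≢ level v → u ∈ strip i → v ∈ strip i → does (level u ℤ.≟ i) ≢ does (level v ℤ.≟ i)
    separated {u} {v} differ u∈ v∈ eq with level u ℤ.≟ i | level v ℤ.≟ i
    separated differ u∈ v∈ eq | yes p | yes q = differ (trans p (sym q))
    separated differ (inj₁ p) v∈ eq | no ¬p | _ = ¬p p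
    separated differ (inj₂ p) (inj₁ q) eq | no _ | no ¬q = ¬q q
    separated differ (inj₂ p) (inj₂ q) eq | no _ | no _ = differ (trans p (sym q))
    separated differ u∈ v∈ () | yes _ | no _
    separated differ u∈ v∈ () | no _  | yes _

  moved-size : ∀ {p q} {P : Pred V p} {Q : Pred V q} (g : Automorphism Γ) → (∀ {x} → P x → Q (to g x)) → (∀ {x} → Q x → P (from g x)) →
               SameSize (subset vertices P) (subset vertices Q)
  moved-size g P⇒Q Q⇒P = record
    { to = λ (x , p) → to g x , P⇒Q p ; from = λ (x , q) → from g x , Q⇒P q
    ; to-cong = to-cong g ; from-cong = from-cong g
    ; inverse = (λ e → inverseˡ g e) , (λ e → inverseʳ g e) }

  same-size : ∀ {p q} {P : Pred V p} {Q : Pred V q} → (∀ {x} → P x → Q x) → (∀ {x} → Q x → P x) →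
              SameSize (subset vertices P) (subset vertices Q)
  same-size = moved-size 𝟙

  size-transfer : ∀ {p q} {P : Pred V p} {Q : Pred V q} {n} → SameSize (subset vertices P) (subset vertices Q) →
                  HasSize (subset vertices P) n → HasSize (subset vertices Q) n
  size-transfer f s = Composition.inverse s f

  size-⊎ : ∀ {p q r} {P : Pred V p} {Q : Pred V q} {T : Pred V r} {m n} →
           HasSize (subset vertices P) m → HasSize (subset vertices Q) n → Respects P → Respects Q →
           (∀ {x} → T x → P x ⊎ Q x) → (∀ {x} → P x → T x) → (∀ {x} → Q x → T x) → (∀ {x} → P x → ¬ Q x) →
           HasSize (subset vertices T) (m ℕ.+ n)
  size-⊎ {P = P} {Q} {T} {m} {n} P-size Q-size P-resp Q-resp T⇒ P⇒T Q⇒T disjoint = subst (HasSize (subset vertices T))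
    (trans (List.length-++ (Enum.list A)) (cong₂ ℕ._+_ (proj₂ (size⇒enum P-size)) (proj₂ (size⇒enum Q-size))))
    (enum⇒size record
      { list = Enum.list A ++ Enum.list B
      ; unique = Unique.++⁺ vertices (Enum.unique A) (Enum.unique B)
          λ (a , b) → disjoint (All-∈ P-resp (Enum.sound A) a) (All-∈ Q-resp (Enum.sound B) b)
      ; sound = All.++⁺ (All.map P⇒T (Enum.sound A)) (All.map Q⇒T (Enum.sound B))
      ; complete = λ t → place (T⇒ t) })
    where
    open import Data.List.Membership.Setoid.Properties using (∈-++⁺ˡ; ∈-++⁺ʳ)
    A : Enum P
    A = proj₁ (size⇒enum P-size)
    B : Enum Q
    B = proj₁ (size⇒enum Q-size)
    place : ∀ {x} → P x ⊎ Q x → x ∈ˡ (Enum.list A ++ Enum.list B)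
    place (inj₁ p) = ∈-++⁺ˡ vertices (Enum.complete A p)
    place (inj₂ q) = ∈-++⁺ʳ vertices (Enum.list A) (Enum.complete B q)

  level-resp : ∀ {j} → Respects (λ v → level v ≡ j)
  level-resp e eq = trans (level-cong (≈-sym e)) eq

  OutAt InAt : V → ℤ → Pred V ℓ
  OutAt v j x = E v x × level x ≡ j
  InAt  v j x = E x v × level x ≡ j

  out-resp : ∀ {v j} → Respects (OutAt v j)
  out-resp e (a , eq) = E-resp ≈-refl e a , level-resp e eq

  in-resp : ∀ {v j} → Respects (InAt v j)
  in-resp e (a , eq) = E-resp e ≈-refl a , level-resp e eq

  level-enum : ∀ j → Enum (λ v → level v ≡ j)
  level-enum j = covered⇒enum (λ v → level v ℤ.≟ j) level-resp (proj₁ (level-finite j)) (proj₂ (level-finite j))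

  moved-out : ∀ (g : Automorphism Γ) {v v′ w w′} → to g v ≈ v′ → to g w ≈ w′ →
              SameSize (subset vertices (OutAt v (level w))) (subset vertices (OutAt v′ (level w′)))
  moved-out g gv gw = moved-size g
    (λ (a , eq) → E-resp gv ≈-refl (to-arc g a) , trans (level-to-cong g eq) (level-cong gw))
    (λ (a , eq) → E-resp (inverseʳ g (≈-sym gv)) ≈-refl (from-arc g a)
                , trans (level-to-cong (g ⁻¹) eq) (level-cong (inverseʳ g (≈-sym gw))))

  moved-in : ∀ (g : Automorphism Γ) {v v′ w w′} → to g v ≈ v′ → to g w ≈ w′ →
             SameSize (subset vertices (InAt v (level w))) (subset vertices (InAt v′ (level w′)))
  moved-in g gv gw = moved-size g
    (λ (a , eq) → E-resp ≈-refl gv (to-arc g a) , trans (level-to-cong g eq) (level-cong gw))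
    (λ (a , eq) → E-resp ≈-refl (inverseʳ g (≈-sym gv)) (from-arc g a)
                , trans (level-to-cong (g ⁻¹) eq) (level-cong (inverseʳ g (≈-sym gw))))

  module Counting where
    indicator : (V → Set ℓ) → V → ℤ
    indicator P x with em {P x}
    ... | yes _ = 1ℤ
    ... | no _  = 0ℤ

    indicator-true : ∀ (P : V → Set ℓ) {x} → P x → indicator P x ≡ 1ℤ
    indicator-true P {x} p with em {P x}
    ... | yes _ = refl
    ... | no ¬p = contradiction p ¬p

    indicator-support : ∀ (P : V → Set ℓ) {x} → indicator P x ≢ 0ℤ → P x
    indicator-support P {x} nz with em {P x}
    ... | yes p = p
    ... | no _  = contradiction refl nz

    indicator-cong : ∀ (P : V → Set ℓ) → Respects P → ∀ {x y} → x ≈ y → indicator P x ≡ indicator P y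
    indicator-cong P r {x} {y} x≈y with em {P x} | em {P y}
    ... | yes _ | yes _ = refl
    ... | no _  | no _  = refl
    ... | yes p | no ¬p = contradiction (r x≈y p) ¬p
    ... | no ¬p | yes p = contradiction (r (≈-sym x≈y) p) ¬p

    count : ∀ (P : V → Set ℓ) → Respects P → ∀ {j n} → HasSize (subset vertices (λ x → P x × level x ≡ j)) n →
            sum (indicator P) (Enum.list (level-enum j)) ≡ + n
    count P r {j} {n} s = begin
      sum (indicator P) (Enum.list (level-enum j))
        ≡⟨ sum-support (indicator P) (indicator-cong P r) (Enum.unique (level-enum j)) (Enum.unique A)
             (λ x∈ nz → Enum.complete A (indicator-support P nz , All-∈ level-resp (Enum.sound (level-enum j)) x∈))
             (λ x∈ _ → Enum.complete (level-enum j) (proj₂ (in-A x∈))) ⟩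
      sum (indicator P) (Enum.list A)                 ≡⟨ sum-cong (Enum.list A) (λ x∈ → indicator-true P (proj₁ (in-A x∈))) ⟩
      sum (λ _ → 1ℤ) (Enum.list A)                    ≡⟨ sum-1 (Enum.list A) ⟩
      + length (Enum.list A)                          ≡⟨ cong +_ (proj₂ (size⇒enum s)) ⟩
      + n                                             ∎
      where
      open ≡.≡-Reasoning
      A : Enum (λ x → P x × level x ≡ j)
      A = proj₁ (size⇒enum s)
      in-A : ∀ {x} → x ∈ˡ Enum.list A → P x × level x ≡ j
      in-A = All-∈ (λ e (p , eq) → r e p , level-resp e eq) (Enum.sound A)

    sum-const : ∀ {f c} L → (∀ {x} → x ∈ˡ L → f x ≡ + c) → sum f L ≡ + (length L ℕ.* c)
    sum-const []      eq = refl
    sum-const (x ∷ L) eq = cong₂ _+_ (eq (here ≈-refl)) (sum-const L (eq ∘ there))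

    double-count : ∀ {i j a b} → (∀ v → level v ≡ i → HasSize (subset vertices (OutAt v j)) a) →
                   (∀ w → level w ≡ j → HasSize (subset vertices (InAt w i)) b) →
                   length (Enum.list (level-enum i)) ℕ.* a ≡ length (Enum.list (level-enum j)) ℕ.* b
    double-count {i} {j} {a} {b} outs ins = ℤ.+-injective (begin
      + (length I ℕ.* a)                              ≡⟨ sum-const I (λ v∈ → count (E _) (E-resp ≈-refl) (outs _ (at-i v∈))) ⟨
      sum (λ v → sum (λ w → indicator (E v) w) J) I   ≡⟨ sum-swap (λ v w → indicator (E v) w) I J ⟩
      sum (λ w → sum (λ v → indicator (E v) w) I) J   ≡⟨ sum-cong J (λ {w} _ → sum-cong I λ {v} _ → same v w) ⟩
      sum (λ w → sum (indicator (λ v → E v w)) I) J   ≡⟨ sum-const J (λ w∈ → count (λ v → E v _) (λ e → E-resp e ≈-refl) (ins _ (at-j w∈))) ⟩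
      + (length J ℕ.* b)                              ∎)
      where
      open ≡.≡-Reasoning
      I J : List V
      I = Enum.list (level-enum i)
      J = Enum.list (level-enum j)
      at-i : ∀ {v} → v ∈ˡ I → level v ≡ i
      at-i = All-∈ level-resp (Enum.sound (level-enum i))
      at-j : ∀ {v} → v ∈ˡ J → level v ≡ j
      at-j = All-∈ level-resp (Enum.sound (level-enum j))
      same : ∀ v w → indicator (E v) w ≡ indicator (λ v → E v w) v
      same v w with em {E v w}
      ... | yes _ = refl
      ... | no _  = refl

  module Balance (climbs : ∀ v → Climbs Sign.+ v) (climbs-in : ∀ v → ∃[ u ] E u v × level u ≡ level v - 1ℤ) (p : V) where
    open Counting

    private
      q : V
      q = proj₁ (climbs p)

      pq : E p q
      pq = proj₁ (proj₂ (climbs p))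

      q≡ : level q ≡ level p + 1ℤ
      q≡ = proj₂ (proj₂ (climbs p))

      finite-at : (P : V → Set ℓ) → Respects P → ∀ j → ∃[ n ] HasSize (subset vertices (λ x → P x × level x ≡ j)) n
      finite-at P r j = _ , enum⇒size (covered⇒enum (λ _ → em) (λ e (p , eq) → r e p , level-resp e eq)
        (proj₁ (level-finite j)) (proj₂ (level-finite j) ∘ proj₂))

    d : ℕ
    d = proj₁ (finite-at (E p) (E-resp ≈-refl) (level q))

    -- Arc-transitivity compares any arc with `pq`, whether it ascends or descends, so the one
    -- number `d` serves for both directions.
    out-size : ∀ {v w} → E v w → HasSize (subset vertices (OutAt v (level w))) d
    out-size vw = let g , gp , gq = arc-transitive pq vw in
      size-transfer (moved-out g gp gq) (proj₂ (finite-at (E p) (E-resp ≈-refl) (level q)))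

    private
      d′ : ℕ
      d′ = proj₁ (finite-at (λ x → E x q) (λ e → E-resp e ≈-refl) (level p))

      in-size′ : ∀ {v w} → E v w → HasSize (subset vertices (InAt w (level v))) d′
      in-size′ vw = let g , gp , gq = arc-transitive pq vw in
        size-transfer (moved-in g gq gp) (proj₂ (finite-at (λ x → E x q) (λ e → E-resp e ≈-refl) (level p)))

      layer-lengths : length (Enum.list (level-enum (level p))) ≡ length (Enum.list (level-enum (level q)))
      layer-lengths = size-unique {S = subset vertices (λ v → level v ≡ level q)}
        (size-transfer moved (enum⇒size (level-enum (level p)))) (enum⇒size (level-enum (level q)))
        where
        moved : SameSize (subset vertices (λ v → level v ≡ level p)) (subset vertices (λ v → level v ≡ level q))
        moved = let g , gp = transitive p q in moved-size g
          (λ eq → trans (level-to-cong g eq) (level-cong gp))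
          (λ eq → trans (level-to-cong (g ⁻¹) eq) (level-cong (inverseʳ g (≈-sym gp))))

      -- Counting the arcs from the layer of `p` to that of `q` by initial and by terminal vertices
      -- gives the two products. The layers have equal size, an automorphism taking one onto the
      -- other, and `p` shows that this size can be cancelled.
      balanced : d ≡ d′
      balanced = cancel (trans (double-count outs ins) (cong (ℕ._* d′) (sym layer-lengths))) (Enum.complete (level-enum (level p)) refl)
        where
        outs : ∀ v → level v ≡ level p → HasSize (subset vertices (OutAt v (level q))) d
        outs v v≡ = let w , vw , w≡ = climbs v in
          subst (λ j → HasSize (subset vertices (OutAt v j)) d) (trans w≡ (trans (cong (_+ 1ℤ) v≡) (sym q≡))) (out-size vw)
        ins : ∀ w → level w ≡ level q → HasSize (subset vertices (InAt w (level p))) d′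
        ins w w≡ = let u , uw , u≡ = climbs-in w in
          subst (λ j → HasSize (subset vertices (InAt w j)) d′)
            (trans u≡ (trans (cong (_- 1ℤ) (trans w≡ q≡)) (i+1-1≡i (level p)))) (in-size′ uw)
        cancel : ∀ {L x a b} → length L ℕ.* a ≡ length L ℕ.* b → x ∈ˡ L → a ≡ b
        cancel {y ∷ L} eq _ = ℕ.*-cancelˡ-≡ _ _ (suc (length L)) eq

    in-size : ∀ {v w} → E v w → HasSize (subset vertices (InAt w (level v))) d
    in-size vw = subst (HasSize _) (sym balanced) (in-size′ vw)

  slope : Automorphism Γ → Sign
  slope g = proj₁ (proj₂ (level-affine g))

  same-slope⇒same-levels : ∀ (g h : Automorphism Γ) {v} → to g v ≈ v → to h v ≈ v → slope g ≡ slope h → ∀ u → level (to g u) ≡ level (to h u)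
  same-slope⇒same-levels g h {v} gv hv same u = compare (level-affine g) (level-affine h) same
    where
    compare : (G : ∃₂ (Affine g)) (H : ∃₂ (Affine h)) → proj₁ (proj₂ G) ≡ proj₁ (proj₂ H) → level (to g u) ≡ level (to h u)
    compare (a , e , g≡) (b , .e , h≡) refl = trans (g≡ u) (trans (cong (_+ e ⋆ level u) a≡b) (sym (h≡ u)))
      where
      a≡b : a ≡ b
      a≡b = GroupProperties.∙-cancelʳ ℤ-group (e ⋆ level v) a b
        (trans (sym (g≡ v)) (trans (level-cong (≈-trans gv (≈-sym hv))) (h≡ v)))

  two-alike : (s : Fin 3 → Sign) → ∃₂ λ i j → i ≢ j × s i ≡ s j
  two-alike s with s fzero in p | s (fsuc fzero) in q | s (fsuc (fsuc fzero)) in r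
  ... | Sign.+ | Sign.+ | _      = fzero , fsuc fzero , (λ ()) , trans p (sym q)
  ... | Sign.- | Sign.- | _      = fzero , fsuc fzero , (λ ()) , trans p (sym q)
  ... | Sign.+ | Sign.- | Sign.+ = fzero , fsuc (fsuc fzero) , (λ ()) , trans p (sym r)
  ... | Sign.- | Sign.+ | Sign.- = fzero , fsuc (fsuc fzero) , (λ ()) , trans p (sym r)
  ... | Sign.+ | Sign.- | Sign.- = fsuc fzero , fsuc (fsuc fzero) , (λ ()) , trans q (sym r)
  ... | Sign.- | Sign.+ | Sign.+ = fsuc fzero , fsuc (fsuc fzero) , (λ ()) , trans q (sym r)

  PreservesLevels : Automorphism Γ → Set ℓ
  PreservesLevels g = ∀ u → level (to g u) ≡ level u

  -- Among three elements of the stabilizer two have the same slope. Composing one with the inverse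
  -- of the other gives an element that fixes `v` and preserves all levels, and the hypothesis
  -- spreads its fixed points over the whole digraph.
  small-stabilizer : (∀ v g → to g v ≈ v → PreservesLevels g → ∀ {x} → Adjacent v x → to g x ≈ x) →
                     ∀ v → ¬ MoreThanTwoElements (Group.setoid (Stabilizer Γ v))
  small-stabilizer fixes v three = i≢j (Injection.injective three alike)
    where
    element : Fin 3 → Automorphism Γ
    element i = proj₁ (Injection.to three i)
    fixed : ∀ i → to (element i) v ≈ v
    fixed i = proj₂ (Injection.to three i)
    pair = two-alike (slope ∘ element)
    i = proj₁ pair
    j = proj₁ (proj₂ pair)
    i≢j = proj₁ (proj₂ (proj₂ pair))
    same-slope = proj₂ (proj₂ (proj₂ pair))
    g h k : Automorphism Γ
    g = element i
    h = element j
    k = g ⁻¹ ∙ h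
    k-preserves : PreservesLevels k
    k-preserves u = trans (level-to-cong (g ⁻¹) (sym (same-slope⇒same-levels g h (fixed i) (fixed j) same-slope u)))
      (level-cong (strictlyInverseʳ g u))
    k-trivial : ∀ u → to k u ≈ u
    k-trivial u = connected-induction connected (λ x → to k x ≈ x)
      (λ e p → ≈-trans (to-cong k (≈-sym e)) (≈-trans p e)) (λ a p → fixes _ k p k-preserves a) v u
      (inverseʳ g (≈-trans (fixed j) (≈-sym (fixed i))))
    alike : ∀ u → to g u ≈ to h u
    alike u = ≈-trans (to-cong g (≈-sym (k-trivial u))) (strictlyInverseˡ g (to h u))

-- The case of the directed line

module Oneway {ℓ} (em : ExcludedMiddle ℓ) (Γ : Digraph ℓ ℓ ℓ)
  (connected : Connected Γ) (transitive : VertexTransitive Γ) (arc-transitive : ArcTransitive Γ) (R : Ray Γ)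
  (Λ : Levelling Γ) (oriented : Oriented Γ Λ) (at-level : ∀ j → ∃[ v ] Levelling.level Λ v ≡ j)
  where
  open Digraph Γ renaming (refl to ≈-refl; sym to ≈-sym; trans to ≈-trans)
  open Levels em Γ connected transitive arc-transitive R using (out-neighbour; in-neighbour)
  open Layers em Γ connected transitive arc-transitive Λ
  open Levelling Λ

  oriented-down : ∀ {u v} → E u v → level u ≡ level v - 1ℤ
  oriented-down {u} uv = sym (trans (cong (_- 1ℤ) (oriented uv)) (i+1-1≡i (level u)))

  in-below×out-above : ∀ i v → v ∈ Γ[ i ] → In v ⊆ Γ[ i - 1ℤ ] × Out v ⊆ Γ[ i + 1ℤ ]
  in-below×out-above i v refl = oriented-down , oriented

  upwards : ∀ v → Climbs Sign.+ v
  upwards v = let w , vw = out-neighbour v in w , vw , oriented vw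

  from-below : ∀ v → ∃[ u ] E u v × level u ≡ level v - 1ℤ
  from-below v = let u , uv = in-neighbour v in u , uv , oriented-down uv

  open Balance upwards from-below (Ray.at R 0) using (d; out-size; in-size)

  valencies : ∃[ d ] InValency Γ d × OutValency Γ d
  valencies = d
    , (λ v → let u , uv = in-neighbour v in size-transfer
        (same-size proj₁ (λ xv → xv , trans (oriented-down xv) (sym (oriented-down uv)))) (in-size uv))
    , (λ v → let w , vw = out-neighbour v in size-transfer
        (same-size proj₁ (λ vx → vx , trans (oriented vx) (sym (oriented vw)))) (out-size vw))

  property-Z : HasPropertyZ Γ
  property-Z = record { to = level ; to-cong = level-cong ; to-arc = oriented }
    , λ j → let v , v≡ = at-level j in v , λ z≈v → trans (level-cong z≈v) v≡

  strip-arcs : ∀ i u v → u ∈ strip i → v ∈ strip i → E u v → u ∈ Γ[ i ] × v ∈ Γ[ i + 1ℤ ]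
  strip-arcs i u v (inj₁ u≡) v∈ uv = u≡ , trans (oriented uv) (cong (_+ 1ℤ) u≡)
  strip-arcs i u v (inj₂ u≡) (inj₁ v≡) uv = contradiction
    (trans (sym v≡) (trans (oriented uv) (cong (_+ 1ℤ) u≡))) i≢i+2
  strip-arcs i u v (inj₂ u≡) (inj₂ v≡) uv = contradiction (trans u≡ (sym v≡)) (arc-levels-differ uv)

  not-both-sides : ¬ (∀ i v → v ∈ Γ[ i ] →
      In  v ≬ Γ[ i - 1ℤ ] × In  v ≬ Γ[ i + 1ℤ ]
    × Out v ≬ Γ[ i - 1ℤ ] × Out v ≬ Γ[ i + 1ℤ ])
  not-both-sides sides = let v = Ray.at R 0
                             _ , (u , uv , u≡) , _ = sides (level v) v refl
                         in i≢i+2 (trans u≡ (cong (_+ 1ℤ) (oriented uv)))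

-- The case of neighbours on both sides

module Bothways {ℓ} (em : ExcludedMiddle ℓ) (Γ : Digraph ℓ ℓ ℓ)
  (connected : Connected Γ) (transitive : VertexTransitive Γ) (arc-transitive : ArcTransitive Γ) (R : Ray Γ)
  (Λ : Levelling Γ) (climbs : ∀ e v → Levelling.Climbs Λ e v)
  (climbs-in : ∀ e v → ∃[ u ] Digraph.E Γ u v × Levelling.level Λ u ≡ Levelling.level Λ v + e ⋆ 1ℤ)
  where
  open Digraph Γ renaming (refl to ≈-refl; sym to ≈-sym; trans to ≈-trans)
  open Layers em Γ connected transitive arc-transitive Λ
  open Levelling Λ
  open Isomorphism using (to; from; to-cong; to-arc; strictlyInverseˡ)

  neighbours-on-both-sides : ∀ i v → v ∈ Γ[ i ] →
      In  v ≬ Γ[ i - 1ℤ ] × In  v ≬ Γ[ i + 1ℤ ]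
    × Out v ≬ Γ[ i - 1ℤ ] × Out v ≬ Γ[ i + 1ℤ ]
  neighbours-on-both-sides i v refl = climbs-in Sign.- v , climbs-in Sign.+ v , climbs Sign.- v , climbs Sign.+ v

  -- An automorphism taking a descending arc at `v` to an ascending one fixes `v` and exchanges the
  -- two adjacent layers.
  symmetric-valencies : ∀ i v → v ∈ Γ[ i ] →
      SameSize (subset vertices (Out v ∩ Γ[ i - 1ℤ ])) (subset vertices (Out v ∩ Γ[ i + 1ℤ ]))
    × SameSize (subset vertices (In  v ∩ Γ[ i - 1ℤ ])) (subset vertices (In  v ∩ Γ[ i + 1ℤ ]))
  symmetric-valencies i v refl =
    let w , vw , w≡ = climbs Sign.- v
        x , vx , x≡ = climbs Sign.+ v
        g , gv , gw = arc-transitive vw vx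
    in subst₂ (λ j k → SameSize (subset vertices (OutAt v j)) (subset vertices (OutAt v k))) w≡ x≡ (moved-out g gv gw)
     , subst₂ (λ j k → SameSize (subset vertices (InAt v j)) (subset vertices (InAt v k))) w≡ x≡ (moved-in g gv gw)

  open Balance (climbs Sign.+) (climbs-in Sign.-) (Ray.at R 0) using (d; out-size; in-size)

  out-size-at : ∀ e v → HasSize (subset vertices (OutAt v (level v + e ⋆ 1ℤ))) d
  out-size-at e v = let w , vw , w≡ = climbs e v in
    subst (λ j → HasSize (subset vertices (OutAt v j)) d) w≡ (out-size vw)

  in-size-at : ∀ e v → HasSize (subset vertices (InAt v (level v + e ⋆ 1ℤ))) d
  in-size-at e v = let u , uv , u≡ = climbs-in e v in
    subst (λ j → HasSize (subset vertices (InAt v j)) d) u≡ (in-size uv)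

  either-side : ∀ {u v} → ∃[ e ] level v ≡ level u + e ⋆ 1ℤ → level v ≡ level u + 1ℤ ⊎ level v ≡ level u - 1ℤ
  either-side (Sign.+ , eq) = inj₁ eq
  either-side (Sign.- , eq) = inj₂ eq

  level-arc-in : ∀ {u v} → E u v → ∃[ e ] level u ≡ level v + e ⋆ 1ℤ
  level-arc-in {u} uv = let e , eq = level-arc uv in Sign.- Sign.* e , (sym (trans
    (cong₂ _+_ eq (⋆-assoc Sign.- e 1ℤ)) (trans (ℤ.+-assoc (level u) (e ⋆ 1ℤ) (- (e ⋆ 1ℤ)))
      (trans (cong (_+_ (level u)) (ℤ.+-inverseʳ (e ⋆ 1ℤ))) (ℤ.+-identityʳ (level u))))))

  opposite-sides : ∀ {i} j → i ≡ j + 1ℤ → i ≢ j - 1ℤ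
  opposite-sides j p q with GroupProperties.∙-cancelˡ ℤ-group j 1ℤ -1ℤ (trans (sym p) q)
  ... | ()

  -- There are `d` arcs going up and `d` going down; the evenness needed for (d) comes from here.
  out-valency : OutValency Γ (d ℕ.+ d)
  out-valency v = size-⊎ (out-size-at Sign.+ v) (out-size-at Sign.- v) out-resp out-resp
    (λ {x} vx → [ (λ eq → inj₁ (vx , eq)) , (λ eq → inj₂ (vx , eq)) ]′ (either-side {v} {x} (level-arc vx)))
    proj₁ proj₁ (λ (_ , p) (_ , q) → opposite-sides (level v) p q)

  in-valency : InValency Γ (d ℕ.+ d)
  in-valency v = size-⊎ (in-size-at Sign.+ v) (in-size-at Sign.- v) in-resp in-resp
    (λ {x} xv → [ (λ eq → inj₁ (xv , eq)) , (λ eq → inj₂ (xv , eq)) ]′ (either-side {v} {x} (level-arc-in xv)))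
    proj₁ proj₁ (λ (_ , p) (_ , q) → opposite-sides (level v) p q)

  even-valency : ∀ {n} → OutValency Γ n → n ≡ d ℕ.+ d
  even-valency outs = size-unique {S = subset vertices (Out (Ray.at R 0))} (outs _) (out-valency _)

  2∣valency : ∀ {n} → OutValency Γ n → 2 ∣ n
  2∣valency outs = divides d (trans (even-valency outs)
    (trans (cong (d ℕ.+_) (sym (ℕ.+-identityʳ d))) (ℕ.*-comm 2 d)))

  -- From `v` upwards to `w`, one 2-arc returns to the level of `v` and another goes on to the level
  -- above `w`. Automorphisms preserve equality of levels, so the first cannot be taken to the
  -- second.
  not-2-arc-transitive : ¬ TwoArcTransitive Γ
  not-2-arc-transitive 2-arc-transitive =
    let v = Ray.at R 0
        w , vw , w≡ = climbs Sign.+ v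
        x , wx , x≡ = climbs Sign.+ w
        y , wy , y≡ = climbs Sign.- w
        g , gv , _ , gy = 2-arc-transitive vw wy vw wx
        y-level = trans y≡ (trans (cong (_- 1ℤ) w≡) (i+1-1≡i (level v)))
        x-level = trans (sym (level-cong gy)) (trans (level-to-cong g y-level) (level-cong gv))
    in opposite-sides (level w) (trans (sym x-level) x≡) (trans (sym y-level) y≡)

  -- The level-preserving elements form a normal subgroup of the stabilizer. It is not transitive on
  -- the in-neighbours or on the out-neighbours of `v`, both of which meet two levels, so by
  -- quasi-primitivity it fixes all of them.
  quasi-primitive⇒small : LocallyQuasiPrimitive Γ → ∀ v → ¬ MoreThanTwoElements (Group.setoid (Stabilizer Γ v))
  quasi-primitive⇒small quasi-primitive = small-stabilizer λ
    { v g gv g-pres (inj₁ vx) → out-fixed v g gv g-pres vx (proj₂ (proj₂ (quasi-primitive v)) (kernel v))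
    ; v g gv g-pres (inj₂ xv) → in-fixed v g gv g-pres xv (proj₂ (proj₁ (quasi-primitive v)) (kernel v)) }
    where
    kernel : ∀ v → NormalSubgroup (Stabilizer Γ v) ℓ
    kernel v = record
      { Member = λ (g , _) → PreservesLevels g
      ; resp = λ g≈h g∈ u → trans (level-cong (≈-sym (g≈h u))) (g∈ u)
      ; ε-closed = λ _ → refl
      ; ∙-closed = λ {(g , _)} {(h , _)} g∈ h∈ u → trans (g∈ (to h u)) (h∈ u)
      ; ⁻¹-closed = λ {(g , _)} g∈ u → trans (sym (g∈ (from g u))) (level-cong (strictlyInverseˡ g u))
      ; conj-closed = λ (g , _) {(n , _)} n∈ u →
          trans (level-to-cong g (n∈ (from g u))) (level-cong (strictlyInverseˡ g u)) }

    out-fixed : ∀ v g → to g v ≈ v → PreservesLevels g → ∀ {x} → E v x → _ → to g x ≈ x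
    out-fixed v g gv g-pres vx (inj₁ trivially) = trivially (g , gv) (_ , vx) g-pres
    out-fixed v g gv g-pres vx (inj₂ transitively) =
      let y , vy , y≡ = climbs Sign.+ v
          z , vz , z≡ = climbs Sign.- v
          (n , _) , n∈ , ny = transitively (y , vy) (z , vz)
      in contradiction (trans (sym (level-cong ny)) (trans (n∈ y) y≡)) (λ p → opposite-sides (level v) p z≡)

    in-fixed : ∀ v g → to g v ≈ v → PreservesLevels g → ∀ {x} → E x v → _ → to g x ≈ x
    in-fixed v g gv g-pres xv (inj₁ trivially) = trivially (g , gv) (_ , xv) g-pres
    in-fixed v g gv g-pres xv (inj₂ transitively) =
      let y , yv , y≡ = climbs-in Sign.+ v
          z , zv , z≡ = climbs-in Sign.- v
          (n , _) , n∈ , ny = transitively (y , yv) (z , zv)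
      in contradiction (trans (sym (level-cong ny)) (trans (n∈ y) y≡)) (λ p → opposite-sides (level v) p z≡)

  not-oriented : ¬ (∀ i v → v ∈ Γ[ i ] → In v ⊆ Γ[ i - 1ℤ ] × Out v ⊆ Γ[ i + 1ℤ ])
  not-oriented sides = let v = Ray.at R 0
                           u , uv , u≡ = climbs-in Sign.+ v
                       in opposite-sides (level v) u≡ (proj₁ (sides (level v) v refl) uv)

  -- Here `d` is 1, so `v` has a single out-neighbour and a single in-neighbour on each adjacent
  -- level, and these are fixed by every element of the stabilizer that preserves the levels.
  valency-2⇒small : OutValency Γ 2 → ∀ v → ¬ MoreThanTwoElements (Group.setoid (Stabilizer Γ v))
  valency-2⇒small outs = small-stabilizer fixes
    where
    halve : ∀ {n} → 2 ≡ n ℕ.+ n → n ≡ 1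
    halve {suc zero} _ = refl
    halve {suc (suc n)} eq with trans (cong ℕ.pred (cong ℕ.pred eq)) (ℕ.+-suc n (suc n))
    ... | ()

    singleton : ∀ {p} {P : Pred V p} {x y} → HasSize (subset vertices P) d → P x → P y → x ≈ y
    singleton {P = P} {x} {y} s px py = ≈-trans (≈-sym (strictlyInverse (x , px)))
      (≈-trans (Inverse.to-cong one (all-equal _ _)) (strictlyInverse (y , py)))
      where
      one : HasSize (subset vertices P) 1
      one = subst (HasSize (subset vertices P)) (halve (even-valency outs)) s
      strictlyInverse = Inverse.strictlyInverseˡ one
      all-equal : ∀ (i j : Fin 1) → i ≡ j
      all-equal fzero fzero = refl

    fixes : ∀ v g → to g v ≈ v → PreservesLevels g → ∀ {x} → Adjacent v x → to g x ≈ x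
    fixes v g gv g-pres {x} (inj₁ vx) = let e , eq = level-arc vx in
      singleton (out-size-at e v) (E-resp gv ≈-refl (to-arc g vx) , trans (g-pres x) eq) (vx , eq)
    fixes v g gv g-pres {x} (inj₂ xv) = let e , eq = level-arc-in xv in
      singleton (in-size-at e v) (E-resp ≈-refl gv (to-arc g xv) , trans (g-pres x) eq) (xv , eq)


-- The layers are those of the given `s`. Each equivalence therefore amounts to two facts: the case
-- at hand yields its own condition, and it refutes both the other case and the other condition. In
-- case (i) the assumptions of (d) to (g) are contradictory; in case (ii) the projection itself is
-- the required homomorphism.
corollary9 : ∀ {ℓ} → ExcludedMiddle ℓ →
    (Γ : Digraph ℓ ℓ ℓ) → VertexTransitive Γ → ArcTransitive Γ → TwoEnded Γ →
    let open Digraph Γ in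
    (Σ[ N ∈ NormalSubgroup (Aut Γ) ℓ ] FiniteOrbits Γ N × (CaseI Γ N ⊎ CaseII Γ N))
    ×
    ((N : NormalSubgroup (Aut Γ) ℓ) → FiniteOrbits Γ N →
    (s : CaseI Γ N ⊎ CaseII Γ N) →
    let Γ[_] = layer Γ N s in
    ((CaseI Γ N ⇔
    (∀ i v → v ∈ Γ[ i ] →
    In  v ≬ Γ[ i - 1ℤ ] × In  v ≬ Γ[ i + 1ℤ ]
    × Out v ≬ Γ[ i - 1ℤ ] × Out v ≬ Γ[ i + 1ℤ ]))
    × (CaseI Γ N → ∀ i →
    (∀ v → v ∈ Γ[ i ] →
    SameSize (subset vertices (Out v ∩ Γ[ i - 1ℤ ]))
    (subset vertices (Out v ∩ Γ[ i + 1ℤ ]))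
    × SameSize (subset vertices (In v ∩ Γ[ i - 1ℤ ]))
    (subset vertices (In v ∩ Γ[ i + 1ℤ ])))
    × Bipartite (induced Γ (Γ[ i ] ∪ Γ[ i + 1ℤ ]))
    × VertexTransitive (induced Γ (Γ[ i ] ∪ Γ[ i + 1ℤ ]))
    × ArcTransitive (induced Γ (Γ[ i ] ∪ Γ[ i + 1ℤ ]))))
    × ((CaseII Γ N ⇔
    (∀ i v → v ∈ Γ[ i ] → In v ⊆ Γ[ i - 1ℤ ] × Out v ⊆ Γ[ i + 1ℤ ]))
    × (CaseII Γ N → ∀ i →
    Bipartite (induced Γ (Γ[ i ] ∪ Γ[ i + 1ℤ ]))
    × ArcTransitive (induced Γ (Γ[ i ] ∪ Γ[ i + 1ℤ ]))
    × (∀ u v → u ∈ Γ[ i ] ∪ Γ[ i + 1ℤ ] → v ∈ Γ[ i ] ∪ Γ[ i + 1ℤ ] →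
    E u v → u ∈ Γ[ i ] × v ∈ Γ[ i + 1ℤ ])))
    × (∃[ d ] InValency Γ d × OutValency Γ d)
    × (∀ d → OutValency Γ d → ¬ 2 ∣ d → HasPropertyZ Γ)
    × (TwoArcTransitive Γ → Isomorphism (quotient Γ N) ℤ⃗-digraph × HasPropertyZ Γ)
    × (LocallyQuasiPrimitive Γ →
    ∀ v → MoreThanTwoElements (Group.setoid (Stabilizer Γ v)) → HasPropertyZ Γ)
    × (OutValency Γ 2 →
    ∀ v → MoreThanTwoElements (Group.setoid (Stabilizer Γ v)) → HasPropertyZ Γ))
corollary9 {ℓ} em Γ transitive arc-transitive (connected , R , S , R≁S , ends) =
  Existence.subgroup-exists em Γ connected transitive arc-transitive R S R≁S ends , λ
    { N finite (inj₁ I@(α , _)) →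
        let open OrbitLevels em Γ N finite
            open Layers em Γ connected transitive arc-transitive (ℤ-levelling α)
            open Bothways em Γ connected transitive arc-transitive R (ℤ-levelling α) (ℤ-climbs α) (ℤ-climbs-in α)
        in ( mk⇔ (λ _ → neighbours-on-both-sides) (λ _ → I)
           , λ _ i → symmetric-valencies i , strip-bipartite i , strip-vertex-transitive i (ℤ-climbs α)
             , λ {u} {v} {u′} {v′} → strip-arc-transitive i {u} {v} {u′} {v′} )
         , ( mk⇔ (λ II → contradiction II (caseI⇒¬caseII {Γ = Γ} {N} I)) (λ sides → ⊥-elim (not-oriented sides))
           , λ II → contradiction II (caseI⇒¬caseII {Γ = Γ} {N} I) )
         , (_ , in-valency , out-valency)
         , (λ _ outs odd → contradiction (2∣valency outs) odd)
         , (λ 2-arc-transitive → ⊥-elim (not-2-arc-transitive 2-arc-transitive))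
         , (λ quasi-primitive v large → contradiction large (quasi-primitive⇒small quasi-primitive v))
         , (λ outs v large → contradiction large (valency-2⇒small outs v))
    ; N finite (inj₂ II@(β , _)) →
        let open OrbitLevels em Γ N finite
            open Layers em Γ connected transitive arc-transitive (ℤ⃗-levelling β)
            open Oneway em Γ connected transitive arc-transitive R (ℤ⃗-levelling β) (ℤ⃗-oriented β)
              (λ j → Isomorphism.from β j , Isomorphism.strictlyInverseˡ β j)
        in ( mk⇔ (λ I → contradiction II (caseI⇒¬caseII {Γ = Γ} {N} I)) (λ sides → ⊥-elim (not-both-sides sides))
           , λ I → contradiction II (caseI⇒¬caseII {Γ = Γ} {N} I) )
         , ( mk⇔ (λ _ → in-below×out-above) (λ _ → II)
           , λ _ i → strip-bipartite i , (λ {u} {v} {u′} {v′} → strip-arc-transitive i {u} {v} {u′} {v′}) , strip-arcs i )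
         , valencies
         , (λ _ _ _ → property-Z)
         , (λ _ → β , property-Z)
         , (λ _ _ _ → property-Z)
         , (λ _ _ _ → property-Z)
    }
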